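{- Let $5\le k\le n$ be integers with $k$ odd, let $d=\frac{k-1}{2}$, let $C=(\mathbb{Z}_n,E)$ be the cycle with $E=\{\{u,u+1\}:u\in\mathbb{Z}_n\}$, and let $v:\mathbb{Z}_k\to\mathbb{Z}_n$ be injective. The half-chorded odd cycle inequality $\sum_{i\in\mathbb{Z}_k}(x_{v_iv_{i+d}}-x_{v_iv_{i+1}})\le k-3$ is facet-defining for $\mathrm{LMC}(C)$ if and only if $v$ is true to $C$.
   Context: $\mathbb{Z}_n$ is the ring of integers modulo $n$; indices of $v$ are taken modulo $k$. For $a,b\in\mathbb{Z}_n$, the interval $[a,b]=\{a,a+1,\dots,b\}$ (going forward from $a$ to $b$ around the cycle), $[a,b[\,=[a,b]\setminus\{b\}$, $]a,b]=[a,b]\setminus\{a\}$. A cyclic sequence $v:\mathbb{Z}_k\to\mathbb{Z}_n$ is true to $C$ if either $v_i\in[v_0,v_{i+1}[$ for all $i=0,\dots,k-2$, or $v_i\in\,]v_{i+1},v_0]$ for all $i=0,\dots,k-2$. A decomposition of $C$ is a partition of $\mathbb{Z}_n$ whose blocks induce connected subgraphs of $C$; its lifted multicut is the set of pairs $ab\in\binom{\mathbb{Z}_n}{2}$ with $a,b$ in distinct blocks. $\mathrm{LMC}(C)\subseteq\mathbb{R}^{\binom{\mathbb{Z}_n}{2}}$ is the convex hull of the characteristic vectors of these lifted multicuts over all decompositions of $C$.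
   Formalization: The polytope LMC(C), its points and affine independence are taken over the rational numbers instead of the reals; since its vertices are 0/1 vectors and the inequality is integral, being facet-defining is the same over both. -}

module Defs where

open import Level using (0ℓ)
open import Data.Nat as ℕ using (ℕ; zero; suc; NonZero; _∸_)
open import Data.Nat.DivMod using (_mod_; _%_; _/_)
open import Data.Fin using (Fin; toℕ)
import Data.Fin as F
open import Data.Integer using (+_)
open import Data.Rational using (ℚ; 0ℚ; 1ℚ; _+_; _*_; _-_; _≤_) renaming (_/_ to _÷_)
open import Data.Product using (Σ; _×_; ∃; _,_)
open import Data.Sum using (_⊎_)
open import Relation.Binary.PropositionalEquality using (_≡_; _≢_)
open import Relation.Nullary using (¬_; yes; no)

_+ₘ_ : ∀ {n} .{{_ : NonZero n}} → Fin n → ℕ → Fin n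
_+ₘ_ {n} a j = (toℕ a ℕ.+ j) mod n

fdist : ∀ {n} .{{_ : NonZero n}} → Fin n → Fin n → ℕ
fdist {n} a x = (toℕ x ℕ.+ (n ∸ toℕ a)) % n

-- x ∈ [a,b]  (going forward from a to b)
InCC : ∀ {n} .{{_ : NonZero n}} → Fin n → Fin n → Fin n → Set
InCC a b x = fdist a x ℕ.≤ fdist a b

InCO : ∀ {n} .{{_ : NonZero n}} → Fin n → Fin n → Fin n → Set
InCO a b x = InCC a b x × x ≢ b

InOC : ∀ {n} .{{_ : NonZero n}} → Fin n → Fin n → Fin n → Set
InOC a b x = InCC a b x × x ≢ a

at : ∀ {k n} .{{_ : NonZero k}} → (Fin k → Fin n) → ℕ → Fin n
at {k} v i = v (i mod k)

TrueTo : ∀ {k n} .{{_ : NonZero k}} .{{_ : NonZero n}} → (Fin k → Fin n) → Set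
TrueTo {k} v =
    (∀ (i : ℕ) → i ℕ.≤ k ∸ 2 → InCO (at v 0) (at v (suc i)) (at v i))
  ⊎ (∀ (i : ℕ) → i ℕ.≤ k ∸ 2 → InOC (at v (suc i)) (at v 0) (at v i))

-- A labelling f : ℤ_n → ℤ_n describes the partition into the nonempty
-- fibres of f.  Path f a b : a walk in C from a to b along which the label
-- stays constant (i.e. a walk inside the block of a).
data Path {n} .{{_ : NonZero n}} (f : Fin n → Fin n) (a : Fin n) : Fin n → Set where
  here : Path f a a
  fwd  : ∀ {b} → Path f a b → f (b +ₘ 1) ≡ f b → Path f a (b +ₘ 1)
  bwd  : ∀ {b} → Path f a b → f (b +ₘ (n ∸ 1)) ≡ f b → Path f a (b +ₘ (n ∸ 1))

IsDecomposition : ∀ {n} .{{_ : NonZero n}} → (Fin n → Fin n) → Set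
IsDecomposition f = ∀ a b → f a ≡ f b → Path f a b

Decomposition : (n : ℕ) .{{_ : NonZero n}} → Set
Decomposition n = Σ (Fin n → Fin n) IsDecomposition

-- Vectors in ℚ^{ℤ_n × ℤ_n}; coordinate (a,b) with a ≠ b stands for the
-- unordered pair ab (all points considered are symmetric, zero diagonal).

Vect : ℕ → Set
Vect n = Fin n → Fin n → ℚ

sumFin : (m : ℕ) → (Fin m → ℚ) → ℚ
sumFin zero    g = 0ℚ
sumFin (suc m) g = g F.zero + sumFin m (λ j → g (F.suc j))

lmcVec : ∀ {n} .{{_ : NonZero n}} → Decomposition n → Vect n
lmcVec (f , _) a b with f a F.≟ f b
... | yes _ = 0ℚ
... | no  _ = 1ℚ

LMC : (n : ℕ) .{{_ : NonZero n}} → Vect n → Set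
LMC n x =
  ∃ λ (m : ℕ) → Σ (Fin m → ℚ) λ λs → Σ (Fin m → Decomposition n) λ D →
    (∀ j → 0ℚ ≤ λs j) × (sumFin m λs ≡ 1ℚ) ×
    (∀ a b → x a b ≡ sumFin m (λ j → λs j * lmcVec (D j) a b))

AffinelyIndependent : ∀ {n m} → (Fin m → Vect n) → Set
AffinelyIndependent {n} {m} p =
  ∀ (λs : Fin m → ℚ) → sumFin m λs ≡ 0ℚ →
    (∀ a b → sumFin m (λ j → λs j * p j a b) ≡ 0ℚ) → ∀ j → λs j ≡ 0ℚ

HasDim : ∀ {n} → (Vect n → Set) → ℕ → Set
HasDim {n} S d =
  (Σ (Fin (suc d) → Vect n) λ p → (∀ j → S (p j)) × AffinelyIndependent p) ×
  (∀ (p : Fin (suc (suc d)) → Vect n) → (∀ j → S (p j)) → ¬ AffinelyIndependent p)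

FacetDefining : ∀ {n} → (Vect n → Set) → (Vect n → ℚ) → ℚ → Set
FacetDefining P α β =
  (∀ x → P x → α x ≤ β) ×
  (∃ λ d → HasDim P (suc d) × HasDim (λ x → P x × α x ≡ β) d)

-- Half-chorded odd cycle inequality, with d = (k-1)/2 = k / 2 for odd k:
--   Σ_{i ∈ ℤ_k} (x_{v_i v_{i+d}} - x_{v_i v_{i+1}}) ≤ k - 3

halfChordedLHS : ∀ {k n} .{{_ : NonZero k}} → (Fin k → Fin n) → Vect n → ℚ
halfChordedLHS {k} v x =
  sumFin k (λ i → x (at v (toℕ i)) (at v (toℕ i ℕ.+ k / 2))
                - x (at v (toℕ i)) (at v (suc (toℕ i))))

halfChordedRHS : ℕ → ℚ
halfChordedRHS k = (+ (k ∸ 3)) ÷ 1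

{-# OPTIONS --safe #-}

-- A decomposition D of the cycle is on the face iff #{uncut half-chords} + #{cut edges}
-- of the closed walk v equals 3; in general this number is at least 3, for every v.
--
-- If the closed polygon v₀ v₁ … has two crossing edges v_m v_{m+1} and v_t v_{t+1}, a block
-- containing both ends of one of them meets the other, and a decomposition of the face cuts
-- at most three edges; hence the face satisfies the further equation
-- x_{v_m v_{m+1}} + x_{v_t v_{t+1}} = x_{v_m v_t} + x_{v_{m+1} v_{t+1}} and is not a facet.
-- A polygon on the circle without crossing edges is traversed monotonically, i.e. v is true to C.
--
-- Conversely let v be true to C. Since the face misses the origin, it is a facet once no
-- nonzero functional L vanishes on its vertices. The vector of a decomposition into intervals
-- is half the sum of the cut vectors X of its blocks, and the second differences of X are the
-- unit vectors, so it suffices that L(X) = 0 for all intervals. For boundaries in the segments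
-- i < j of v, the vertices of the face with two or three blocks give linear relations between
-- the values D(i,j) = L(X), which force D(i,j) to depend on the gap alone, then to be an
-- arithmetic progression in the gap, and finally to vanish.

module Submission where

open import Defs
open import Data.Nat using (ℕ; NonZero; _≤_; _%_)
open import Data.Fin using (Fin)
open import Function.Definitions using (Injective)
open import Relation.Binary.PropositionalEquality using (_≡_)
open import Function.Bundles using (_⇔_)

open import Data.Empty using (⊥; ⊥-elim)
open import Data.Fin as Fin using (toℕ; punchIn)
import Data.Fin.Properties as Finₚ
open import Data.Integer as ℤ using (+≤+) renaming (+_ to ⁺_)
open import Data.Integer.GCD using (gcd)
import Data.Integer.Properties as ℤₚ
open import Data.List using (List; []; _∷_; length)
open import Data.List.Membership.Propositional using (_∈_; _∉_)
open import Data.List.Relation.Unary.All as All using (All) renaming ([] to ∅; _∷_ to _◂_)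
open import Data.List.Relation.Unary.AllPairs using () renaming ([] to []ᵘ; _∷_ to _∷ᵘ_)
open import Data.List.Relation.Unary.Any using (here; there)
open import Data.List.Relation.Unary.Unique.Propositional using (Unique)
open import Data.Nat using (zero; suc; _<_; _+_; _∸_; _*_; _/_; z≤n; s≤s)
open import Data.Nat.DivMod
open import Data.Nat.Properties
open import Data.Nat.Tactic.RingSolver using (solve)
open import Data.List.Membership.DecPropositional _≟_ using (_∈?_)
open import Data.Product using (Σ; ∃; _×_; _,_; proj₁; proj₂)
open import Data.Rational using (ℚ; 0ℚ; 1ℚ; 1/_; ↥_; *≤*; toℚᵘ; ≢-nonZero; nonNegative) 
  renaming (_+_ to _⊕_; _*_ to _⊗_; _-_ to _⊖_; -_ to ⊝_; _≤_ to _≤ℚ_; _/_ to _÷_)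
import Data.Rational.Properties as ℚₚ
import Data.Rational.Unnormalised as ℚᵘ
import Data.Rational.Unnormalised.Properties as ℚᵘₚ
open import Data.Sum using (_⊎_; inj₁; inj₂; [_,_]′; swap)
open import Function.Base using (case_of_)
open import Function.Bundles using (mk⇔)
open import Relation.Binary.Definitions using (tri<; tri≈; tri>)
open import Relation.Binary.PropositionalEquality using (_≢_; refl; sym; trans; ≢-sym; cong; cong₂; subst; subst₂; module ≡-Reasoning)
open import Relation.Nullary using (¬_; Dec; yes; no; ¬?; _×-dec_; contradiction)
open import Relation.Nullary.Decidable using (dec⇒maybe; decidable-stable)
import Tactic.RingSolver as Ring
import Tactic.RingSolver.Core.AlmostCommutativeRing as ACR

-- The bound 3 is a count on the closed walk. Two cut edges leave 2d - 1 others, so one of the two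
-- arcs between them has at least d edges and carries a half-chord; either that half-chord is uncut
-- or a third edge of the arc is cut.
--
-- The same count produces the vertices of the face. Among the k = 2d + 1 points v_i, an arc with at
-- most d of them contains no half-chord, and an arc with d + 1 of them contains exactly one,
-- joining its ends. So three blocks with at most d points each are tight, and so are two blocks
-- with d and d + 1 points.
--
-- As n may exceed k, a segment of v may hold several boundaries, while the relations for D speak of
-- one index per segment. They are therefore solved for an arbitrary choice of one boundary per
-- segment, and boundaries within a common segment are compared afterwards.

ringℚ : ACR.AlmostCommutativeRing _ _
ringℚ = ACR.fromCommutativeRing ℚₚ.+-*-commutativeRing λ x → dec⇒maybe (0ℚ ℚₚ.≟ x)

⊗-cancelˡ-0 : ∀ {x y} → x ≢ 0ℚ → x ⊗ y ≡ 0ℚ → y ≡ 0ℚ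
⊗-cancelˡ-0 {x} {y} x≢0 xy≡0 = begin
  y                  ≡⟨ ℚₚ.*-identityˡ y ⟨
  1ℚ ⊗ y             ≡⟨ cong (_⊗ y) (ℚₚ.*-inverseˡ x) ⟨
  (1/ x ⊗ x) ⊗ y     ≡⟨ ℚₚ.*-assoc (1/ x) x y ⟩
  1/ x ⊗ (x ⊗ y)     ≡⟨ cong (1/ x ⊗_) xy≡0 ⟩
  1/ x ⊗ 0ℚ          ≡⟨ ℚₚ.*-zeroʳ (1/ x) ⟩
  0ℚ ∎
  where
  open ≡-Reasoning
  instance _ = ≢-nonZero x≢0

-- Finite sums

sum-cong : ∀ m {g h : Fin m → ℚ} → (∀ j → g j ≡ h j) → sumFin m g ≡ sumFin m h
sum-cong zero    eq = refl
sum-cong (suc m) eq = cong₂ _⊕_ (eq Fin.zero) (sum-cong m λ j → eq (Fin.suc j))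

sum-0 : ∀ m → sumFin m (λ _ → 0ℚ) ≡ 0ℚ
sum-0 zero    = refl
sum-0 (suc m) = trans (ℚₚ.+-identityˡ _) (sum-0 m)

sum-⊕ : ∀ m (g h : Fin m → ℚ) → sumFin m (λ j → g j ⊕ h j) ≡ sumFin m g ⊕ sumFin m h
sum-⊕ zero    g h = refl
sum-⊕ (suc m) g h rewrite sum-⊕ m (λ j → g (Fin.suc j)) (λ j → h (Fin.suc j)) =
  interchange (g Fin.zero) (h Fin.zero) _ _
  where
  interchange : ∀ a b c e → a ⊕ b ⊕ (c ⊕ e) ≡ a ⊕ c ⊕ (b ⊕ e)
  interchange = Ring.solve-∀ ringℚ

sum-⊗ : ∀ m c (g : Fin m → ℚ) → sumFin m (λ j → c ⊗ g j) ≡ c ⊗ sumFin m g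
sum-⊗ zero    c g = sym (ℚₚ.*-zeroʳ c)
sum-⊗ (suc m) c g rewrite sum-⊗ m c (λ j → g (Fin.suc j)) = sym (ℚₚ.*-distribˡ-+ c _ _)

sum-⊗ʳ : ∀ m c (g : Fin m → ℚ) → sumFin m (λ j → g j ⊗ c) ≡ sumFin m g ⊗ c
sum-⊗ʳ m c g = trans (sum-cong m λ j → ℚₚ.*-comm (g j) c) (trans (sum-⊗ m c g) (ℚₚ.*-comm c _))

sum-⊖ : ∀ m (g h : Fin m → ℚ) → sumFin m (λ j → g j ⊖ h j) ≡ sumFin m g ⊖ sumFin m h
sum-⊖ zero    g h = refl
sum-⊖ (suc m) g h rewrite sum-⊖ m (λ j → g (Fin.suc j)) (λ j → h (Fin.suc j)) =
  interchange (g Fin.zero) (h Fin.zero) _ _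
  where
  interchange : ∀ a b c e → a ⊖ b ⊕ (c ⊖ e) ≡ a ⊕ c ⊖ (b ⊕ e)
  interchange = Ring.solve-∀ ringℚ

sum-mono : ∀ m {g h : Fin m → ℚ} → (∀ j → g j ≤ℚ h j) → sumFin m g ≤ℚ sumFin m h
sum-mono zero    le = ℚₚ.≤-refl
sum-mono (suc m) le = ℚₚ.+-mono-≤ (le Fin.zero) (sum-mono m λ j → le (Fin.suc j))

sum-1 : ∀ m → sumFin m (λ _ → 1ℚ) ≡ ⁺ m ÷ 1
sum-1 zero    = refl
sum-1 (suc m) = trans (cong (1ℚ ⊕_) (sum-1 m)) (ℚₚ.toℚᵘ-injective lemma)
  where
  open ℚᵘₚ.≃-Reasoning
  lemma : toℚᵘ (1ℚ ⊕ ⁺ m ÷ 1) ℚᵘ.≃ toℚᵘ (⁺ suc m ÷ 1)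
  lemma = begin
    toℚᵘ (1ℚ ⊕ ⁺ m ÷ 1)              ≈⟨ ℚₚ.toℚᵘ-homo-+ 1ℚ (⁺ m ÷ 1) ⟩
    toℚᵘ 1ℚ ℚᵘ.+ toℚᵘ (⁺ m ÷ 1)      ≈⟨ ℚᵘₚ.+-congʳ (toℚᵘ 1ℚ) (ℚₚ.toℚᵘ-fromℚᵘ (ℚᵘ.mkℚᵘ (⁺ m) 0)) ⟩
    toℚᵘ 1ℚ ℚᵘ.+ ℚᵘ.mkℚᵘ (⁺ m) 0      ≈⟨ ℚᵘ.*≡* (cong (λ z → (⁺ 1 ℤ.+ z) ℤ.* ⁺ 1) (ℤₚ.*-identityʳ (⁺ m))) ⟩
    ℚᵘ.mkℚᵘ (⁺ suc m) 0              ≈⟨ ℚₚ.toℚᵘ-fromℚᵘ (ℚᵘ.mkℚᵘ (⁺ suc m) 0) ⟨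
    toℚᵘ (⁺ suc m ÷ 1) ∎

δ : ℕ → ℕ → ℚ
δ zero    zero    = 1ℚ
δ zero    (suc t) = 0ℚ
δ (suc s) zero    = 0ℚ
δ (suc s) (suc t) = δ s t

δ-≡ : ∀ s → δ s s ≡ 1ℚ
δ-≡ zero    = refl
δ-≡ (suc s) = δ-≡ s

δ-≢ : ∀ {s t} → s ≢ t → δ s t ≡ 0ℚ
δ-≢ {zero}  {zero}  s≢t = contradiction refl s≢t
δ-≢ {zero}  {suc t} s≢t = refl
δ-≢ {suc s} {zero}  s≢t = refl
δ-≢ {suc s} {suc t} s≢t = δ-≢ λ eq → s≢t (cong suc eq)

sum-δ : ∀ m {s} → s < m → sumFin m (λ j → δ s (toℕ j)) ≡ 1ℚ
sum-δ (suc m) {zero}  _         = cong (1ℚ ⊕_) (sum-0 m)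
sum-δ (suc m) {suc s} (s≤s s<m) = trans (ℚₚ.+-identityˡ _) (sum-δ m s<m)

sum-δ-⊗ : ∀ m (i : Fin m) (c : Fin m → ℚ) → sumFin m (λ j → c j ⊗ δ (toℕ i) (toℕ j)) ≡ c i
sum-δ-⊗ (suc m) Fin.zero c = begin
  c Fin.zero ⊗ 1ℚ ⊕ sumFin m (λ j → c (Fin.suc j) ⊗ 0ℚ)
    ≡⟨ cong₂ _⊕_ (ℚₚ.*-identityʳ (c Fin.zero)) (trans (sum-cong m λ j → ℚₚ.*-zeroʳ (c (Fin.suc j))) (sum-0 m)) ⟩
  c Fin.zero ⊕ 0ℚ ≡⟨ ℚₚ.+-identityʳ _ ⟩
  c Fin.zero ∎
  where open ≡-Reasoning
sum-δ-⊗ (suc m) (Fin.suc i) c =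
  trans (cong₂ _⊕_ (ℚₚ.*-zeroʳ (c Fin.zero)) (sum-δ-⊗ m i λ j → c (Fin.suc j))) (ℚₚ.+-identityˡ _)

-- Linear algebra

-- Gaussian elimination on the first column. If the column vanishes, the first unit vector is a
-- solution; otherwise a row `p` with nonzero head clears it from the other rows, the smaller system
-- is solved, and row `p` determines the remaining coefficient.
homogeneous-solution : ∀ r m → r < m → (A : Fin r → Fin m → ℚ) →
  Σ (Fin m → ℚ) λ c → (∃ λ j → c j ≢ 0ℚ) × (∀ i → sumFin m (λ j → c j ⊗ A i j) ≡ 0ℚ)
homogeneous-solution r (suc m) r<m A with Finₚ.any? (λ i → ¬? (A i Fin.zero ℚₚ.≟ 0ℚ))
... | no all-zero = (λ j → δ 0 (toℕ j)) , (Fin.zero , ℚₚ.1≢0) , λ i →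
  begin
    sumFin (suc m) (λ j → δ 0 (toℕ j) ⊗ A i j)
      ≡⟨ sum-cong (suc m) (λ j → ℚₚ.*-comm (δ 0 (toℕ j)) (A i j)) ⟩
    sumFin (suc m) (λ j → A i j ⊗ δ 0 (toℕ j))
      ≡⟨ sum-δ-⊗ (suc m) Fin.zero (A i) ⟩
    A i Fin.zero
      ≡⟨ zero-entry i ⟩
    0ℚ ∎
  where
  open ≡-Reasoning
  zero-entry : ∀ i → A i Fin.zero ≡ 0ℚ
  zero-entry i with A i Fin.zero ℚₚ.≟ 0ℚ
  ... | yes eq = eq
  ... | no neq = contradiction (i , neq) all-zero
homogeneous-solution (suc r) (suc m) (s≤s r<m) A | yes (p , Ap≢0) =
  c , (Fin.suc (proj₁ c′≢0) , proj₂ c′≢0) , solves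
  where
  open ≡-Reasoning
  instance _ = ≢-nonZero Ap≢0
  ratio : Fin r → ℚ
  ratio i = A (punchIn p i) Fin.zero ⊗ 1/ A p Fin.zero
  ih = homogeneous-solution r m r<m λ i j → A (punchIn p i) (Fin.suc j) ⊖ ratio i ⊗ A p (Fin.suc j)
  c′ = proj₁ ih
  c′≢0 = proj₁ (proj₂ ih)
  row : Fin (suc r) → ℚ
  row i = sumFin m λ j → c′ j ⊗ A i (Fin.suc j)
  c : Fin (suc m) → ℚ
  c Fin.zero    = ⊝ (row p ⊗ 1/ A p Fin.zero)
  c (Fin.suc j) = c′ j
  pivot : ∀ a x y → a ⊗ x ≡ 1ℚ → ⊝ (y ⊗ x) ⊗ a ⊕ y ≡ 0ℚ
  pivot a x y ax≡1 = begin
    ⊝ (y ⊗ x) ⊗ a ⊕ y       ≡⟨ Ring.solve (a ∷ x ∷ y ∷ []) ringℚ ⟩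
    ⊝ (y ⊗ (a ⊗ x)) ⊕ y     ≡⟨ cong (λ z → ⊝ (y ⊗ z) ⊕ y) ax≡1 ⟩
    ⊝ (y ⊗ 1ℚ) ⊕ y          ≡⟨ Ring.solve (y ∷ []) ringℚ ⟩
    0ℚ ∎
  reduced : ∀ i → row (punchIn p i) ≡ ratio i ⊗ row p
  reduced i = begin
    row (punchIn p i)
      ≡⟨ move (row (punchIn p i)) (ratio i ⊗ row p) (trans (sym split) (proj₂ (proj₂ ih) i)) ⟩
    ratio i ⊗ row p ∎
    where
    move : ∀ x y → x ⊖ y ≡ 0ℚ → x ≡ y
    move x y eq = begin
      x           ≡⟨ Ring.solve (x ∷ y ∷ []) ringℚ ⟩
      (x ⊖ y) ⊕ y ≡⟨ cong (_⊕ y) eq ⟩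
      0ℚ ⊕ y      ≡⟨ ℚₚ.+-identityˡ y ⟩
      y ∎
    distrib : ∀ x a b s → x ⊗ (a ⊖ s ⊗ b) ≡ x ⊗ a ⊖ s ⊗ (x ⊗ b)
    distrib = Ring.solve-∀ ringℚ
    split : sumFin m (λ j → c′ j ⊗ (A (punchIn p i) (Fin.suc j) ⊖ ratio i ⊗ A p (Fin.suc j)))
          ≡ row (punchIn p i) ⊖ ratio i ⊗ row p
    split = begin
      _ ≡⟨ sum-cong m (λ j → distrib (c′ j) _ _ (ratio i)) ⟩
      _ ≡⟨ sum-⊖ m _ _ ⟩
      row (punchIn p i) ⊖ sumFin m (λ j → ratio i ⊗ (c′ j ⊗ A p (Fin.suc j)))
        ≡⟨ cong (row (punchIn p i) ⊖_) (sum-⊗ m (ratio i) _) ⟩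
      _ ∎
  solves : ∀ i → sumFin (suc m) (λ j → c j ⊗ A i j) ≡ 0ℚ
  solves i with p Finₚ.≟ i
  ... | yes refl = pivot (A p Fin.zero) (1/ A p Fin.zero) (row p) (ℚₚ.*-inverseʳ (A p Fin.zero))
  ... | no p≢i = subst (λ z → c Fin.zero ⊗ A z Fin.zero ⊕ row z ≡ 0ℚ) (Finₚ.punchIn-punchOut p≢i) (begin
    c Fin.zero ⊗ A z Fin.zero ⊕ row z
      ≡⟨ cong (c Fin.zero ⊗ A z Fin.zero ⊕_) (reduced (Fin.punchOut p≢i)) ⟩
    ⊝ (row p ⊗ 1/ A p Fin.zero) ⊗ A z Fin.zero ⊕ A z Fin.zero ⊗ 1/ A p Fin.zero ⊗ row p
      ≡⟨ cancel (row p) (1/ A p Fin.zero) (A z Fin.zero) ⟩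
    0ℚ ∎)
    where
    z = punchIn p (Fin.punchOut p≢i)
    cancel : ∀ y x a → ⊝ (y ⊗ x) ⊗ a ⊕ a ⊗ x ⊗ y ≡ 0ℚ
    cancel = Ring.solve-∀ ringℚ

sum-nonneg-0 : ∀ m (g : Fin m → ℚ) → (∀ j → 0ℚ ≤ℚ g j) → sumFin m g ≡ 0ℚ → ∀ j → g j ≡ 0ℚ
sum-nonneg-0 (suc m) g g≥0 eq = λ where
    Fin.zero    → head≡0
    (Fin.suc j) → sum-nonneg-0 m _ (λ j → g≥0 (Fin.suc j)) tail≡0 j
  where
  tail = sumFin m λ j → g (Fin.suc j)
  tail≥0 : 0ℚ ≤ℚ tail
  tail≥0 = subst (_≤ℚ tail) (sum-0 m) (sum-mono m λ j → g≥0 (Fin.suc j))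
  head≡0 : g Fin.zero ≡ 0ℚ
  head≡0 = ℚₚ.≤-antisym
    (subst₂ _≤ℚ_ (ℚₚ.+-identityʳ _) eq (ℚₚ.+-monoʳ-≤ (g Fin.zero) tail≥0)) (g≥0 Fin.zero)
  tail≡0 : tail ≡ 0ℚ
  tail≡0 = trans (sym (ℚₚ.+-identityˡ tail)) (trans (cong (_⊕ tail) (sym head≡0)) eq)

-- Linear functionals on vectors

record Linear {n} (L : Vect n → ℚ) : Set where
  field
    resp  : ∀ {x y} → (∀ a b → x a b ≡ y a b) → L x ≡ L y
    add   : ∀ x y → L (λ a b → x a b ⊕ y a b) ≡ L x ⊕ L y
    scale : ∀ c x → L (λ a b → c ⊗ x a b) ≡ c ⊗ L x

  null : ∀ {x} → (∀ a b → x a b ≡ 0ℚ) → L x ≡ 0ℚ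
  null {x} x≡0 = trans (resp λ a b → trans (x≡0 a b) (sym (ℚₚ.*-zeroˡ (x a b))))
    (trans (scale 0ℚ x) (ℚₚ.*-zeroˡ (L x)))

  combination : ∀ m (c : Fin m → ℚ) (p : Fin m → Vect n) →
    L (λ a b → sumFin m λ j → c j ⊗ p j a b) ≡ sumFin m λ j → c j ⊗ L (p j)
  combination zero    c p = null λ _ _ → refl
  combination (suc m) c p = trans (add _ _) (cong₂ _⊕_ (scale (c Fin.zero) (p Fin.zero)) (combination m (λ j → c (Fin.suc j)) λ j → p (Fin.suc j)))

open Linear

module _ {n : ℕ} where

  coordinate-linear : ∀ (a b : Fin n) → Linear λ x → x a b
  coordinate-linear a b = record
    { resp = λ eq → eq a b ; add = λ _ _ → refl ; scale = λ _ _ → refl }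

  ⊖-linear : ∀ {L M : Vect n → ℚ} → Linear L → Linear M → Linear λ x → L x ⊖ M x
  ⊖-linear {L} {M} l m = record
    { resp  = λ eq → cong₂ _⊖_ (resp l eq) (resp m eq)
    ; add   = λ x y → trans (cong₂ _⊖_ (add l x y) (add m x y)) (interchange (L x) (L y) (M x) (M y))
    ; scale = λ c x → trans (cong₂ _⊖_ (scale l c x) (scale m c x)) (distrib c (L x) (M x))
    }
    where
    interchange : ∀ a b c e → a ⊕ b ⊖ (c ⊕ e) ≡ a ⊖ c ⊕ (b ⊖ e)
    interchange = Ring.solve-∀ ringℚ
    distrib : ∀ c a b → c ⊗ a ⊖ c ⊗ b ≡ c ⊗ (a ⊖ b)
    distrib = Ring.solve-∀ ringℚ

  ⊗-linear : ∀ c {L : Vect n → ℚ} → Linear L → Linear λ x → c ⊗ L x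
  ⊗-linear c {L} l = record
    { resp  = λ eq → cong (c ⊗_) (resp l eq)
    ; add   = λ x y → trans (cong (c ⊗_) (add l x y)) (ℚₚ.*-distribˡ-+ c (L x) (L y))
    ; scale = λ e x → trans (cong (c ⊗_) (scale l e x)) (exchange c e (L x))
    }
    where
    exchange : ∀ c e a → c ⊗ (e ⊗ a) ≡ e ⊗ (c ⊗ a)
    exchange = Ring.solve-∀ ringℚ

  sum-linear : ∀ m {L : Fin m → Vect n → ℚ} → (∀ i → Linear (L i)) → Linear λ x → sumFin m λ i → L i x
  sum-linear m {L} l = record
    { resp  = λ eq → sum-cong m λ i → resp (l i) eq
    ; add   = λ x y → trans (sum-cong m λ i → add (l i) x y) (sum-⊕ m _ _)
    ; scale = λ c x → trans (sum-cong m λ i → scale (l i) c x) (sum-⊗ m c _)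
    }

  combination-≡0 : ∀ {L : Vect n → ℚ} → Linear L → ∀ m (c : Fin m → ℚ) (p : Fin m → Vect n) →
    (∀ a b → sumFin m (λ j → c j ⊗ p j a b) ≡ 0ℚ) → sumFin m (λ j → c j ⊗ L (p j)) ≡ 0ℚ
  combination-≡0 l m c p eq = trans (sym (combination l m c p)) (null l eq)

-- The coordinates of a symmetric vector with zero diagonal

-- The binomial coefficient `n` over 2. `Vect` stores every unordered pair twice and a diagonal as
-- well, so the linear algebra is done on the entries with a < b.
#pairs : ℕ → ℕ
#pairs zero    = 0
#pairs (suc n) = n + #pairs n

pair : ∀ n → Fin (#pairs n) → Fin n × Fin n
pair (suc n) i with Fin.splitAt n i
... | inj₁ b = Fin.zero , Fin.suc b
... | inj₂ j = Fin.suc (proj₁ (pair n j)) , Fin.suc (proj₂ (pair n j))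

pair-< : ∀ n i → toℕ (proj₁ (pair n i)) < toℕ (proj₂ (pair n i))
pair-< (suc n) i with Fin.splitAt n i
... | inj₁ b = s≤s z≤n
... | inj₂ j = s≤s (pair-< n j)

pair-injective : ∀ n i j → pair n i ≡ pair n j → i ≡ j
pair-injective (suc n) i j eq with Fin.splitAt n i in eqᵢ | Fin.splitAt n j in eqⱼ
... | inj₁ a | inj₁ b with refl ← eq = begin
    i                                ≡⟨ Finₚ.join-splitAt n _ i ⟨
    Fin.join n _ (Fin.splitAt n i)   ≡⟨ cong (Fin.join n _) (trans eqᵢ (sym eqⱼ)) ⟩
    Fin.join n _ (Fin.splitAt n j)   ≡⟨ Finₚ.join-splitAt n _ j ⟩
    j ∎
  where open ≡-Reasoning
... | inj₁ a | inj₂ b = contradiction (cong proj₁ eq) λ ()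
... | inj₂ a | inj₁ b = contradiction (cong proj₁ eq) λ ()
... | inj₂ a | inj₂ b = begin
    i                                ≡⟨ Finₚ.join-splitAt n _ i ⟨
    Fin.join n _ (Fin.splitAt n i)   ≡⟨ cong (Fin.join n _) (trans eqᵢ (trans (cong inj₂ a≡b) (sym eqⱼ))) ⟩
    Fin.join n _ (Fin.splitAt n j)   ≡⟨ Finₚ.join-splitAt n _ j ⟩
    j ∎
  where
  open ≡-Reasoning
  a≡b : a ≡ b
  a≡b = pair-injective n a b (cong₂ _,_ (Finₚ.suc-injective (cong proj₁ eq)) (Finₚ.suc-injective (cong proj₂ eq)))

pair-surjective : ∀ n {a b : Fin n} → toℕ a < toℕ b → ∃ λ i → pair n i ≡ (a , b)
pair-surjective (suc n) {Fin.zero} {Fin.suc b} _ = Fin.join n (#pairs n) (inj₁ b) , eq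
  where
  eq : pair (suc n) (Fin.join n (#pairs n) (inj₁ b)) ≡ (Fin.zero , Fin.suc b)
  eq rewrite Finₚ.splitAt-↑ˡ n b (#pairs n) = refl
pair-surjective (suc n) {Fin.suc a} {Fin.suc b} (s≤s a<b) = Fin.join n (#pairs n) (inj₂ (proj₁ ih)) , eq
  where
  ih = pair-surjective n a<b
  eq : pair (suc n) (Fin.join n (#pairs n) (inj₂ (proj₁ ih))) ≡ (Fin.suc a , Fin.suc b)
  eq rewrite Finₚ.splitAt-↑ʳ n (#pairs n) (proj₁ ih) | proj₂ ih = refl

entry : ∀ {n} → Vect n → Fin (#pairs n) → ℚ
entry {n} x i = x (proj₁ (pair n i)) (proj₂ (pair n i))

record SymmetricHollow {n} (x : Vect n) : Set where
  field
    symmetric : ∀ a b → x a b ≡ x b a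
    hollow    : ∀ a → x a a ≡ 0ℚ

open SymmetricHollow

entries-≡0 : ∀ {n} {x : Vect n} → SymmetricHollow x → (∀ i → entry x i ≡ 0ℚ) → ∀ a b → x a b ≡ 0ℚ
entries-≡0 {n} {x} sh eq a b with <-cmp (toℕ a) (toℕ b)
... | tri< a<b _ _ = at-pair (pair-surjective n a<b)
  where
  at-pair : (∃ λ i → pair n i ≡ (a , b)) → x a b ≡ 0ℚ
  at-pair (i , refl) = eq i
... | tri≈ _ a≡b _ = subst (λ z → x a z ≡ 0ℚ) (Finₚ.toℕ-injective a≡b) (hollow sh a)
... | tri> _ _ b<a = trans (symmetric sh a b) (at-pair (pair-surjective n b<a))
  where
  at-pair : (∃ λ i → pair n i ≡ (b , a)) → x b a ≡ 0ℚ
  at-pair (i , refl) = eq i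

combination-symmetricHollow : ∀ {n} m (c : Fin m → ℚ) {p : Fin m → Vect n} →
  (∀ j → SymmetricHollow (p j)) → SymmetricHollow λ a b → sumFin m λ j → c j ⊗ p j a b
combination-symmetricHollow m c sh = record
  { symmetric = λ a b → sum-cong m λ j → cong (c j ⊗_) (symmetric (sh j) a b)
  ; hollow    = λ a → trans (sum-cong m λ j → trans (cong (c j ⊗_) (hollow (sh j) a)) (ℚₚ.*-zeroʳ (c j))) (sum-0 m)
  }

-- Faces of the lifted multicut polytope

module _ {n : ℕ} .{{_ : NonZero n}} where

  lmcVec-≡ : ∀ (D : Decomposition n) {a b} → proj₁ D a ≡ proj₁ D b → lmcVec D a b ≡ 0ℚ
  lmcVec-≡ (f , _) {a} {b} eq with f a Fin.≟ f b
  ... | yes _  = refl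
  ... | no neq = contradiction eq neq

  lmcVec-≢ : ∀ (D : Decomposition n) {a b} → proj₁ D a ≢ proj₁ D b → lmcVec D a b ≡ 1ℚ
  lmcVec-≢ (f , _) {a} {b} neq with f a Fin.≟ f b
  ... | yes eq = contradiction eq neq
  ... | no _   = refl

  lmcVec-symmetricHollow : ∀ (D : Decomposition n) → SymmetricHollow (lmcVec D)
  lmcVec-symmetricHollow D@(f , _) = record { symmetric = sym′ ; hollow = λ a → lmcVec-≡ D {a} refl }
    where
    sym′ : ∀ a b → lmcVec D a b ≡ lmcVec D b a
    sym′ a b with f a Fin.≟ f b
    ... | yes eq = sym (lmcVec-≡ D (sym eq))
    ... | no neq = sym (lmcVec-≢ D λ eq → neq (sym eq))

  lmcVec∈LMC : ∀ (D : Decomposition n) → LMC n (lmcVec D)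
  lmcVec∈LMC D = 1 , (λ _ → 1ℚ) , (λ _ → D) , (λ _ → 0≤1) , refl ,
    λ a b → sym (trans (ℚₚ.+-identityʳ _) (ℚₚ.*-identityˡ _))
    where
    0≤1 : 0ℚ ≤ℚ 1ℚ
    0≤1 = ℚₚ.nonNegative⁻¹ 1ℚ

  LMC-symmetricHollow : ∀ {x} → LMC n x → SymmetricHollow x
  LMC-symmetricHollow {x} (m , c , D , _ , _ , eq) = record
    { symmetric = λ a b → trans (eq a b) (trans (symmetric sh a b) (sym (eq b a)))
    ; hollow    = λ a → trans (eq a a) (hollow sh a)
    }
    where sh = combination-symmetricHollow m c λ j → lmcVec-symmetricHollow (D j)

  module _ {α : Vect n → ℚ} {β : ℚ} (α-linear : Linear α) (valid : ∀ D → α (lmcVec D) ≤ℚ β) where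

    LMC-value : ∀ {x} ((m , c , D , _) : LMC n x) → α x ≡ sumFin m λ j → c j ⊗ α (lmcVec (D j))
    LMC-value (m , c , D , _ , _ , eq) = trans (resp α-linear eq) (combination α-linear m c _)

    LMC-valid : ∀ x → LMC n x → α x ≤ℚ β
    LMC-valid x x∈@(m , c , D , c≥0 , Σc≡1 , eq) = subst₂ _≤ℚ_ (sym (LMC-value x∈))
      (trans (sum-⊗ʳ m β c) (trans (cong (_⊗ β) Σc≡1) (ℚₚ.*-identityˡ β)))
      (sum-mono m λ j → ℚₚ.*-monoˡ-≤-nonNeg (c j) {{nonNegative (c≥0 j)}} (valid (D j)))

    -- Complementary slackness: the weighted slacks of a convex combination on the face are
    -- nonnegative with sum 0, so every vertex of nonzero weight is itself tight.
    LMC-face : ∀ {α′} → Linear α′ → (∀ D → α (lmcVec D) ≡ β → α′ (lmcVec D) ≡ 0ℚ) →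
      ∀ x → LMC n x → α x ≡ β → α′ x ≡ 0ℚ
    LMC-face {α′} α′-linear tight x x∈@(m , c , D , c≥0 , Σc≡1 , eq) αx≡β = begin
      α′ x                                        ≡⟨ resp α′-linear eq ⟩
      _                                           ≡⟨ combination α′-linear m c _ ⟩
      sumFin m (λ j → c j ⊗ α′ (lmcVec (D j)))    ≡⟨ sum-cong m term≡0 ⟩
      sumFin m (λ _ → 0ℚ)                         ≡⟨ sum-0 m ⟩
      0ℚ ∎
      where
      open ≡-Reasoning
      slack : Fin m → ℚ
      slack j = β ⊖ α (lmcVec (D j))
      slack≥0 : ∀ j → 0ℚ ≤ℚ slack j
      slack≥0 j = subst (_≤ℚ slack j) (ℚₚ.+-inverseʳ (α (lmcVec (D j))))
        (ℚₚ.+-monoˡ-≤ (⊝ α (lmcVec (D j))) (valid (D j)))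
      total≡0 : sumFin m (λ j → c j ⊗ slack j) ≡ 0ℚ
      total≡0 = begin
        sumFin m (λ j → c j ⊗ slack j)
          ≡⟨ sum-cong m (λ j → distrib (c j) β (α (lmcVec (D j)))) ⟩
        sumFin m (λ j → c j ⊗ β ⊖ c j ⊗ α (lmcVec (D j)))
          ≡⟨ sum-⊖ m _ _ ⟩
        sumFin m (λ j → c j ⊗ β) ⊖ sumFin m (λ j → c j ⊗ α (lmcVec (D j)))
          ≡⟨ cong₂ _⊖_ (trans (sum-⊗ʳ m β c) (trans (cong (_⊗ β) Σc≡1) (ℚₚ.*-identityˡ β))) (trans (sym (LMC-value x∈)) αx≡β) ⟩
        β ⊖ β
          ≡⟨ ℚₚ.+-inverseʳ β ⟩
        0ℚ ∎
        where
        distrib : ∀ c a b → c ⊗ (a ⊖ b) ≡ c ⊗ a ⊖ c ⊗ b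
        distrib = Ring.solve-∀ ringℚ
      weighted≡0 : ∀ j → c j ⊗ slack j ≡ 0ℚ
      weighted≡0 = sum-nonneg-0 m _ (λ j → subst (_≤ℚ c j ⊗ slack j) (ℚₚ.*-zeroʳ (c j))
        (ℚₚ.*-monoˡ-≤-nonNeg (c j) {{nonNegative (c≥0 j)}} (slack≥0 j))) total≡0
      slack-0 : ∀ u v → u ⊖ v ≡ 0ℚ → v ≡ u
      slack-0 u v eq = begin
        v            ≡⟨ Ring.solve (u ∷ v ∷ []) ringℚ ⟩
        u ⊖ (u ⊖ v)  ≡⟨ cong (u ⊖_) eq ⟩
        u ⊖ 0ℚ       ≡⟨ ℚₚ.+-identityʳ u ⟩
        u ∎
      term≡0 : ∀ j → c j ⊗ α′ (lmcVec (D j)) ≡ 0ℚ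
      term≡0 j with c j ℚₚ.≟ 0ℚ
      ... | yes cⱼ≡0 = trans (cong (_⊗ α′ (lmcVec (D j))) cⱼ≡0) (ℚₚ.*-zeroˡ (α′ (lmcVec (D j))))
      ... | no cⱼ≢0  = trans (cong (c j ⊗_) (tight (D j) (slack-0 _ _ (⊗-cancelˡ-0 cⱼ≢0 (weighted≡0 j))))) (ℚₚ.*-zeroʳ (c j))

    module _ (β≢0 : β ≢ 0ℚ) (O : Decomposition n) (O≡0 : ∀ a b → lmcVec O a b ≡ 0ℚ) where

      -- On a hyperplane `α` = `β` with `β` ≠ 0 every linear dependence is affine: `α` turns it into
      -- `β` times the sum of its coefficients.
      tail-sum-0 : ∀ m (c : Fin m → ℚ) (p : Fin m → Vect n) → (∀ j → α (p j) ≡ β) →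
        sumFin m (λ j → c j ⊗ α (p j)) ≡ 0ℚ → sumFin m c ≡ 0ℚ
      tail-sum-0 m c p tight eq = ⊗-cancelˡ-0 β≢0 (begin
        β ⊗ sumFin m c                  ≡⟨ ℚₚ.*-comm β _ ⟩
        sumFin m c ⊗ β                  ≡⟨ sum-⊗ʳ m β c ⟨
        sumFin m (λ j → c j ⊗ β)        ≡⟨ sum-cong m (λ j → cong (c j ⊗_) (tight j)) ⟨
        sumFin m (λ j → c j ⊗ α (p j))  ≡⟨ eq ⟩
        0ℚ ∎)
        where open ≡-Reasoning

      -- The face is contained in the hyperplane α′ = 0, so its dimension drops by
      -- two: both the origin and Q are affinely independent of it.
      second-equation⇒¬facet : ∀ {α′} → Linear α′ → (∀ D → α (lmcVec D) ≡ β → α′ (lmcVec D) ≡ 0ℚ) →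
        (Q : Decomposition n) → α′ (lmcVec Q) ≢ 0ℚ → ¬ FacetDefining (LMC n) α β
      second-equation⇒¬facet {α′} α′-linear tight Q α′Q≢0 (_ , d , (_ , upper) , (p , p∈ , p-indep) , _) =
        upper points points∈ points-indep
        where
        open ≡-Reasoning
        pad₁ : ∀ x c → x ⊗ c ≡ c ⊗ x ⊕ (0ℚ ⊕ 0ℚ)
        pad₁ = Ring.solve-∀ ringℚ
        pad₂ : ∀ x c s → s ≡ 0ℚ ⊗ x ⊕ (c ⊗ 0ℚ ⊕ s)
        pad₂ = Ring.solve-∀ ringℚ
        pad₃ : ∀ c → c ≡ 0ℚ ⊕ (c ⊕ 0ℚ)
        pad₃ = Ring.solve-∀ ringℚ
        points : Fin (suc (suc (suc d))) → Vect n
        points Fin.zero                = lmcVec Q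
        points (Fin.suc Fin.zero)      = lmcVec O
        points (Fin.suc (Fin.suc j))   = p j
        points∈ : ∀ j → LMC n (points j)
        points∈ Fin.zero              = lmcVec∈LMC Q
        points∈ (Fin.suc Fin.zero)    = lmcVec∈LMC O
        points∈ (Fin.suc (Fin.suc j)) = proj₁ (p∈ j)
        points-indep : AffinelyIndependent points
        points-indep c Σc≡0 eq = λ where
            Fin.zero              → cQ≡0
            (Fin.suc Fin.zero)    → cO≡0
            (Fin.suc (Fin.suc j)) → p-indep c″ Σc″≡0 p-eq j
          where
          cQ = c Fin.zero
          cO = c (Fin.suc Fin.zero)
          c″ : Fin (suc d) → ℚ
          c″ j = c (Fin.suc (Fin.suc j))
          α′p≡0 : ∀ j → α′ (p j) ≡ 0ℚ
          α′p≡0 j = LMC-face α′-linear tight (p j) (proj₁ (p∈ j)) (proj₂ (p∈ j))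
          -- `α′` vanishes at the origin and on the face, so it isolates the coefficient of `Q`.
          cQ≡0 : cQ ≡ 0ℚ
          cQ≡0 = ⊗-cancelˡ-0 α′Q≢0 (begin
            α′ (lmcVec Q) ⊗ cQ
              ≡⟨ pad₁ (α′ (lmcVec Q)) cQ ⟩
            cQ ⊗ α′ (lmcVec Q) ⊕ (0ℚ ⊕ 0ℚ)
              ≡⟨ cong (cQ ⊗ α′ (lmcVec Q) ⊕_) (cong₂ _⊕_
                   (trans (cong (cO ⊗_) (null α′-linear O≡0)) (ℚₚ.*-zeroʳ cO))
                   (trans (sum-cong (suc d) λ j → trans (cong (c″ j ⊗_) (α′p≡0 j)) (ℚₚ.*-zeroʳ (c″ j))) (sum-0 (suc d)))) ⟨
            sumFin _ (λ j → c j ⊗ α′ (points j))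
              ≡⟨ combination-≡0 α′-linear _ c points eq ⟩
            0ℚ ∎)
          p-eq : ∀ a b → sumFin (suc d) (λ j → c″ j ⊗ p j a b) ≡ 0ℚ
          p-eq a b = begin
            sumFin (suc d) (λ j → c″ j ⊗ p j a b)
              ≡⟨ pad₂ (lmcVec Q a b) cO (sumFin (suc d) (λ j → c″ j ⊗ p j a b)) ⟩
            0ℚ ⊗ lmcVec Q a b ⊕ (cO ⊗ 0ℚ ⊕ sumFin (suc d) (λ j → c″ j ⊗ p j a b))
              ≡⟨ cong₂ (λ s t → s ⊗ lmcVec Q a b ⊕ (cO ⊗ t ⊕ sumFin (suc d) (λ j → c″ j ⊗ p j a b))) cQ≡0 (O≡0 a b) ⟨
            sumFin _ (λ j → c j ⊗ points j a b)
              ≡⟨ eq a b ⟩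
            0ℚ ∎
          Σc″≡0 : sumFin (suc d) c″ ≡ 0ℚ
          Σc″≡0 = tail-sum-0 (suc d) c″ p (λ j → proj₂ (p∈ j)) (combination-≡0 α-linear _ c″ p p-eq)
          cO≡0 : cO ≡ 0ℚ
          cO≡0 = begin
            cO                                ≡⟨ pad₃ cO ⟩
            0ℚ ⊕ (cO ⊕ 0ℚ)                    ≡⟨ cong₂ (λ s t → s ⊕ (cO ⊕ t)) cQ≡0 Σc″≡0 ⟨
            sumFin _ c                        ≡⟨ Σc≡0 ⟩
            0ℚ ∎

      Independent : ∀ {r} → (Fin r → Decomposition n) → Set
      Independent {r} D = ∀ (c : Fin r → ℚ) →
        (∀ i → sumFin r (λ j → c j ⊗ entry (lmcVec (D j)) i) ≡ 0ℚ) → ∀ j → c j ≡ 0ℚ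

      module _ (spanning : ∀ (c : Fin (#pairs n) → ℚ) → (∃ λ i → c i ≢ 0ℚ) →
                 ∃ λ D → α (lmcVec D) ≡ β × sumFin (#pairs n) (λ i → c i ⊗ entry (lmcVec D) i) ≢ 0ℚ) where

        entry-functional : (Fin (#pairs n) → ℚ) → Vect n → ℚ
        entry-functional c x = sumFin (#pairs n) (λ i → c i ⊗ entry x i)

        entry-functional-linear : ∀ c → Linear (entry-functional c)
        entry-functional-linear c = sum-linear (#pairs n) λ i → ⊗-linear (c i) (coordinate-linear _ _)

        -- Greedy extension: fewer than `#pairs n` vectors leave a nonzero functional `e` that
        -- vanishes on all of them, and `spanning` supplies a tight decomposition on which `e` does
        -- not vanish. Applying `e` to a dependence isolates the coefficient of the new vector.
        independent-family : ∀ r → r ≤ #pairs n →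
          Σ (Fin r → Decomposition n) λ D → (∀ j → α (lmcVec (D j)) ≡ β) × Independent D
        independent-family zero    _   = (λ ()) , (λ ()) , λ _ _ ()
        independent-family (suc r) r<N with independent-family r (<⇒≤ r<N)
        ... | D , D-tight , D-indep
            with homogeneous-solution r (#pairs n) r<N (λ j i → entry (lmcVec (D j)) i)
        ... | e , e≢0 , e⊥D with spanning e e≢0
        ... | D₀ , D₀-tight , eD₀≢0 = D′ , D′-tight , D′-indep
          where
          open ≡-Reasoning
          pad₄ : ∀ x c → x ⊗ c ≡ c ⊗ x ⊕ 0ℚ
          pad₄ = Ring.solve-∀ ringℚ
          pad₅ : ∀ x s → s ≡ 0ℚ ⊗ x ⊕ s
          pad₅ = Ring.solve-∀ ringℚ
          D′ : Fin (suc r) → Decomposition n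
          D′ Fin.zero    = D₀
          D′ (Fin.suc j) = D j
          D′-tight : ∀ j → α (lmcVec (D′ j)) ≡ β
          D′-tight Fin.zero    = D₀-tight
          D′-tight (Fin.suc j) = D-tight j
          D′-indep : Independent D′
          D′-indep c eq = λ where
              Fin.zero    → c₀≡0
              (Fin.suc j) → D-indep (λ j → c (Fin.suc j)) tail-eq j
            where
            c₀ = c Fin.zero
            all-eq : ∀ a b → sumFin (suc r) (λ j → c j ⊗ lmcVec (D′ j) a b) ≡ 0ℚ
            all-eq = entries-≡0 (combination-symmetricHollow (suc r) c λ j → lmcVec-symmetricHollow (D′ j)) eq
            c₀≡0 : c₀ ≡ 0ℚ
            c₀≡0 = ⊗-cancelˡ-0 eD₀≢0 (begin
              entry-functional e (lmcVec D₀) ⊗ c₀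
                ≡⟨ pad₄ (entry-functional e (lmcVec D₀)) c₀ ⟩
              c₀ ⊗ entry-functional e (lmcVec D₀) ⊕ 0ℚ
                ≡⟨ cong (c₀ ⊗ entry-functional e (lmcVec D₀) ⊕_) (trans (sum-cong r λ j → trans (cong (c (Fin.suc j) ⊗_) (e⊥D j)) (ℚₚ.*-zeroʳ (c (Fin.suc j)))) (sum-0 r)) ⟨
              sumFin (suc r) (λ j → c j ⊗ entry-functional e (lmcVec (D′ j)))
                ≡⟨ combination-≡0 (entry-functional-linear e) (suc r) c (λ j → lmcVec (D′ j)) all-eq ⟩
              0ℚ ∎)
            tail-eq : ∀ i → sumFin r (λ j → c (Fin.suc j) ⊗ entry (lmcVec (D j)) i) ≡ 0ℚ
            tail-eq i = begin
              rest                                    ≡⟨ pad₅ (entry (lmcVec D₀) i) rest ⟩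
              0ℚ ⊗ entry (lmcVec D₀) i ⊕ rest         ≡⟨ cong (λ z → z ⊗ entry (lmcVec D₀) i ⊕ rest) c₀≡0 ⟨
              c₀ ⊗ entry (lmcVec D₀) i ⊕ rest         ≡⟨ eq i ⟩
              0ℚ ∎
              where rest = sumFin r λ j → c (Fin.suc j) ⊗ entry (lmcVec (D j)) i

        -- The hyperplane α = β misses the origin, so linearly independent points
        -- of the face stay affinely independent when the origin is added.
        spanning⇒facet : ∀ d → #pairs n ≡ suc d → FacetDefining (LMC n) α β
        spanning⇒facet d N≡ = LMC-valid , d , (polytope-lower , polytope-upper) , face-lower , face-upper
          where
          open ≡-Reasoning
          pad₆ : ∀ c s → s ≡ c ⊗ 0ℚ ⊕ s
          pad₆ = Ring.solve-∀ ringℚ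
          family = independent-family (suc d) (≤-reflexive (sym N≡))
          D = proj₁ family
          D-tight = proj₁ (proj₂ family)
          D-indep = proj₂ (proj₂ family)
          points : Fin (suc (suc d)) → Vect n
          points Fin.zero    = lmcVec O
          points (Fin.suc j) = lmcVec (D j)
          polytope-lower : Σ (Fin (suc (suc d)) → Vect n) λ p → (∀ j → LMC n (p j)) × AffinelyIndependent p
          polytope-lower = points , (λ { Fin.zero → lmcVec∈LMC O ; (Fin.suc j) → lmcVec∈LMC (D j) }) , indep
            where
            indep : AffinelyIndependent points
            indep c Σc≡0 eq = λ where
                Fin.zero    → c₀≡0
                (Fin.suc j) → tail≡0 j
              where
              tail≡0 : ∀ j → c (Fin.suc j) ≡ 0ℚ
              tail≡0 = D-indep (λ j → c (Fin.suc j)) λ i → begin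
                rest i                            ≡⟨ pad₆ (c Fin.zero) (rest i) ⟩
                c Fin.zero ⊗ 0ℚ ⊕ rest i          ≡⟨ cong (λ z → c Fin.zero ⊗ z ⊕ rest i) (O≡0 _ _) ⟨
                sumFin _ (λ j → c j ⊗ entry (points j) i) ≡⟨ eq _ _ ⟩
                0ℚ ∎
                where
                rest : Fin (#pairs n) → ℚ
                rest i = sumFin (suc d) λ j → c (Fin.suc j) ⊗ entry (lmcVec (D j)) i
              c₀≡0 : c Fin.zero ≡ 0ℚ
              c₀≡0 = begin
                c Fin.zero                                       ≡⟨ ℚₚ.+-identityʳ (c Fin.zero) ⟨
                c Fin.zero ⊕ 0ℚ                                  ≡⟨ cong (c Fin.zero ⊕_) (trans (sum-cong (suc d) tail≡0) (sum-0 (suc d))) ⟨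
                sumFin _ c                                       ≡⟨ Σc≡0 ⟩
                0ℚ ∎
          polytope-upper : ∀ (p : Fin (suc (suc (suc d))) → Vect n) → (∀ j → LMC n (p j)) → ¬ AffinelyIndependent p
          polytope-upper p p∈ indep with homogeneous-solution (suc (#pairs n)) (suc (suc (suc d))) (s≤s (s≤s (≤-reflexive N≡))) rows
            where
            rows : Fin (suc (#pairs n)) → Fin (suc (suc (suc d))) → ℚ
            -- The row of ones forces the coefficients to sum to 0; on the face, `tail-sum-0`
            -- derives this from `α` = `β`.
            rows Fin.zero    j = 1ℚ
            rows (Fin.suc i) j = entry (p j) i
          ... | c , (j , cⱼ≢0) , c⊥ = cⱼ≢0 (indep c
                  (trans (sum-cong (suc (suc (suc d))) λ j → sym (ℚₚ.*-identityʳ (c j))) (c⊥ Fin.zero))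
                  (entries-≡0 (combination-symmetricHollow _ c λ j → LMC-symmetricHollow (p∈ j)) (λ i → c⊥ (Fin.suc i))) j)
          face-lower : Σ (Fin (suc d) → Vect n) λ p → (∀ j → LMC n (p j) × α (p j) ≡ β) × AffinelyIndependent p
          face-lower = (λ j → lmcVec (D j)) , (λ j → lmcVec∈LMC (D j) , D-tight j) , λ c _ eq → D-indep c λ i → eq _ _
          face-upper : ∀ (p : Fin (suc (suc d)) → Vect n) → (∀ j → LMC n (p j) × α (p j) ≡ β) → ¬ AffinelyIndependent p
          face-upper p p∈ indep with homogeneous-solution (#pairs n) (suc (suc d)) (s≤s (≤-reflexive N≡)) (λ i j → entry (p j) i)
          ... | c , (j , cⱼ≢0) , c⊥ = cⱼ≢0 (indep c
                  (tail-sum-0 _ c p (λ j → proj₂ (p∈ j)) (combination-≡0 α-linear _ c p all-eq)) all-eq j)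
            where
            all-eq : ∀ a b → sumFin (suc (suc d)) (λ j → c j ⊗ p j a b) ≡ 0ℚ
            all-eq = entries-≡0 (combination-symmetricHollow _ c λ j → LMC-symmetricHollow (proj₁ (p∈ j))) c⊥

-- The cycle and its decompositions into intervals

%-+ˡ : ∀ m t n .{{_ : NonZero n}} → (m % n + t) % n ≡ (m + t) % n
%-+ˡ m t n = begin
  (m % n + t) % n             ≡⟨ %-distribˡ-+ (m % n) t n ⟩
  (m % n % n + t % n) % n     ≡⟨ cong (λ z → (z + t % n) % n) (m%n%n≡m%n m n) ⟩
  (m % n + t % n) % n         ≡⟨ %-distribˡ-+ m t n ⟨
  (m + t) % n ∎
  where open ≡-Reasoning

module _ {n : ℕ} .{{_ : NonZero n}} where

  open ≡-Reasoning

  toℕ-+ₘ : ∀ (a : Fin n) j → toℕ (a +ₘ j) ≡ (toℕ a + j) % n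
  toℕ-+ₘ a j = Finₚ.toℕ-fromℕ< (m%n<n (toℕ a + j) n)

  toℕ%n : ∀ (a : Fin n) → toℕ a % n ≡ toℕ a
  toℕ%n a = m<n⇒m%n≡m (Finₚ.toℕ<n a)

  +ₘ-+ : ∀ (a : Fin n) s t → (a +ₘ s) +ₘ t ≡ a +ₘ (s + t)
  +ₘ-+ a s t = Finₚ.toℕ-injective (begin
    toℕ ((a +ₘ s) +ₘ t)           ≡⟨ toℕ-+ₘ (a +ₘ s) t ⟩
    (toℕ (a +ₘ s) + t) % n        ≡⟨ cong (λ z → (z + t) % n) (toℕ-+ₘ a s) ⟩
    ((toℕ a + s) % n + t) % n     ≡⟨ %-+ˡ (toℕ a + s) t n ⟩
    (toℕ a + s + t) % n           ≡⟨ cong (_% n) (+-assoc (toℕ a) s t) ⟩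
    (toℕ a + (s + t)) % n         ≡⟨ toℕ-+ₘ a (s + t) ⟨
    toℕ (a +ₘ (s + t)) ∎)

  +ₘ-0 : ∀ (a : Fin n) → a +ₘ 0 ≡ a
  +ₘ-0 a = Finₚ.toℕ-injective (trans (toℕ-+ₘ a 0) (trans (cong (_% n) (+-identityʳ (toℕ a))) (toℕ%n a)))

  +ₘ-n : ∀ (a : Fin n) → a +ₘ n ≡ a
  +ₘ-n a = Finₚ.toℕ-injective (trans (toℕ-+ₘ a n) (trans ([m+n]%n≡m%n (toℕ a) n) (toℕ%n a)))

  fdist<n : ∀ (a x : Fin n) → fdist a x < n
  fdist<n a x = m%n<n (toℕ x + (n ∸ toℕ a)) n

  +ₘ-fdist : ∀ (a x : Fin n) → a +ₘ fdist a x ≡ x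
  +ₘ-fdist a x = Finₚ.toℕ-injective (begin
    toℕ (a +ₘ fdist a x)                          ≡⟨ toℕ-+ₘ a (fdist a x) ⟩
    (toℕ a + (toℕ x + (n ∸ toℕ a)) % n) % n       ≡⟨ cong (_% n) (+-comm (toℕ a) _) ⟩
    ((toℕ x + (n ∸ toℕ a)) % n + toℕ a) % n       ≡⟨ %-+ˡ (toℕ x + (n ∸ toℕ a)) (toℕ a) n ⟩
    (toℕ x + (n ∸ toℕ a) + toℕ a) % n             ≡⟨ cong (_% n) (+-assoc (toℕ x) _ _) ⟩
    (toℕ x + (n ∸ toℕ a + toℕ a)) % n             ≡⟨ cong (λ z → (toℕ x + z) % n) (m∸n+n≡m (<⇒≤ (Finₚ.toℕ<n a))) ⟩
    (toℕ x + n) % n                               ≡⟨ [m+n]%n≡m%n (toℕ x) n ⟩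
    toℕ x % n                                     ≡⟨ toℕ%n x ⟩
    toℕ x ∎)

  fdist-+ₘ : ∀ (a : Fin n) {t} → t < n → fdist a (a +ₘ t) ≡ t
  fdist-+ₘ a {t} t<n = begin
    (toℕ (a +ₘ t) + (n ∸ toℕ a)) % n              ≡⟨ cong (λ z → (z + (n ∸ toℕ a)) % n) (toℕ-+ₘ a t) ⟩
    ((toℕ a + t) % n + (n ∸ toℕ a)) % n           ≡⟨ %-+ˡ (toℕ a + t) (n ∸ toℕ a) n ⟩
    (toℕ a + t + (n ∸ toℕ a)) % n                 ≡⟨ cong (λ z → (z + (n ∸ toℕ a)) % n) (+-comm (toℕ a) t) ⟩
    (t + toℕ a + (n ∸ toℕ a)) % n                 ≡⟨ cong (_% n) (+-assoc t (toℕ a) _) ⟩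
    (t + (toℕ a + (n ∸ toℕ a))) % n               ≡⟨ cong (λ z → (t + z) % n) (m+[n∸m]≡n (<⇒≤ (Finₚ.toℕ<n a))) ⟩
    (t + n) % n                                   ≡⟨ [m+n]%n≡m%n t n ⟩
    t % n                                         ≡⟨ m<n⇒m%n≡m t<n ⟩
    t ∎

  fdist-unique : ∀ {a x : Fin n} {t} → t < n → a +ₘ t ≡ x → fdist a x ≡ t
  fdist-unique t<n refl = fdist-+ₘ _ t<n

  fdist-injective : ∀ {o a b : Fin n} → fdist o a ≡ fdist o b → a ≡ b
  fdist-injective {o} {a} {b} eq = trans (sym (+ₘ-fdist o a)) (trans (cong (o +ₘ_) eq) (+ₘ-fdist o b))

  Adj : Fin n → Fin n → Set
  Adj a b = b ≡ a +ₘ 1 ⊎ a ≡ b +ₘ 1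

  1+[n∸1] : 1 + (n ∸ 1) ≡ n
  1+[n∸1] = suc-pred n

  +ₘ-1-pred : ∀ (a : Fin n) → (a +ₘ 1) +ₘ (n ∸ 1) ≡ a
  +ₘ-1-pred a = trans (+ₘ-+ a 1 (n ∸ 1)) (trans (cong (a +ₘ_) 1+[n∸1]) (+ₘ-n a))

  +ₘ-pred-1 : ∀ (a : Fin n) → (a +ₘ (n ∸ 1)) +ₘ 1 ≡ a
  +ₘ-pred-1 a = trans (+ₘ-+ a (n ∸ 1) 1) (trans (cong (a +ₘ_) (trans (+-comm (n ∸ 1) 1) 1+[n∸1])) (+ₘ-n a))

  module _ {f : Fin n → Fin n} where

    path-step : ∀ {a b c} → Path f a b → Adj b c → f c ≡ f b → Path f a c
    path-step p (inj₁ refl) eq = fwd p eq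
    path-step {c = c} p (inj₂ refl) eq = subst (Path f _) (+ₘ-1-pred c) (bwd p (trans (cong f (+ₘ-1-pred c)) eq))

    path-trans : ∀ {a b c} → Path f a b → Path f b c → Path f a c
    path-trans p here       = p
    path-trans p (fwd q eq) = fwd (path-trans p q) eq
    path-trans p (bwd q eq) = bwd (path-trans p q) eq

    path-sym : ∀ {a b} → Path f a b → Path f b a
    path-sym here               = here
    path-sym (fwd p eq)         = path-trans (path-step here (inj₂ refl) (sym eq)) (path-sym p)
    path-sym (bwd {b = b} p eq) = path-trans (path-step here (inj₁ (sym (+ₘ-pred-1 b))) (sym eq)) (path-sym p)

  -- An enumeration of the cycle along consecutive vertices, in either direction.
  record Frame : Set where
    field
      pos     : Fin n → ℕ
      vtx     : ℕ → Fin n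
      pos<n   : ∀ a → pos a < n
      vtx-pos : ∀ a → vtx (pos a) ≡ a
      pos-vtx : ∀ {p} → p < n → pos (vtx p) ≡ p
      -- `p` = n - 1 is included: the closing edge leads to position `n`, a second name of position
      -- 0.
      adj     : ∀ {p} → suc p ≤ n → Adj (vtx p) (vtx (suc p))
      wrap    : vtx n ≡ vtx 0

    pos-injective : ∀ {a b} → pos a ≡ pos b → a ≡ b
    pos-injective {a} {b} eq = trans (sym (vtx-pos a)) (trans (cong vtx eq) (vtx-pos b))

  forward : Fin n → Frame
  forward o = record
    { pos     = fdist o
    ; vtx     = o +ₘ_
    ; pos<n   = fdist<n o
    ; vtx-pos = +ₘ-fdist o
    ; pos-vtx = fdist-+ₘ o
    ; adj     = λ {p} _ → inj₁ (trans (cong (o +ₘ_) (+-comm 1 p)) (sym (+ₘ-+ o p 1)))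
    ; wrap    = trans (+ₘ-n o) (sym (+ₘ-0 o))
    }

  backward : Fin n → Frame
  backward o = record
    { pos     = λ x → fdist x o
    ; vtx     = λ p → o +ₘ (n ∸ p)
    ; pos<n   = λ x → fdist<n x o
    ; vtx-pos = λ x → begin
        o +ₘ (n ∸ fdist x o)                     ≡⟨ cong (_+ₘ (n ∸ fdist x o)) (+ₘ-fdist x o) ⟨
        (x +ₘ fdist x o) +ₘ (n ∸ fdist x o)      ≡⟨ +ₘ-+ x _ _ ⟩
        x +ₘ (fdist x o + (n ∸ fdist x o))       ≡⟨ cong (x +ₘ_) (m+[n∸m]≡n (<⇒≤ (fdist<n x o))) ⟩
        x +ₘ n                                   ≡⟨ +ₘ-n x ⟩
        x ∎
    ; pos-vtx = λ {p} p<n → fdist-unique p<n (begin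
        (o +ₘ (n ∸ p)) +ₘ p   ≡⟨ +ₘ-+ o _ _ ⟩
        o +ₘ (n ∸ p + p)      ≡⟨ cong (o +ₘ_) (m∸n+n≡m (<⇒≤ p<n)) ⟩
        o +ₘ n                ≡⟨ +ₘ-n o ⟩
        o ∎)
    ; adj     = λ {p} p<n → inj₂ (begin
        o +ₘ (n ∸ p)                ≡⟨ cong (o +ₘ_) (+-∸-assoc 1 p<n) ⟩
        o +ₘ (1 + (n ∸ suc p))      ≡⟨ cong (o +ₘ_) (+-comm 1 _) ⟩
        o +ₘ (n ∸ suc p + 1)        ≡⟨ +ₘ-+ o _ 1 ⟨
        (o +ₘ (n ∸ suc p)) +ₘ 1 ∎)
    ; wrap    = trans (cong (o +ₘ_) (n∸n≡0 n)) (trans (+ₘ-0 o) (sym (+ₘ-n o)))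
    }

  -- A walk leaving the open interval between lo and hi passes through lo or hi.
  confined : ∀ (o : Fin n) {f x y lo hi} → Path f x y → hi < n →
    lo < fdist o x → fdist o x < hi → f (o +ₘ lo) ≢ f x → f (o +ₘ hi) ≢ f x →
    f y ≡ f x × lo < fdist o y × fdist o y < hi
  confined o here hi<n lo<x x<hi ≢lo ≢hi = refl , lo<x , x<hi
  confined o {f} {x} {_} {lo} {hi} (fwd {b} path eq) hi<n lo<x x<hi ≢lo ≢hi
    with confined o path hi<n lo<x x<hi ≢lo ≢hi
  ... | fb≡fx , lo<b , b<hi = trans eq fb≡fx , <-trans lo<b (subst (fdist o b <_) (sym pos≡) (n<1+n _)) , next<hi
    where
    b+1≡ : b +ₘ 1 ≡ o +ₘ suc (fdist o b)
    b+1≡ = begin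
      b +ₘ 1                    ≡⟨ cong (_+ₘ 1) (+ₘ-fdist o b) ⟨
      (o +ₘ fdist o b) +ₘ 1     ≡⟨ +ₘ-+ o _ 1 ⟩
      o +ₘ (fdist o b + 1)      ≡⟨ cong (o +ₘ_) (+-comm _ 1) ⟩
      o +ₘ suc (fdist o b) ∎
    pos≡ : fdist o (b +ₘ 1) ≡ suc (fdist o b)
    pos≡ = fdist-unique (≤-<-trans b<hi hi<n) (sym b+1≡)
    next<hi : fdist o (b +ₘ 1) < hi
    next<hi = ≤∧≢⇒< (subst (_≤ hi) (sym pos≡) b<hi) λ at-hi → ≢hi (begin
      f (o +ₘ hi)                    ≡⟨ cong (λ z → f (o +ₘ z)) at-hi ⟨
      f (o +ₘ fdist o (b +ₘ 1))      ≡⟨ cong f (+ₘ-fdist o _) ⟩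
      f (b +ₘ 1)                     ≡⟨ eq ⟩
      f b                            ≡⟨ fb≡fx ⟩
      f x ∎)
  confined o {f} {x} {_} {lo} {hi} (bwd {b} path eq) hi<n lo<x x<hi ≢lo ≢hi
    with confined o path hi<n lo<x x<hi ≢lo ≢hi
  ... | fb≡fx , lo<b , b<hi = trans eq fb≡fx , lo<prev , <-trans prev<b b<hi
    where
    prev = b +ₘ (n ∸ 1)
    q = fdist o b ∸ 1
    1+q : suc q ≡ fdist o b
    1+q = trans (sym (+-∸-assoc 1 (≤-<-trans z≤n lo<b))) refl
    prev≡ : prev ≡ o +ₘ q
    prev≡ = begin
      b +ₘ (n ∸ 1)                    ≡⟨ cong (_+ₘ (n ∸ 1)) (+ₘ-fdist o b) ⟨
      (o +ₘ fdist o b) +ₘ (n ∸ 1)     ≡⟨ cong (λ z → (o +ₘ z) +ₘ (n ∸ 1)) (trans (sym 1+q) (+-comm 1 q)) ⟩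
      (o +ₘ (q + 1)) +ₘ (n ∸ 1)       ≡⟨ cong (_+ₘ (n ∸ 1)) (+ₘ-+ o q 1) ⟨
      ((o +ₘ q) +ₘ 1) +ₘ (n ∸ 1)      ≡⟨ +ₘ-1-pred (o +ₘ q) ⟩
      o +ₘ q ∎
    q<n : q < n
    q<n = ≤-<-trans (m∸n≤m _ 1) (fdist<n o b)
    pos≡ : fdist o prev ≡ q
    pos≡ = fdist-unique q<n (sym prev≡)
    prev<b : fdist o prev < fdist o b
    prev<b = subst₂ _≤_ (cong suc (sym pos≡)) 1+q ≤-refl
    lo<prev : lo < fdist o prev
    lo<prev = ≤∧≢⇒< (≤-pred (subst (suc lo ≤_) (trans (sym 1+q) (cong suc (sym pos≡))) lo<b)) λ at-lo → ≢lo (begin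
      f (o +ₘ lo)                    ≡⟨ cong (λ z → f (o +ₘ z)) at-lo ⟩
      f (o +ₘ fdist o prev)          ≡⟨ cong f (+ₘ-fdist o _) ⟩
      f prev                         ≡⟨ eq ⟩
      f b                            ≡⟨ fb≡fx ⟩
      f x ∎)

  module Intervals (F : Frame) {ℓ₀ ℓ₁ ℓ₂ : Fin n} (ℓ₀≢ℓ₁ : ℓ₀ ≢ ℓ₁) (ℓ₀≢ℓ₂ : ℓ₀ ≢ ℓ₂) (ℓ₁≢ℓ₂ : ℓ₁ ≢ ℓ₂) where
    open Frame F

    -- The blocks are [e , f[, [f , h[ and the complement of [e , h[, in positions.
    label : ℕ → ℕ → ℕ → ℕ → Fin n
    label e f h s with s <? e
    ... | yes _ = ℓ₀
    ... | no  _ with s <? f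
    ... | yes _ = ℓ₁
    ... | no  _ with s <? h
    ... | yes _ = ℓ₂
    ... | no  _ = ℓ₀

    -- The graph of `label`, for case analysis on labels instead of nested comparisons. Its
    -- constructors mirror the order of the tests, so it remains the graph when `e`, `f`, `h` are
    -- not in increasing order.
    data Region (e f h s : ℕ) : Fin n → Set where
      below  : s < e → Region e f h s ℓ₀
      first  : e ≤ s → s < f → Region e f h s ℓ₁
      second : e ≤ s → f ≤ s → s < h → Region e f h s ℓ₂
      above  : e ≤ s → f ≤ s → h ≤ s → Region e f h s ℓ₀

    region : ∀ e f h s → Region e f h s (label e f h s)
    region e f h s with s <? e
    ... | yes s<e = below s<e
    ... | no  s≮e with s <? f
    ... | yes s<f = first (≮⇒≥ s≮e) s<f
    ... | no  s≮f with s <? h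
    ... | yes s<h = second (≮⇒≥ s≮e) (≮⇒≥ s≮f) s<h
    ... | no  s≮h = above (≮⇒≥ s≮e) (≮⇒≥ s≮f) (≮⇒≥ s≮h)

    region-unique : ∀ {e f h s l l′} → Region e f h s l → Region e f h s l′ → l ≡ l′
    region-unique (below _)        (below _)        = refl
    region-unique (below p)        (first q _)      = contradiction p (≤⇒≯ q)
    region-unique (below p)        (second q _ _)   = contradiction p (≤⇒≯ q)
    region-unique (below p)        (above q _ _)    = refl
    region-unique (first q _)      (below p)        = contradiction p (≤⇒≯ q)
    region-unique (first _ _)      (first _ _)      = refl
    region-unique (first _ p)      (second _ q _)   = contradiction p (≤⇒≯ q)
    region-unique (first _ p)      (above _ q _)    = contradiction p (≤⇒≯ q)
    region-unique (second q _ _)   (below p)        = contradiction p (≤⇒≯ q)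
    region-unique (second _ q _)   (first _ p)      = contradiction p (≤⇒≯ q)
    region-unique (second _ _ _)   (second _ _ _)   = refl
    region-unique (second _ _ p)   (above _ _ q)    = contradiction p (≤⇒≯ q)
    region-unique (above _ _ _)    (below _)        = refl
    region-unique (above _ q _)    (first _ p)      = contradiction p (≤⇒≯ q)
    region-unique (above _ _ q)    (second _ _ p)   = contradiction p (≤⇒≯ q)
    region-unique (above _ _ _)    (above _ _ _)    = refl

    label-≡ : ∀ {e f h s l} → Region e f h s l → label e f h s ≡ l
    label-≡ {e} {f} {h} {s} r = region-unique (region e f h s) r

    module _ (e f h : ℕ) where

      block : Fin n → Fin n
      block a = label e f h (pos a)

      ascend : ∀ {l} p d → p + d ≤ n → (∀ s → p ≤ s → s ≤ p + d → s ≤ n → block (vtx s) ≡ l) →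
        Path block (vtx p) (vtx (p + d))
      ascend p zero    _   const = subst (λ z → Path block (vtx p) (vtx z)) (sym (+-identityʳ p)) here
      ascend p (suc d) le  const = subst (λ z → Path block (vtx p) (vtx z)) (sym (+-suc p d))
        (path-step (ascend p d (<⇒≤ le′) λ s p≤s s≤ s≤n → const s p≤s (≤-trans s≤ (+-monoʳ-≤ p (n≤1+n d))) s≤n)
          (adj le′)
          (trans (const (suc (p + d)) (≤-trans (m≤m+n p d) (n≤1+n _)) (≤-reflexive (sym (+-suc p d))) le′)
            (sym (const (p + d) (m≤m+n p d) (+-monoʳ-≤ p (n≤1+n d)) (<⇒≤ le′)))))
        where
        le′ : suc (p + d) ≤ n
        le′ = subst (_≤ n) (+-suc p d) le

      -- The walk may end at position `n`, which `pos` never returns; there the label is read off at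
      -- position 0.
      interval-path : ∀ {l p q} → p ≤ q → q ≤ n → (∀ s → p ≤ s → s ≤ q → s < n → Region e f h s l) →
        (q ≡ n → block (vtx 0) ≡ l) → Path block (vtx p) (vtx q)
      interval-path {l} {p} {q} p≤q q≤n reg end = subst (λ z → Path block (vtx p) (vtx z)) p+≡q
        (ascend p (q ∸ p) (subst (_≤ n) (sym p+≡q) q≤n) const)
        where
        p+≡q : p + (q ∸ p) ≡ q
        p+≡q = m+[n∸m]≡n p≤q
        const : ∀ s → p ≤ s → s ≤ p + (q ∸ p) → s ≤ n → block (vtx s) ≡ l
        const s p≤s s≤ s≤n with m≤n⇒m<n∨m≡n s≤n
        ... | inj₁ s<n  = trans (cong (label e f h) (pos-vtx s<n)) (label-≡ (reg s p≤s (subst (s ≤_) p+≡q s≤) s<n))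
        ... | inj₂ refl = trans (cong block wrap) (end (≤-antisym q≤n (subst (n ≤_) p+≡q s≤)))

      short-path : ∀ {l p q} → p ≤ q → q < n → (∀ s → p ≤ s → s ≤ q → Region e f h s l) → Path block (vtx p) (vtx q)
      short-path p≤q q<n reg = interval-path p≤q (<⇒≤ q<n) (λ s p≤s s≤q _ → reg s p≤s s≤q) λ q≡n → contradiction q≡n (<⇒≢ q<n)

      -- `below` and `above` form one block across the origin: in reverse, the walk climbs from `q`
      -- to position `n`, which is position 0, and goes on to `p`.
      around-path : ∀ {p q} → p < e → p < n → e ≤ q → f ≤ q → h ≤ q → q < n → Path block (vtx p) (vtx q)
      around-path {p} {q} p<e p<n e≤q f≤q h≤q q<n = path-sym (path-trans to-0
        (short-path z≤n p<n λ s _ s≤p → below (≤-<-trans s≤p p<e)))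
        where
        0<n : 0 < n
        0<n = ≤-<-trans z≤n p<n
        to-0 : Path block (vtx q) (vtx 0)
        to-0 = subst (Path block (vtx q)) wrap (interval-path (<⇒≤ q<n) ≤-refl
          (λ s q≤s _ _ → above (≤-trans e≤q q≤s) (≤-trans f≤q q≤s) (≤-trans h≤q q≤s))
          λ _ → trans (cong (label e f h) (pos-vtx 0<n)) (label-≡ (below (≤-<-trans z≤n p<e))))

      position-path : ∀ {l l′ p q} → p < n → q < n → Region e f h p l → Region e f h q l′ → l ≡ l′ → p ≤ q →
        Path block (vtx p) (vtx q)
      position-path p<n q<n (below _)      (below q<e)      _  p≤q = short-path p≤q q<n λ s _ s≤q → below (≤-<-trans s≤q q<e)
      position-path p<n q<n (below p<e)    (above x y z)    _  p≤q = around-path p<e p<n x y z q<n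
      position-path p<n q<n (first e≤p _)  (first _ q<f)    _  p≤q =
        short-path p≤q q<n λ s p≤s s≤q → first (≤-trans e≤p p≤s) (≤-<-trans s≤q q<f)
      position-path p<n q<n (second x y _) (second _ _ q<h) _  p≤q =
        short-path p≤q q<n λ s p≤s s≤q → second (≤-trans x p≤s) (≤-trans y p≤s) (≤-<-trans s≤q q<h)
      position-path p<n q<n (above x y z)  (above _ _ _)    _  p≤q =
        short-path p≤q q<n λ s p≤s s≤q → above (≤-trans x p≤s) (≤-trans y p≤s) (≤-trans z p≤s)
      position-path p<n q<n (above x _ _)  (below q<e)      _  p≤q = contradiction (≤-trans x p≤q) (<⇒≱ q<e)
      position-path p<n q<n (below _)      (first _ _)      eq p≤q = contradiction eq ℓ₀≢ℓ₁
      position-path p<n q<n (below _)      (second _ _ _)   eq p≤q = contradiction eq ℓ₀≢ℓ₂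
      position-path p<n q<n (first _ _)    (below _)        eq p≤q = contradiction (sym eq) ℓ₀≢ℓ₁
      position-path p<n q<n (first _ _)    (second _ _ _)   eq p≤q = contradiction eq ℓ₁≢ℓ₂
      position-path p<n q<n (first _ _)    (above _ _ _)    eq p≤q = contradiction (sym eq) ℓ₀≢ℓ₁
      position-path p<n q<n (second _ _ _) (below _)        eq p≤q = contradiction (sym eq) ℓ₀≢ℓ₂
      position-path p<n q<n (second _ _ _) (first _ _)      eq p≤q = contradiction (sym eq) ℓ₁≢ℓ₂
      position-path p<n q<n (second _ _ _) (above _ _ _)    eq p≤q = contradiction (sym eq) ℓ₀≢ℓ₂
      position-path p<n q<n (above _ _ _)  (first _ _)      eq p≤q = contradiction eq ℓ₀≢ℓ₁
      position-path p<n q<n (above _ _ _)  (second _ _ _)   eq p≤q = contradiction eq ℓ₀≢ℓ₂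

      block-isDecomposition : IsDecomposition block
      block-isDecomposition a b eq = subst₂ (Path block) (vtx-pos a) (vtx-pos b) (join (≤-total (pos a) (pos b)))
        where
        join : pos a ≤ pos b ⊎ pos b ≤ pos a → Path block (vtx (pos a)) (vtx (pos b))
        join (inj₁ a≤b) = position-path (pos<n a) (pos<n b) (region e f h _) (region e f h _) eq a≤b
        join (inj₂ b≤a) = path-sym (position-path (pos<n b) (pos<n a) (region e f h _) (region e f h _) (sym eq) b≤a)

    intervals : ℕ → ℕ → ℕ → Decomposition n
    intervals e f h = _ , block-isDecomposition e f h

-- Separation by intervals

-- The indicator of s < q
H : ℕ → ℕ → ℚ
H zero    s       = 0ℚ
H (suc q) zero    = 1ℚ
H (suc q) (suc s) = H q s

H-< : ∀ {q s} → s < q → H q s ≡ 1ℚ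
H-< {suc q} {zero}  _         = refl
H-< {suc q} {suc s} (s≤s s<q) = H-< s<q

H-≥ : ∀ {q s} → q ≤ s → H q s ≡ 0ℚ
H-≥ {zero}          _         = refl
H-≥ {suc q} {suc s} (s≤s q≤s) = H-≥ q≤s

H-suc : ∀ q s → H (suc q) s ≡ H q s ⊕ δ q s
H-suc zero    zero    = refl
H-suc zero    (suc s) = refl
H-suc (suc q) zero    = refl
H-suc (suc q) (suc s) = H-suc q s

-- For 0/1-valued arguments this is the indicator of u ≢ w.
xor : ℚ → ℚ → ℚ
xor u w = u ⊕ w ⊖ (1ℚ ⊕ 1ℚ) ⊗ u ⊗ w

⊕-self-0 : ∀ {x} → x ⊕ x ≡ 0ℚ → x ≡ 0ℚ
⊕-self-0 {x} eq = ⊗-cancelˡ-0 {1ℚ ⊕ 1ℚ} (λ ()) (trans (double x) eq)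
  where
  double : ∀ x → (1ℚ ⊕ 1ℚ) ⊗ x ≡ x ⊕ x
  double = Ring.solve-∀ ringℚ

module _ {n : ℕ} (pos : Fin n → ℕ) where

  -- The pairs separated by the interval [p , q[
  X : ℕ → ℕ → Vect n
  X p q a b = xor (H q (pos a) ⊖ H p (pos a)) (H q (pos b) ⊖ H p (pos b))

  E : Fin n → Fin n → Vect n
  E a b x y = δ (pos a) (pos x) ⊗ δ (pos b) (pos y) ⊕ δ (pos a) (pos y) ⊗ δ (pos b) (pos x)

  -- `xor` has degree 2: in the mixed second difference its linear terms cancel, and the term -2uw
  -- leaves twice the unit vector `E a b`. The identity is polynomial in the values of `H` and `δ`.
  X-second-difference : ∀ a b x y → let p = pos a ; q = pos b in
    X p q x y ⊕ X (suc p) (suc q) x y ≡ (X (suc p) q x y ⊕ X p (suc q) x y) ⊕ (E a b x y ⊕ E a b x y)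
  X-second-difference a b x y
    rewrite H-suc (pos a) (pos x) | H-suc (pos a) (pos y) | H-suc (pos b) (pos x) | H-suc (pos b) (pos y) =
    identity (H (pos a) (pos x)) (H (pos a) (pos y)) (H (pos b) (pos x)) (H (pos b) (pos y)) _ _ _ _
    where
    identity : ∀ hp hp′ hq hq′ dp dp′ dq dq′ →
      ((hq ⊖ hp) ⊕ (hq′ ⊖ hp′) ⊖ (1ℚ ⊕ 1ℚ) ⊗ (hq ⊖ hp) ⊗ (hq′ ⊖ hp′))
      ⊕ (((hq ⊕ dq) ⊖ (hp ⊕ dp)) ⊕ ((hq′ ⊕ dq′) ⊖ (hp′ ⊕ dp′)) ⊖ (1ℚ ⊕ 1ℚ) ⊗ ((hq ⊕ dq) ⊖ (hp ⊕ dp)) ⊗ ((hq′ ⊕ dq′) ⊖ (hp′ ⊕ dp′)))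
      ≡ (((hq ⊖ (hp ⊕ dp)) ⊕ (hq′ ⊖ (hp′ ⊕ dp′)) ⊖ (1ℚ ⊕ 1ℚ) ⊗ (hq ⊖ (hp ⊕ dp)) ⊗ (hq′ ⊖ (hp′ ⊕ dp′)))
         ⊕ (((hq ⊕ dq) ⊖ hp) ⊕ ((hq′ ⊕ dq′) ⊖ hp′) ⊖ (1ℚ ⊕ 1ℚ) ⊗ ((hq ⊕ dq) ⊖ hp) ⊗ ((hq′ ⊕ dq′) ⊖ hp′)))
        ⊕ ((dp ⊗ dq′ ⊕ dp′ ⊗ dq) ⊕ (dp ⊗ dq′ ⊕ dp′ ⊗ dq))
    identity = Ring.solve-∀ ringℚ

  X-empty : ∀ p x y → X p p x y ≡ 0ℚ
  X-empty p x y = vanish (H p (pos x)) (H p (pos y))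
    where
    vanish : ∀ u w → (u ⊖ u) ⊕ (w ⊖ w) ⊖ (1ℚ ⊕ 1ℚ) ⊗ (u ⊖ u) ⊗ (w ⊖ w) ≡ 0ℚ
    vanish = Ring.solve-∀ ringℚ

  module _ (pos<n : ∀ a → pos a < n) where

    -- An interval and its complement cut the same pairs. This trades boundary 0 for boundary `n`,
    -- so that only the boundaries 1, ..., n have to be located between points of v.
    X-complement : ∀ q x y → X 0 q x y ≡ X q n x y
    X-complement q x y rewrite H-< (pos<n x) | H-< (pos<n y) = flip (H q (pos x)) (H q (pos y))
      where
      flip : ∀ u w → (u ⊖ 0ℚ) ⊕ (w ⊖ 0ℚ) ⊖ (1ℚ ⊕ 1ℚ) ⊗ (u ⊖ 0ℚ) ⊗ (w ⊖ 0ℚ)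
        ≡ (1ℚ ⊖ u) ⊕ (1ℚ ⊖ w) ⊖ (1ℚ ⊕ 1ℚ) ⊗ (1ℚ ⊖ u) ⊗ (1ℚ ⊖ w)
      flip = Ring.solve-∀ ringℚ

    module _ {L : Vect n → ℚ} (L-linear : Linear L)
             (L-X : ∀ {e f} → 0 < e → e < f → f ≤ n → L (X e f) ≡ 0ℚ) where

      L-X′ : ∀ {e f} → e ≤ f → f ≤ n → L (X e f) ≡ 0ℚ
      L-X′ {e} {f} e≤f f≤n with m≤n⇒m<n∨m≡n e≤f
      L-X′ {e}     {f} e≤f f≤n | inj₂ refl = null L-linear (X-empty e)
      L-X′ {suc e} {f} e≤f f≤n | inj₁ e<f  = L-X (s≤s z≤n) e<f f≤n
      L-X′ {zero}  {f} e≤f f≤n | inj₁ 0<f with m≤n⇒m<n∨m≡n f≤n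
      ... | inj₁ f<n  = trans (resp L-linear (X-complement f)) (L-X 0<f f<n ≤-refl)
      ... | inj₂ refl = trans (resp L-linear (X-complement f)) (null L-linear (X-empty f))

      L-E-< : ∀ a b → pos a < pos b → L (E a b) ≡ 0ℚ
      L-E-< a b a<b = ⊕-self-0 (begin
        L (E a b) ⊕ L (E a b)
          ≡⟨ ℚₚ.+-identityˡ _ ⟨
        0ℚ ⊕ (L (E a b) ⊕ L (E a b))
          ≡⟨ cong (_⊕ (L (E a b) ⊕ L (E a b))) (trans (add L-linear _ _) (cong₂ _⊕_ (L-X′ a<b (<⇒≤ b<n)) (L-X′ (<⇒≤ (<-trans a<b (n<1+n _))) b<n))) ⟨
        L (λ x y → X (suc p) q x y ⊕ X p (suc q) x y) ⊕ (L (E a b) ⊕ L (E a b))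
          ≡⟨ cong (L (λ x y → X (suc p) q x y ⊕ X p (suc q) x y) ⊕_) (add L-linear (E a b) (E a b)) ⟨
        L (λ x y → X (suc p) q x y ⊕ X p (suc q) x y) ⊕ L (λ x y → E a b x y ⊕ E a b x y)
          ≡⟨ add L-linear _ _ ⟨
        L (λ x y → (X (suc p) q x y ⊕ X p (suc q) x y) ⊕ (E a b x y ⊕ E a b x y))
          ≡⟨ resp L-linear (X-second-difference a b) ⟨
        L (λ x y → X p q x y ⊕ X (suc p) (suc q) x y)
          ≡⟨ add L-linear (X p q) (X (suc p) (suc q)) ⟩
        L (X p q) ⊕ L (X (suc p) (suc q))
          ≡⟨ cong₂ _⊕_ (L-X′ (<⇒≤ a<b) (<⇒≤ b<n)) (L-X′ (s≤s (<⇒≤ a<b)) b<n) ⟩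
        0ℚ ∎)
        where
        open ≡-Reasoning
        p = pos a
        q = pos b
        b<n = pos<n b

      L-E : ∀ a b → pos a ≢ pos b → L (E a b) ≡ 0ℚ
      L-E a b a≢b with <-cmp (pos a) (pos b)
      ... | tri< a<b _ _ = L-E-< a b a<b
      ... | tri≈ _ a≡b _ = contradiction a≡b a≢b
      ... | tri> _ _ b<a = trans (resp L-linear λ x y → exchange (δ (pos a) (pos x)) (δ (pos b) (pos y)) (δ (pos a) (pos y)) (δ (pos b) (pos x)))
        (L-E-< b a b<a)
        where
        exchange : ∀ s t u w → s ⊗ t ⊕ u ⊗ w ≡ w ⊗ u ⊕ t ⊗ s
        exchange = Ring.solve-∀ ringℚ

  module _ (pos-injective : ∀ {a b} → pos a ≡ pos b → a ≡ b) where

    E-entry : ∀ i j → entry (E (proj₁ (pair n i)) (proj₂ (pair n i))) j ≡ δ (toℕ i) (toℕ j)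
    E-entry i j with i Finₚ.≟ j
    ... | yes refl rewrite δ-≡ (pos (proj₁ (pair n i))) | δ-≡ (pos (proj₂ (pair n i))) | δ-≡ (toℕ i)
        | δ-≢ (λ eq → <⇒≢ (pair-< n i) (cong toℕ (pos-injective eq)))
        | δ-≢ (λ eq → <⇒≢ (pair-< n i) (cong toℕ (pos-injective (sym eq)))) = refl
    ... | no i≢j = trans (cong₂ _⊕_ straight crossed) (sym (δ-≢ λ eq → i≢j (Finₚ.toℕ-injective eq)))
      where
      a = proj₁ (pair n i)
      b = proj₂ (pair n i)
      x = proj₁ (pair n j)
      y = proj₂ (pair n j)
      straight : δ (pos a) (pos x) ⊗ δ (pos b) (pos y) ≡ 0ℚ
      straight with pos a ≟ pos x | pos b ≟ pos y
      ... | no a≢x  | _       = trans (cong (_⊗ δ (pos b) (pos y)) (δ-≢ a≢x)) (ℚₚ.*-zeroˡ (δ (pos b) (pos y)))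
      ... | yes _   | no b≢y  = trans (cong (δ (pos a) (pos x) ⊗_) (δ-≢ b≢y)) (ℚₚ.*-zeroʳ (δ (pos a) (pos x)))
      ... | yes a≡x | yes b≡y = contradiction (pair-injective n i j (cong₂ _,_ (pos-injective a≡x) (pos-injective b≡y))) i≢j
      -- Both pairs are listed in increasing order, so neither is the reverse of the other.
      crossed : δ (pos a) (pos y) ⊗ δ (pos b) (pos x) ≡ 0ℚ
      crossed with pos a ≟ pos y | pos b ≟ pos x
      ... | no a≢y  | _       = trans (cong (_⊗ δ (pos b) (pos x)) (δ-≢ a≢y)) (ℚₚ.*-zeroˡ (δ (pos b) (pos x)))
      ... | yes _   | no b≢x  = trans (cong (δ (pos a) (pos y) ⊗_) (δ-≢ b≢x)) (ℚₚ.*-zeroʳ (δ (pos a) (pos y)))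
      ... | yes a≡y | yes b≡x = contradiction
        (subst₂ (λ s t → toℕ s < toℕ t) (pos-injective a≡y) (pos-injective b≡x) (pair-< n i)) (<⇒≯ (pair-< n j))

module _ {n : ℕ} .{{_ : NonZero n}} (F : Frame {n}) {ℓ₀ ℓ₁ ℓ₂ : Fin n}
         (ℓ₀≢ℓ₁ : ℓ₀ ≢ ℓ₁) (ℓ₀≢ℓ₂ : ℓ₀ ≢ ℓ₂) (ℓ₁≢ℓ₂ : ℓ₁ ≢ ℓ₂) where

  open Frame F
  open Intervals F ℓ₀≢ℓ₁ ℓ₀≢ℓ₂ ℓ₁≢ℓ₂

  private
    -- The values of `H e`, `H f`, `H h` in each region. On these constants both sides of
    -- `separation` compute, which leaves sixteen closed equations.
    data Code : Fin n → ℚ → ℚ → ℚ → Set where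
      below  : Code ℓ₀ 1ℚ 1ℚ 1ℚ
      first  : Code ℓ₁ 0ℚ 1ℚ 1ℚ
      second : Code ℓ₂ 0ℚ 0ℚ 1ℚ
      above  : Code ℓ₀ 0ℚ 0ℚ 0ℚ

    code : ∀ {e f h s l} → e ≤ f → f ≤ h → Region e f h s l → Code l (H e s) (H f s) (H h s)
    code e≤f f≤h (below s<e)
      rewrite H-< s<e | H-< (<-≤-trans s<e e≤f) | H-< (<-≤-trans s<e (≤-trans e≤f f≤h)) = below
    code e≤f f≤h (first e≤s s<f)
      rewrite H-≥ e≤s | H-< s<f | H-< (<-≤-trans s<f f≤h) = first
    code e≤f f≤h (second e≤s f≤s s<h)
      rewrite H-≥ e≤s | H-≥ f≤s | H-< s<h = second
    code e≤f f≤h (above e≤s f≤s h≤s)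
      rewrite H-≥ e≤s | H-≥ f≤s | H-≥ h≤s = above

    separation : ∀ {l p q r l′ p′ q′ r′} (x : ℚ) → (l ≡ l′ → x ≡ 0ℚ) → (l ≢ l′ → x ≡ 1ℚ) →
      Code l p q r → Code l′ p′ q′ r′ →
      x ⊕ x ≡ (xor (q ⊖ p) (q′ ⊖ p′) ⊕ xor (r ⊖ q) (r′ ⊖ q′)) ⊕ xor (r ⊖ p) (r′ ⊖ p′)
    separation x x≡0 x≡1 below  below  rewrite x≡0 refl = refl
    separation x x≡0 x≡1 below  first  rewrite x≡1 ℓ₀≢ℓ₁ = refl
    separation x x≡0 x≡1 below  second rewrite x≡1 ℓ₀≢ℓ₂ = refl
    separation x x≡0 x≡1 below  above  rewrite x≡0 refl = refl
    separation x x≡0 x≡1 first  below  rewrite x≡1 (λ eq → ℓ₀≢ℓ₁ (sym eq)) = refl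
    separation x x≡0 x≡1 first  first  rewrite x≡0 refl = refl
    separation x x≡0 x≡1 first  second rewrite x≡1 ℓ₁≢ℓ₂ = refl
    separation x x≡0 x≡1 first  above  rewrite x≡1 (λ eq → ℓ₀≢ℓ₁ (sym eq)) = refl
    separation x x≡0 x≡1 second below  rewrite x≡1 (λ eq → ℓ₀≢ℓ₂ (sym eq)) = refl
    separation x x≡0 x≡1 second first  rewrite x≡1 (λ eq → ℓ₁≢ℓ₂ (sym eq)) = refl
    separation x x≡0 x≡1 second second rewrite x≡0 refl = refl
    separation x x≡0 x≡1 second above  rewrite x≡1 (λ eq → ℓ₀≢ℓ₂ (sym eq)) = refl
    separation x x≡0 x≡1 above  below  rewrite x≡0 refl = refl
    separation x x≡0 x≡1 above  first  rewrite x≡1 ℓ₀≢ℓ₁ = refl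
    separation x x≡0 x≡1 above  second rewrite x≡1 ℓ₀≢ℓ₂ = refl
    separation x x≡0 x≡1 above  above  rewrite x≡0 refl = refl

  -- Every pair separated by the three blocks is separated by exactly two of
  -- the intervals [e , f[, [f , h[, [e , h[.
  intervals-X : ∀ {e f h} → e ≤ f → f ≤ h → ∀ a b →
    lmcVec (intervals e f h) a b ⊕ lmcVec (intervals e f h) a b
    ≡ (X pos e f a b ⊕ X pos f h a b) ⊕ X pos e h a b
  intervals-X {e} {f} {h} e≤f f≤h a b = separation (lmcVec D a b) (lmcVec-≡ D) (lmcVec-≢ D)
    (code e≤f f≤h (region e f h (pos a))) (code e≤f f≤h (region e f h (pos b)))
    where D = intervals e f h

  L-intervals : ∀ {L : Vect n → ℚ} → Linear L → ∀ {e f h} → e ≤ f → f ≤ h →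
    L (lmcVec (intervals e f h)) ≡ 0ℚ → (L (X pos e f) ⊕ L (X pos f h)) ⊕ L (X pos e h) ≡ 0ℚ
  L-intervals {L} L-linear {e} {f} {h} e≤f f≤h eq = begin
    (L (X pos e f) ⊕ L (X pos f h)) ⊕ L (X pos e h)
      ≡⟨ cong (_⊕ L (X pos e h)) (add L-linear (X pos e f) (X pos f h)) ⟨
    L (λ a b → X pos e f a b ⊕ X pos f h a b) ⊕ L (X pos e h)
      ≡⟨ add L-linear _ (X pos e h) ⟨
    L (λ a b → (X pos e f a b ⊕ X pos f h a b) ⊕ X pos e h a b)
      ≡⟨ resp L-linear (intervals-X e≤f f≤h) ⟨
    L (λ a b → x a b ⊕ x a b)
      ≡⟨ add L-linear x x ⟩
    L x ⊕ L x
      ≡⟨ cong₂ _⊕_ eq eq ⟩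
    0ℚ ∎
    where
    open ≡-Reasoning
    x = lmcVec (intervals e f h)

-- Functionals vanishing on the face

-- Linear arithmetic over ℕ by certificates: A ≤ B is a sum of hypotheses, s the slack.
linear : ∀ {A B a b} s → A ≤ B → a + B + s ≡ b + A → a ≤ b
linear {A} {B} {a} {b} s A≤B eq = +-cancelʳ-≤ A a b
  (≤-trans (+-monoʳ-≤ a A≤B) (≤-trans (m≤m+n (a + B) s) (≤-reflexive eq)))

infixr 5 _⊹_
_⊹_ : ∀ {a b c d} → a ≤ b → c ≤ d → a + c ≤ b + d
_⊹_ = +-mono-≤

fromℕ≢0 : ∀ m → ⁺ suc m ÷ 1 ≢ 0ℚ
fromℕ≢0 m eq = contradiction
  (trans (sym (ℚₚ.↥-/ (⁺ suc m) 1)) (cong (λ z → ↥ z ℤ.* gcd (⁺ suc m) (⁺ 1)) eq)) λ ()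

⊕-0⇒≡⊝ : ∀ {x y} → x ⊕ y ≡ 0ℚ → x ≡ ⊝ y
⊕-0⇒≡⊝ {x} {y} eq = begin
  x              ≡⟨ Ring.solve (x ∷ y ∷ []) ringℚ ⟩
  (x ⊕ y) ⊖ y    ≡⟨ cong (_⊖ y) eq ⟩
  0ℚ ⊖ y         ≡⟨ ℚₚ.+-identityˡ (⊝ y) ⟩
  ⊝ y ∎
  where open ≡-Reasoning

-- D i j is the value of a functional on the decomposition of ℤ_k into ]i , j] and its complement.
module _ {d : ℕ} (2≤d : 2 ≤ d) (D : ℕ → ℕ → ℚ)
  (D-d   : ∀ i → i ≤ d → D i (i + d) ≡ 0ℚ)
  (D-1+d : ∀ i → i < d → D i (suc (i + d)) ≡ 0ℚ)
  (D-triple : ∀ i j l → i < j → j < l → l ≤ d + d → j ≤ i + d → l ≤ j + d → i + d < l →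
              (D i j ⊕ D j l) ⊕ D i l ≡ 0ℚ)
  where

  open ≡-Reasoning

  private
    drop₃ : ∀ {x y z} → (x ⊕ y) ⊕ z ≡ 0ℚ → z ≡ 0ℚ → x ≡ ⊝ y
    drop₃ {x} {y} eq refl = ⊕-0⇒≡⊝ (trans (sym (ℚₚ.+-identityʳ (x ⊕ y))) eq)

    drop₂ : ∀ {x y z} → (x ⊕ y) ⊕ z ≡ 0ℚ → y ≡ 0ℚ → x ≡ ⊝ z
    drop₂ {x} {y} {z} eq refl = ⊕-0⇒≡⊝ (trans (cong (_⊕ z) (sym (ℚₚ.+-identityʳ x))) eq)

    drop₁ : ∀ {x y z} → (x ⊕ y) ⊕ z ≡ 0ℚ → x ≡ 0ℚ → z ≡ ⊝ y
    drop₁ {x} {y} {z} eq refl = ⊕-0⇒≡⊝ (trans (ℚₚ.+-comm z y) (trans (cong (_⊕ z) (sym (ℚₚ.+-identityˡ y))) eq))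

  -- `D-triple` covers the triples whose three cyclic gaps modulo 2d + 1 are at most d. In the
  -- triple i, j, i + d + 1 the outer pair has gap d + 1 and drops out.
  reflect : ∀ {i j} → i < j → j ≤ i + d → i < d → D i j ≡ ⊝ D j (suc (i + d))
  reflect {i} {j} i<j j≤i+d i<d = drop₃ (D-triple i j (suc (i + d)) i<j (s≤s j≤i+d)
    (+-monoˡ-≤ d i<d) j≤i+d (+-monoˡ-≤ d i<j) ≤-refl) (D-1+d i i<d)

  -- In the triple i, i + d, l the first pair has gap d and drops out; `advance-right` uses i, j, j
  -- + d in the same way.
  advance-left : ∀ {i l} → i + d < l → l ≤ d + d → D i l ≡ ⊝ D (i + d) l
  advance-left {i} {l} i+d<l l≤2d = drop₁ (D-triple i (i + d) l
    (linear 0 2≤d+i (solve (i ∷ d ∷ []))) i+d<l l≤2d ≤-refl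
    (≤-trans l≤2d (+-monoˡ-≤ d (m≤n+m d i))) i+d<l) (D-d i i≤d)
    where
    i≤d : i ≤ d
    i≤d = +-cancelʳ-≤ d i d (≤-trans (<⇒≤ i+d<l) l≤2d)
    2≤d+i : 1 + i ≤ d + i
    2≤d+i = +-monoˡ-≤ i (≤-trans (n≤1+n 1) 2≤d)

  advance-right : ∀ {i j} → i < j → j ≤ i + d → j ≤ d → D i j ≡ ⊝ D i (j + d)
  advance-right {i} {j} i<j j≤i+d j≤d = drop₂ (D-triple i j (j + d) i<j
    (linear 0 1≤d (solve (j ∷ d ∷ []))) (+-monoˡ-≤ d j≤d) j≤i+d ≤-refl (+-monoˡ-≤ d i<j)) (D-d j j≤d)
    where
    1≤d : 1 ≤ d
    1≤d = ≤-trans (n≤1+n 1) 2≤d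

  -- Rotation by d moves one end at a time; each move changes the sign, and the two signs cancel.
  shift-d : ∀ {i j} → i < j → j ≤ d → D (i + d) (j + d) ≡ D i j
  shift-d {i} {j} i<j j≤d = begin
    D (i + d) (j + d)          ≡⟨ ⊝-involutive (D (i + d) (j + d)) ⟩
    ⊝ ⊝ D (i + d) (j + d)      ≡⟨ cong ⊝_ (advance-left (+-monoˡ-< d i<j) (+-monoˡ-≤ d j≤d)) ⟨
    ⊝ D i (j + d)              ≡⟨ advance-right i<j (≤-trans j≤d (m≤n+m d i)) j≤d ⟨
    D i j ∎
    where
    ⊝-involutive : ∀ x → x ≡ ⊝ ⊝ x
    ⊝-involutive = Ring.solve-∀ ringℚ

  shift-1+d : ∀ {i j} → i < j → j < d → D (suc (i + d)) (suc (j + d)) ≡ D i j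
  shift-1+d {i} {j} i<j j<d = begin
    D (suc (i + d)) (suc (j + d))          ≡⟨ ⊝-involutive _ ⟩
    ⊝ ⊝ D (suc (i + d)) (suc (j + d))      ≡⟨ cong ⊝_ (reflect (s≤s (≤-trans (<⇒≤ j<d) (m≤n+m d i))) (+-monoˡ-≤ d i<j) j<d) ⟨
    ⊝ D j (suc (i + d))                    ≡⟨ reflect i<j (≤-trans (<⇒≤ j<d) (m≤n+m d i)) (<-trans i<j j<d) ⟨
    D i j ∎
    where
    ⊝-involutive : ∀ x → x ≡ ⊝ ⊝ x
    ⊝-involutive = Ring.solve-∀ ringℚ

  -- The rotations by d and by d + 1 differ by a single step, and both preserve D.
  shift-1 : ∀ {i j} → i < j → j < d → D (suc i) (suc j) ≡ D i j
  shift-1 i<j j<d = trans (sym (shift-d (s≤s i<j) j<d)) (shift-1+d i<j j<d)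

  from-0 : ∀ i {p} → 0 < p → i + p ≤ d → D i (i + p) ≡ D 0 p
  from-0 zero    0<p _   = refl
  from-0 (suc i) {p} 0<p i+p<d = trans (shift-1 (linear 0 0<p (solve (i ∷ p ∷ []))) i+p<d) (from-0 i 0<p (<⇒≤ i+p<d))

  -- The triple i, d, i + d + 1 has cyclic gaps d - i, i + 1 and d, so the values at gaps with sum d
  -- + 1 are opposite.
  complementary : ∀ i → i < d → D 0 (d ∸ i) ≡ ⊝ D 0 (suc i)
  complementary i i<d = begin
    D 0 (d ∸ i)              ≡⟨ from-0 i (m<n⇒0<n∸m i<d) (≤-reflexive i+≡d) ⟨
    D i (i + (d ∸ i))        ≡⟨ cong (D i) i+≡d ⟩
    D i d                    ≡⟨ reflect i<d (m≤n+m d i) i<d ⟩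
    ⊝ D d (suc (i + d))      ≡⟨ cong ⊝_ (shift-d (s≤s z≤n) i<d) ⟩
    ⊝ D 0 (suc i) ∎
    where
    i+≡d : i + (d ∸ i) ≡ d
    i+≡d = m+[n∸m]≡n (<⇒≤ i<d)

  D-0-d : D 0 d ≡ 0ℚ
  D-0-d = D-d 0 z≤n

  D-0-1 : D 0 1 ≡ 0ℚ
  D-0-1 = ℚₚ.neg-injective (trans (sym (complementary 0 (≤-trans (s≤s z≤n) 2≤d))) D-0-d)

  private
    d⁻ = d ∸ 1

    1+d⁻ : suc d⁻ ≡ d
    1+d⁻ = m+[n∸m]≡n (≤-trans (s≤s z≤n) 2≤d)

    step = D 0 d⁻

  -- The cyclic gaps of the triple 0, p + 1, p + d are p + 1, d − 1 and d + 1 − p.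
  arithmetic : ∀ p → 0 < p → p < d → (D 0 (suc p) ⊕ step) ⊖ D 0 p ≡ 0ℚ
  arithmetic p 0<p p<d = begin
    (D 0 (suc p) ⊕ step) ⊖ D 0 p
      ≡⟨ cong₂ (λ y z → (D 0 (suc p) ⊕ y) ⊕ z) middle (trans (sym (⊝-involutive _)) (cong ⊝_ (sym (advance-right 0<p (<⇒≤ p<d) (<⇒≤ p<d))))) ⟨
    _ ≡⟨ D-triple 0 (suc p) (p + d) (s≤s z≤n) (linear 0 2≤d (solve (p ∷ d ∷ []))) (+-monoˡ-≤ d (<⇒≤ p<d)) p<d
           (n≤1+n _) (+-monoˡ-≤ d 0<p) ⟩
    0ℚ ∎
    where
    ⊝-involutive : ∀ x → ⊝ ⊝ x ≡ x
    ⊝-involutive = Ring.solve-∀ ringℚ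
    middle : D (suc p) (p + d) ≡ step
    middle with m≤n⇒m<n∨m≡n p<d
    -- The right end exceeds d, out of reach of `from-0`; reflection leads to gap 2, which is
    -- complementary to d - 1.
    ... | inj₁ 1+p<d = begin
      D (suc p) (p + d)
        ≡⟨ reflect (linear 0 2≤d (solve (p ∷ d ∷ []))) (n≤1+n _) 1+p<d ⟩
      ⊝ D (p + d) (suc (suc p) + d)
        ≡⟨ cong ⊝_ (shift-d (m<n⇒m<1+n (n<1+n p)) 1+p<d) ⟩
      ⊝ D p (suc (suc p))
        ≡⟨ cong (λ z → ⊝ D p z) (+-comm 2 p) ⟩
      ⊝ D p (p + 2)
        ≡⟨ cong ⊝_ (from-0 p (s≤s z≤n) (subst (_≤ d) (+-comm 2 p) 1+p<d)) ⟩
      ⊝ D 0 2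
        ≡⟨ complementary 1 2≤d ⟨
      step ∎
    ... | inj₂ refl = shift-d (m<n⇒0<n∸m 2≤d) (m∸n≤m d 1)

  D-0-p : ∀ m → m < d → D 0 (suc m) ⊕ sumFin m (λ _ → 1ℚ) ⊗ step ≡ 0ℚ
  D-0-p zero    _   = trans (cong₂ _⊕_ D-0-1 (ℚₚ.*-zeroˡ step)) refl
  D-0-p (suc m) m<d = begin
    D 0 (suc (suc m)) ⊕ (1ℚ ⊕ S) ⊗ step
      ≡⟨ regroup (D 0 (suc (suc m))) (D 0 (suc m)) S step ⟩
    ((D 0 (suc (suc m)) ⊕ step) ⊖ D 0 (suc m)) ⊕ (D 0 (suc m) ⊕ S ⊗ step)
      ≡⟨ cong₂ _⊕_ (arithmetic (suc m) (s≤s z≤n) m<d) (D-0-p m (<⇒≤ m<d)) ⟩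
    0ℚ ∎
    where
    S = sumFin m (λ _ → 1ℚ)
    regroup : ∀ x y s t → x ⊕ (1ℚ ⊕ s) ⊗ t ≡ ((x ⊕ t) ⊖ y) ⊕ (y ⊕ s ⊗ t)
    regroup = Ring.solve-∀ ringℚ

  -- The progression starts with 0 at gap 1 and returns to 0 at gap d, so (d - 1) times `step` is 0;
  -- here d ≥ 2 makes d - 1 invertible.
  step≡0 : step ≡ 0ℚ
  step≡0 = ⊗-cancelˡ-0 S≢0 (trans (sym (ℚₚ.+-identityˡ _)) (trans (cong (_⊕ S ⊗ step) (sym D-0-d′)) (D-0-p d⁻ (≤-reflexive 1+d⁻))))
    where
    S = sumFin d⁻ (λ _ → 1ℚ)
    D-0-d′ : D 0 (suc d⁻) ≡ 0ℚ
    D-0-d′ = trans (cong (D 0) 1+d⁻) D-0-d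
    S≢0 : S ≢ 0ℚ
    S≢0 eq = fromℕ≢0 (d⁻ ∸ 1) (trans (trans (cong (λ z → ⁺ z ÷ 1) (m+[n∸m]≡n (m<n⇒0<n∸m 2≤d))) (sym (sum-1 d⁻))) eq)

  D-0-p≡0 : ∀ m → m < d → D 0 (suc m) ≡ 0ℚ
  D-0-p≡0 m m<d = begin
    D 0 (suc m)                                     ≡⟨ ℚₚ.+-identityʳ _ ⟨
    D 0 (suc m) ⊕ 0ℚ                                ≡⟨ cong (D 0 (suc m) ⊕_) (trans (cong (S ⊗_) step≡0) (ℚₚ.*-zeroʳ S)) ⟨
    D 0 (suc m) ⊕ S ⊗ step                          ≡⟨ D-0-p m m<d ⟩
    0ℚ ∎
    where S = sumFin m (λ _ → 1ℚ)

  lower : ∀ {i j} → i < j → j ≤ d → D i j ≡ 0ℚ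
  lower {i} {j} i<j j≤d = begin
    D i j                        ≡⟨ cong (D i) i+≡j ⟨
    D i (i + suc (j ∸ suc i))    ≡⟨ from-0 i (s≤s z≤n) (subst (_≤ d) (sym i+≡j) j≤d) ⟩
    D 0 (suc (j ∸ suc i))        ≡⟨ D-0-p≡0 (j ∸ suc i) (≤-trans (≤-trans (m≤n+m _ i) (≤-reflexive i+≡j)) j≤d) ⟩
    0ℚ ∎
    where
    i+≡j : i + suc (j ∸ suc i) ≡ j
    i+≡j = trans (+-suc i _) (m+[n∸m]≡n i<j)

  upper : ∀ {i j} → d ≤ i → i < j → j ≤ d + d → D i j ≡ 0ℚ
  upper {i} {j} d≤i i<j j≤2d = begin
    D i j                        ≡⟨ cong₂ D (m∸n+n≡m d≤i) (m∸n+n≡m d≤j) ⟨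
    D (i ∸ d + d) (j ∸ d + d)    ≡⟨ shift-d i<j′ j≤d′ ⟩
    D (i ∸ d) (j ∸ d)            ≡⟨ lower i<j′ j≤d′ ⟩
    0ℚ ∎
    where
    d≤j = ≤-trans d≤i (<⇒≤ i<j)
    i<j′ : i ∸ d < j ∸ d
    i<j′ = ∸-monoˡ-< i<j d≤i
    j≤d′ : j ∸ d ≤ d
    j≤d′ = ≤-trans (∸-monoˡ-≤ d j≤2d) (≤-reflexive (m+n∸n≡m d d))

  -- A pair with i < d < j is moved into the upper half: by reflection if its gap is at most d,
  -- otherwise by replacing i with i + d.
  D≡0 : ∀ {i j} → i < j → j ≤ d + d → D i j ≡ 0ℚ
  D≡0 {i} {j} i<j j≤2d with j ≤? d | d ≤? i | j ≤? i + d
  ... | yes j≤d | _       | _         = lower i<j j≤d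
  ... | no _    | yes d≤i | _         = upper d≤i i<j j≤2d
  ... | no j≰d  | no d≰i  | yes j≤i+d =
    trans (reflect i<j j≤i+d (≰⇒> d≰i)) (cong ⊝_ (upper (<⇒≤ (≰⇒> j≰d)) (s≤s j≤i+d) (+-monoˡ-≤ d (≰⇒> d≰i))))
  ... | no j≰d  | no d≰i  | no j≰i+d  =
    trans (advance-left (≰⇒> j≰i+d) j≤2d) (cong ⊝_ (upper (m≤n+m d i) (≰⇒> j≰i+d) j≤2d))

0≤1 : 0ℚ ≤ℚ 1ℚ
0≤1 = ℚₚ.nonNegative⁻¹ 1ℚ

-- The value of the half-chorded odd cycle inequality

ones : ℕ → ℚ
ones m = sumFin m (λ _ → 1ℚ)

ones-+ : ∀ p q → ones (p + q) ≡ ones p ⊕ ones q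
ones-+ zero    q = sym (ℚₚ.+-identityˡ (ones q))
ones-+ (suc p) q = trans (cong (1ℚ ⊕_) (ones-+ p q)) (sym (ℚₚ.+-assoc 1ℚ (ones p) (ones q)))

RHS-ones : ∀ k → 3 ≤ k → halfChordedRHS k ≡ ones k ⊖ ones 3
RHS-ones (suc (suc (suc m))) _ = sym (trans (peel (ones m)) (sum-1 m))
  where
  peel : ∀ x → (1ℚ ⊕ (1ℚ ⊕ (1ℚ ⊕ x))) ⊖ (1ℚ ⊕ (1ℚ ⊕ (1ℚ ⊕ 0ℚ))) ≡ x
  peel = Ring.solve-∀ ringℚ
RHS-ones (suc (suc zero)) (s≤s (s≤s ()))
RHS-ones (suc zero) (s≤s ())

δs : List ℕ → ℕ → ℚ
δs []       t = 0ℚ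
δs (a ∷ as) t = δ a t ⊕ δs as t

δs-∉ : ∀ {as t} → t ∉ as → δs as t ≡ 0ℚ
δs-∉ {[]}     _    = refl
δs-∉ {a ∷ as} t∉as = cong₂ _⊕_ (δ-≢ λ eq → t∉as (here (sym eq))) (δs-∉ λ t∈as → t∉as (there t∈as))

δs-∈ : ∀ {as t} → Unique as → t ∈ as → δs as t ≡ 1ℚ
δs-∈ {t = t} (a∉as ∷ᵘ _) (here refl)  = cong₂ _⊕_ (δ-≡ t) (δs-∉ λ a∈as → All.lookup a∉as a∈as refl)
δs-∈ (a∉as ∷ᵘ uniq)  (there t∈as) = cong₂ _⊕_ (δ-≢ (All.lookup a∉as t∈as)) (δs-∈ uniq t∈as)

sum-δs : ∀ m {as} → All (_< m) as → sumFin m (λ j → δs as (toℕ j)) ≡ ones (length as)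
sum-δs m ∅           = sum-0 m
sum-δs m (a<m ◂ as<m) = trans (sum-⊕ m _ _) (cong₂ _⊕_ (sum-δ m a<m) (sum-δs m as<m))

-- Blocks and interleaved pairs on the circle

module _ {n : ℕ} .{{_ : NonZero n}} where

  NonCrossing : (Fin n → Fin n) → (a b c e : Fin n) → Set
  NonCrossing f a b c e = (f a ≡ f b → f c ≡ f a ⊎ f e ≡ f a) × (f c ≡ f e → f a ≡ f c ⊎ f b ≡ f c)

  nonCrossing-flip : ∀ {f a b c e} → NonCrossing f a b c e → NonCrossing f a b e c
  nonCrossing-flip (p , q) = (λ eq → swap (p eq)) , λ eq → [ (λ r → inj₁ (trans r (sym eq))) , (λ r → inj₂ (trans r (sym eq))) ]′ (q (sym eq))

  nonCrossing-sym : ∀ {f a b c e} → NonCrossing f a b c e → NonCrossing f c e a b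
  nonCrossing-sym (p , q) = q , p

  -- A walk from b to a inside a block leaves the stretch between c and e, hence meets c or e; a
  -- walk from c to e leaves the stretch between a and b.
  interleaved⇒nonCrossing : ∀ (D : Decomposition n) o {a b c e} →
    fdist o a < fdist o c → fdist o c < fdist o b → fdist o b < fdist o e → NonCrossing (proj₁ D) a b c e
  interleaved⇒nonCrossing (f , connected) o {a} {b} {c} {e} a<c c<b b<e = inner , outer
    where
    escape : ∀ {x y z w} → fdist o x < fdist o y → fdist o y < fdist o z → f y ≡ f w →
      ¬ (fdist o x < fdist o w × fdist o w < fdist o z) → f x ≡ f y ⊎ f z ≡ f y
    escape {x} {y} {z} {w} x<y y<z eq outside with f x Finₚ.≟ f y | f z Finₚ.≟ f y
    ... | yes fx≡fy | _         = inj₁ fx≡fy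
    ... | no  _     | yes fz≡fy = inj₂ fz≡fy
    ... | no  fx≢fy | no fz≢fy  = contradiction
      (proj₂ (confined o (connected y w eq) (fdist<n o z) x<y y<z
        (λ eq → fx≢fy (trans (cong f (sym (+ₘ-fdist o x))) eq)) (λ eq → fz≢fy (trans (cong f (sym (+ₘ-fdist o z))) eq)))) outside
    inner : f a ≡ f b → f c ≡ f a ⊎ f e ≡ f a
    inner eq = [ (λ p → inj₁ (trans p (sym eq))) , (λ p → inj₂ (trans p (sym eq))) ]′
      (escape c<b b<e (sym eq) λ (c<a , _) → <-asym a<c c<a)
    outer : f c ≡ f e → f a ≡ f c ⊎ f b ≡ f c
    outer eq = escape a<c c<b eq λ (_ , e<b) → <-asym b<e e<b

¬linear : ∀ {A B} s → A ≤ B → B + suc s ≡ A → ⊥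
¬linear {A} {B} s A≤B eq = <⇒≱ (subst (B <_) eq (m<m+n B (s≤s z≤n))) A≤B

-- Validity of the inequality for a fixed injective sequence

module _ {k d n : ℕ} .{{_ : NonZero k}} .{{_ : NonZero n}} (v : Fin k → Fin n) (v-injective : Injective _≡_ _≡_ v)
         (k≡ : k ≡ suc (d + d)) (k/2≡d : k / 2 ≡ d) (2≤d : 2 ≤ d) (k≤n : k ≤ n) where

  private
    α : Vect n → ℚ
    α = halfChordedLHS v

    β : ℚ
    β = halfChordedRHS k

    u : ℕ → Fin n
    u = at v

    3≤k : 3 ≤ k
    3≤k = subst (3 ≤_) (sym k≡) (s≤s (≤-trans 2≤d (m≤m+n d d)))

    0<k : 0 < k
    0<k = ≤-trans (s≤s z≤n) 3≤k

    3≤n : 3 ≤ n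
    3≤n = ≤-trans 3≤k k≤n

    <k : ∀ {t} → t ≤ d + d → t < k
    <k t≤2d = subst (_ <_) (sym k≡) (s≤s t≤2d)

    <k⁻¹ : ∀ {t} → t < k → t ≤ d + d
    <k⁻¹ t<k = ≤-pred (subst (_ <_) k≡ t<k)

  at-periodic : ∀ t → u (t + k) ≡ u t
  at-periodic t = cong v (Finₚ.toℕ-injective (begin
    toℕ ((t + k) mod k)   ≡⟨ Finₚ.toℕ-fromℕ< (m%n<n (t + k) k) ⟩
    (t + k) % k           ≡⟨ [m+n]%n≡m%n t k ⟩
    t % k                 ≡⟨ Finₚ.toℕ-fromℕ< (m%n<n t k) ⟨
    toℕ (t mod k) ∎))
    where open ≡-Reasoning

  α-linear : Linear α
  α-linear = sum-linear k λ i → ⊖-linear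
    (coordinate-linear (u (toℕ i)) (u (toℕ i + k / 2))) (coordinate-linear (u (toℕ i)) (u (suc (toℕ i))))

  module _ (D : Decomposition n) where

    g : ℕ → Fin n
    g t = proj₁ D (u t)

    g-periodic : ∀ t → g (t + k) ≡ g t
    g-periodic t = cong (proj₁ D) (at-periodic t)

    g-k : g k ≡ g 0
    g-k = g-periodic 0

    private
      chord edge : ℕ → ℚ
      chord t = lmcVec D (u t) (u (t + k / 2))
      edge  t = lmcVec D (u t) (u (suc t))

      lmcVec-≤1 : ∀ a b → lmcVec D a b ≤ℚ 1ℚ
      lmcVec-≤1 a b with proj₁ D a Finₚ.≟ proj₁ D b
      ... | yes _ = 0≤1
      ... | no  _ = ℚₚ.≤-refl

      lmcVec-≥0 : ∀ a b → 0ℚ ≤ℚ lmcVec D a b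
      lmcVec-≥0 a b with proj₁ D a Finₚ.≟ proj₁ D b
      ... | yes _ = ℚₚ.≤-refl
      ... | no  _ = 0≤1

      chord-uncut : ∀ t → g t ≡ g (t + d) → chord t ≡ 0ℚ
      chord-uncut t eq = lmcVec-≡ D (trans eq (cong (λ z → g (t + z)) (sym k/2≡d)))

      chord-cut : ∀ t → g t ≢ g (t + d) → chord t ≡ 1ℚ
      chord-cut t neq = lmcVec-≢ D λ eq → neq (trans eq (cong (λ z → g (t + z)) k/2≡d))

      chord-≤ : ∀ {us} → Unique us → All (λ t → g t ≡ g (t + d)) us → ∀ t → chord t ≤ℚ 1ℚ ⊖ δs us t
      chord-≤ {us} uniq uncut t with t ∈? us
      ... | yes t∈us rewrite δs-∈ uniq t∈us = ℚₚ.≤-reflexive (chord-uncut t (All.lookup uncut t∈us))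
      ... | no  t∉us rewrite δs-∉ t∉us = lmcVec-≤1 _ _

      edge-≥ : ∀ {ws} → Unique ws → All (λ t → g t ≢ g (suc t)) ws → ∀ t → δs ws t ≤ℚ edge t
      edge-≥ {ws} uniq cut t with t ∈? ws
      ... | yes t∈ws rewrite δs-∈ uniq t∈ws = ℚₚ.≤-reflexive (sym (lmcVec-≢ D (All.lookup cut t∈ws)))
      ... | no  t∉ws rewrite δs-∉ t∉ws = lmcVec-≥0 _ _

      sum-bound : ∀ {us ws} → All (_< k) us → All (_< k) ws →
        sumFin k (λ i → (1ℚ ⊖ δs us (toℕ i)) ⊖ δs ws (toℕ i))
        ≡ (ones k ⊖ ones (length us)) ⊖ ones (length ws)
      sum-bound {us} {ws} us<k ws<k = trans (sum-⊖ k (λ i → 1ℚ ⊖ δs us (toℕ i)) λ i → δs ws (toℕ i)) (cong₂ _⊖_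
        (trans (sum-⊖ k (λ _ → 1ℚ) λ i → δs us (toℕ i)) (cong (ones k ⊖_) (sum-δs k us<k))) (sum-δs k ws<k))

    -- Each of the k terms is at most 1 - 0, and each listed uncut half-chord or cut edge costs one
    -- unit. The lists may be incomplete, so exhibiting three items proves validity; `value-≡` asks
    -- for complete lists.
    value-≤ : ∀ {us ws} → Unique us → Unique ws → All (_< k) us → All (_< k) ws →
      All (λ t → g t ≡ g (t + d)) us → All (λ t → g t ≢ g (suc t)) ws →
      α (lmcVec D)
      ≤ℚ (ones k ⊖ ones (length us)) ⊖ ones (length ws)
    value-≤ {us} {ws} us-uniq ws-uniq us<k ws<k uncut cut =
      subst (α (lmcVec D) ≤ℚ_) (sum-bound us<k ws<k) (sum-mono k λ i →
        ℚₚ.+-mono-≤ (chord-≤ us-uniq uncut (toℕ i)) (ℚₚ.neg-antimono-≤ (edge-≥ ws-uniq cut (toℕ i))))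

    value-≡ : ∀ {us ws} → Unique us → Unique ws → All (_< k) us → All (_< k) ws →
      All (λ t → g t ≡ g (t + d)) us → All (λ t → g t ≢ g (suc t)) ws →
      (∀ t → t < k → t ∉ us → g t ≢ g (t + d)) → (∀ t → t < k → t ∉ ws → g t ≡ g (suc t)) →
      α (lmcVec D)
      ≡ (ones k ⊖ ones (length us)) ⊖ ones (length ws)
    value-≡ {us} {ws} us-uniq ws-uniq us<k ws<k uncut cut rest-cut rest-uncut =
      trans (sum-cong k λ i → cong₂ _⊖_ (chord-≡ (toℕ i) (Finₚ.toℕ<n i)) (edge-≡ (toℕ i) (Finₚ.toℕ<n i))) (sum-bound us<k ws<k)
      where
      chord-≡ : ∀ t → t < k → chord t ≡ 1ℚ ⊖ δs us t
      chord-≡ t t<k with t ∈? us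
      ... | yes t∈us rewrite δs-∈ us-uniq t∈us = chord-uncut t (All.lookup uncut t∈us)
      ... | no  t∉us rewrite δs-∉ t∉us = chord-cut t (rest-cut t t<k t∉us)
      edge-≡ : ∀ t → t < k → edge t ≡ δs ws t
      edge-≡ t t<k with t ∈? ws
      ... | yes t∈ws rewrite δs-∈ ws-uniq t∈ws = lmcVec-≢ D (All.lookup cut t∈ws)
      ... | no  t∉ws rewrite δs-∉ t∉ws = lmcVec-≡ D (rest-uncut t t<k t∉ws)

    cut-between : ∀ a m → g a ≢ g (a + m) → ∃ λ c → a ≤ c × c < a + m × g c ≢ g (suc c)
    cut-between a zero    neq = contradiction (cong g (sym (+-identityʳ a))) neq
    cut-between a (suc m) neq with g (a + m) Finₚ.≟ g (a + suc m)
    ... | no neq′ = a + m , m≤m+n a m , ≤-reflexive (sym (+-suc a m)) , λ eq → neq′ (trans eq (cong g (sym (+-suc a m))))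
    ... | yes eq with cut-between a m (λ eq′ → neq (trans eq′ eq))
    ... | c , a≤c , c<a+m , cut = c , a≤c , <-≤-trans c<a+m (+-monoʳ-≤ a (n≤1+n m)) , cut

    cut-between′ : ∀ {a b} → a ≤ b → g a ≢ g b → ∃ λ c → a ≤ c × c < b × g c ≢ g (suc c)
    cut-between′ {a} {b} a≤b neq with cut-between a (b ∸ a) (λ eq → neq (trans eq (cong g (m+[n∸m]≡n a≤b))))
    ... | c , a≤c , c<b , cut = c , a≤c , subst (c <_) (m+[n∸m]≡n a≤b) c<b , cut

    cut-mod-k : ∀ {c} → k ≤ c → g c ≢ g (suc c) → g (c ∸ k) ≢ g (suc (c ∸ k))
    cut-mod-k {c} k≤c cut eq = cut (begin
      g c                      ≡⟨ cong g (m∸n+n≡m k≤c) ⟨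
      g (c ∸ k + k)            ≡⟨ g-periodic (c ∸ k) ⟩
      g (c ∸ k)                ≡⟨ eq ⟩
      g (suc (c ∸ k))          ≡⟨ g-periodic (suc (c ∸ k)) ⟨
      g (suc (c ∸ k) + k)      ≡⟨ cong (λ z → g (suc z)) (m∸n+n≡m k≤c) ⟩
      g (suc c) ∎)
      where open ≡-Reasoning

    private
      ∸k< : ∀ {c b} → k ≤ c → c < b + k → c ∸ k < b
      ∸k< {c} {b} k≤c c<b+k = +-cancelʳ-< k (c ∸ k) b (subst (_< b + k) (sym (m∸n+n≡m k≤c)) c<b+k)

      at-most-3 : ∀ {us ws} → length us + length ws ≡ 3 → Unique us → Unique ws → All (_< k) us → All (_< k) ws →
        All (λ t → g t ≡ g (t + d)) us → All (λ t → g t ≢ g (suc t)) ws →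
        α (lmcVec D) ≤ℚ ones k ⊖ ones 3
      at-most-3 {us} {ws} eq uu uw us<k ws<k uncut cut =
        subst (α (lmcVec D) ≤ℚ_) (trans (merge (ones k) (ones (length us)) (ones (length ws)))
          (cong (ones k ⊖_) (trans (sym (ones-+ (length us) (length ws))) (cong ones eq))))
          (value-≤ uu uw us<k ws<k uncut cut)
        where
        merge : ∀ x y z → (x ⊖ y) ⊖ z ≡ x ⊖ (y ⊕ z)
        merge = Ring.solve-∀ ringℚ

    private
      -- Four cut edges push the value down to k - 4, below the right-hand side.
      at-most-4 : ∀ {ws} → Unique ws → All (_< k) ws → All (λ t → g t ≢ g (suc t)) ws → length ws ≡ 4 →
        α (lmcVec D) ≢ β
      at-most-4 {ws} uniq ws<k cut len tight = contradiction (subst₂ _≤ℚ_ (left (ones k)) (right (ones k))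
        (ℚₚ.+-monoˡ-≤ (ones 4 ⊖ ones k) bound₄)) λ { (*≤* (+≤+ ())) }
        where
        bound₄ : ones k ⊖ ones 3 ≤ℚ (ones k ⊖ 0ℚ) ⊖ ones 4
        bound₄ = subst₂ (λ x y → x ≤ℚ (ones k ⊖ 0ℚ) ⊖ ones y) (trans tight (RHS-ones k 3≤k)) len
          (value-≤ {[]} []ᵘ uniq ∅ ws<k ∅ cut)
        left : ∀ y → (y ⊖ (1ℚ ⊕ (1ℚ ⊕ (1ℚ ⊕ 0ℚ)))) ⊕ ((1ℚ ⊕ (1ℚ ⊕ (1ℚ ⊕ (1ℚ ⊕ 0ℚ)))) ⊖ y) ≡ 1ℚ
        left = Ring.solve-∀ ringℚ
        right : ∀ y → ((y ⊖ 0ℚ) ⊖ (1ℚ ⊕ (1ℚ ⊕ (1ℚ ⊕ (1ℚ ⊕ 0ℚ))))) ⊕ ((1ℚ ⊕ (1ℚ ⊕ (1ℚ ⊕ (1ℚ ⊕ 0ℚ)))) ⊖ y) ≡ 0ℚ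
        right = Ring.solve-∀ ringℚ

      Bound = α (lmcVec D) ≤ℚ ones k ⊖ ones 3

      two-cuts : ∀ {a b} → a < b → b < k → g a ≢ g (suc a) → g b ≢ g (suc b) → Bound
      two-cuts {a} {b} a<b b<k cut-a cut-b with suc a + d ≤? b
      two-cuts {a} {b} a<b b<k cut-a cut-b | yes long with g (suc a) Finₚ.≟ g (suc a + d)
      ... | yes uncut = at-most-3 {suc a ∷ []} {a ∷ b ∷ []} refl
            (∅ ∷ᵘ []ᵘ) ((<⇒≢ a<b ◂ ∅) ∷ᵘ ∅ ∷ᵘ []ᵘ) (≤-<-trans a<b b<k ◂ ∅) (<-trans a<b b<k ◂ b<k ◂ ∅) (uncut ◂ ∅) (cut-a ◂ cut-b ◂ ∅)
      ... | no neq with cut-between′ (m≤m+n (suc a) d) neq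
      ... | c , a<c , c< , cut-c = at-most-3 {[]} {a ∷ b ∷ c ∷ []} refl []ᵘ
            ((<⇒≢ a<b ◂ <⇒≢ a<c ◂ ∅) ∷ᵘ (≢-sym (<⇒≢ (<-≤-trans c< long)) ◂ ∅) ∷ᵘ ∅ ∷ᵘ []ᵘ)
            ∅ (<-trans a<b b<k ◂ b<k ◂ <-trans (<-≤-trans c< long) b<k ◂ ∅) ∅ (cut-a ◂ cut-b ◂ cut-c ◂ ∅)
      -- The arc from a + 1 to b has fewer than d edges, so the arc from b + 1 to a + k has at least
      -- d, and the half-chord at b + 1 stays inside it.
      two-cuts {a} {b} a<b b<k cut-a cut-b | no short with g (suc b) Finₚ.≟ g (suc b + d)
      two-cuts {a} {b} a<b b<k cut-a cut-b | no short | yes uncut with m≤n⇒m<n∨m≡n b<k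
      ... | inj₁ 1+b<k = at-most-3 {suc b ∷ []} {a ∷ b ∷ []} refl
            (∅ ∷ᵘ []ᵘ) ((<⇒≢ a<b ◂ ∅) ∷ᵘ ∅ ∷ᵘ []ᵘ) (1+b<k ◂ ∅) (<-trans a<b b<k ◂ b<k ◂ ∅) (uncut ◂ ∅) (cut-a ◂ cut-b ◂ ∅)
      -- The half-chord at b + 1 = k is listed under index 0.
      ... | inj₂ 1+b≡k = at-most-3 {0 ∷ []} {a ∷ b ∷ []} refl
            (∅ ∷ᵘ []ᵘ) ((<⇒≢ a<b ◂ ∅) ∷ᵘ ∅ ∷ᵘ []ᵘ) (0<k ◂ ∅) (<-trans a<b b<k ◂ b<k ◂ ∅) (uncut₀ ◂ ∅) (cut-a ◂ cut-b ◂ ∅)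
            where
            open ≡-Reasoning
            uncut₀ : g 0 ≡ g d
            uncut₀ = begin
              g 0             ≡⟨ g-k ⟨
              g k             ≡⟨ cong g 1+b≡k ⟨
              g (suc b)       ≡⟨ uncut ⟩
              g (suc b + d)   ≡⟨ cong (λ z → g (z + d)) 1+b≡k ⟩
              g (k + d)       ≡⟨ cong g (+-comm k d) ⟩
              g (d + k)       ≡⟨ g-periodic d ⟩
              g d ∎
      two-cuts {a} {b} a<b b<k cut-a cut-b | no short | no neq with cut-between′ (m≤m+n (suc b) d) neq
      ... | c , b<c , c< , cut-c with c <? k
      ... | yes c<k = at-most-3 {[]} {a ∷ b ∷ c ∷ []} refl []ᵘ
            ((<⇒≢ a<b ◂ <⇒≢ (<-trans a<b b<c) ◂ ∅) ∷ᵘ (<⇒≢ b<c ◂ ∅) ∷ᵘ ∅ ∷ᵘ []ᵘ)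
            ∅ (<-trans a<b b<k ◂ b<k ◂ c<k ◂ ∅) ∅ (cut-a ◂ cut-b ◂ cut-c ◂ ∅)
      ... | no c≮k = at-most-3 {[]} {c ∸ k ∷ a ∷ b ∷ []} refl []ᵘ
            ((<⇒≢ c′<a ◂ <⇒≢ (<-trans c′<a a<b) ◂ ∅) ∷ᵘ (<⇒≢ a<b ◂ ∅) ∷ᵘ ∅ ∷ᵘ []ᵘ)
            ∅ (<-trans c′<a (<-trans a<b b<k) ◂ <-trans a<b b<k ◂ b<k ◂ ∅)
            ∅ (cut-mod-k (≮⇒≥ c≮k) cut-c ◂ cut-a ◂ cut-b ◂ ∅)
            where
            c′<a : c ∸ k < a
            c′<a = ∸k< (≮⇒≥ c≮k) (subst (λ z → c < a + z) (sym k≡) (linear 0 (c< ⊹ ≰⇒> short) (solve (a ∷ b ∷ c ∷ d ∷ []))))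

      search : ∀ m → (∃ λ c → c < m × g c ≢ g (suc c)) ⊎ (∀ t → t ≤ m → g t ≡ g 0)
      search zero = inj₂ λ { zero _ → refl }
      search (suc m) with search m
      ... | inj₁ (c , c<m , cut) = inj₁ (c , m<n⇒m<1+n c<m , cut)
      ... | inj₂ const with g m Finₚ.≟ g (suc m)
      ... | no cut = inj₁ (m , n<1+n m , cut)
      ... | yes eq = inj₂ extend
        where
        extend : ∀ t → t ≤ suc m → g t ≡ g 0
        extend t t≤ with m≤n⇒m<n∨m≡n t≤
        ... | inj₁ (s≤s t≤m) = const t t≤m
        ... | inj₂ refl      = trans (sym eq) (const m ≤-refl)

      bound : Bound
      bound with search k
      ... | inj₂ const = at-most-3 {0 ∷ 1 ∷ 2 ∷ []} {[]} refl
            (((λ ()) ◂ (λ ()) ◂ ∅) ∷ᵘ ((λ ()) ◂ ∅) ∷ᵘ ∅ ∷ᵘ []ᵘ) []ᵘ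
            (0<k ◂ <⇒≤ 3≤k ◂ 3≤k ◂ ∅) ∅ (uncut 0 z≤n ◂ uncut 1 (s≤s z≤n) ◂ uncut 2 ≤-refl ◂ ∅) ∅
            where
            uncut : ∀ t → t ≤ 2 → g t ≡ g (t + d)
            uncut t t≤2 = trans (const t (≤-trans t≤2 (<⇒≤ 3≤k)))
              (sym (const (t + d) (subst (t + d ≤_) (sym k≡) (linear 1 (t≤2 ⊹ 2≤d) (solve (t ∷ d ∷ []))))))
      -- The walk is closed, so a second cut edge exists: after c if `g (suc c)` differs from `g k`,
      -- before c otherwise.
      ... | inj₁ (c , c<k , cut-c) with g (suc c) Finₚ.≟ g k
      ... | no neq with cut-between′ c<k neq
      ... | c′ , c<c′ , c′<k , cut-c′ = two-cuts c<c′ c′<k cut-c cut-c′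
      bound | inj₁ (c , c<k , cut-c) | yes eq with cut-between′ z≤n (λ eq′ → cut-c (sym (trans eq (trans g-k eq′))))
      ... | c′ , _ , c′<c , cut-c′ = two-cuts c′<c c<k cut-c′ cut-c

    value-≤-k-3 : α (lmcVec D) ≤ℚ β
    value-≤-k-3 = subst (α (lmcVec D) ≤ℚ_) (sym (RHS-ones k 3≤k)) bound

    -- Both arcs between the two cut edges have ends with different labels, so each arc contains a
    -- further cut edge.
    four-cuts⇒¬tight : ∀ {a b} → suc a ≤ b → b < k → g a ≢ g (suc a) → g b ≢ g (suc b) →
      g (suc a) ≢ g b → g (suc b) ≢ g a → α (lmcVec D) ≢ β
    four-cuts⇒¬tight {a} {b} a<b b<k cut-a cut-b ≢ab ≢ba tight
      with cut-between′ a<b ≢ab | cut-between′ {suc b} {a + k} (≤-trans b<k (m≤n+m k a)) (λ eq → ≢ba (trans eq (g-periodic a)))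
    ... | c , a<c , c<b , cut-c | e , b<e , e<a+k , cut-e with e <? k
    ... | yes e<k = at-most-4 {a ∷ b ∷ c ∷ e ∷ []}
            ((<⇒≢ a<b ◂ <⇒≢ a<c ◂ <⇒≢ (<-trans a<b b<e) ◂ ∅) 
              ∷ᵘ (≢-sym (<⇒≢ c<b) ◂ <⇒≢ b<e ◂ ∅) ∷ᵘ (<⇒≢ (<-trans c<b b<e) ◂ ∅) ∷ᵘ ∅ ∷ᵘ []ᵘ)
            (<-trans a<b b<k ◂ b<k ◂ <-trans c<b b<k ◂ e<k ◂ ∅) (cut-a ◂ cut-b ◂ cut-c ◂ cut-e ◂ ∅) refl tight
    ... | no e≮k = at-most-4 {a ∷ b ∷ c ∷ e ∸ k ∷ []}
            ((<⇒≢ a<b ◂ <⇒≢ a<c ◂ ≢-sym (<⇒≢ e′<a) ◂ ∅) 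
              ∷ᵘ (≢-sym (<⇒≢ c<b) ◂ ≢-sym (<⇒≢ (<-trans e′<a a<b)) ◂ ∅) ∷ᵘ (≢-sym (<⇒≢ (<-trans e′<a a<c)) ◂ ∅) ∷ᵘ ∅ ∷ᵘ []ᵘ)
            (<-trans a<b b<k ◂ b<k ◂ <-trans c<b b<k ◂ <-trans e′<a (<-trans a<b b<k) ◂ ∅)
            (cut-a ◂ cut-b ◂ cut-c ◂ cut-mod-k (≮⇒≥ e≮k) cut-e ◂ ∅) refl tight
      where
      e′<a : e ∸ k < a
      e′<a = ∸k< (≮⇒≥ e≮k) e<a+k

  ℓ₀ ℓ₁ ℓ₂ : Fin n
  ℓ₀ = Fin.fromℕ< (≤-trans (s≤s z≤n) 3≤n)
  ℓ₁ = Fin.fromℕ< (≤-trans (s≤s (s≤s z≤n)) 3≤n)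
  ℓ₂ = Fin.fromℕ< 3≤n

  ℓ₀≢ℓ₁ : ℓ₀ ≢ ℓ₁
  ℓ₀≢ℓ₁ eq = contradiction (trans (sym (Finₚ.toℕ-fromℕ< _)) (trans (cong toℕ eq) (Finₚ.toℕ-fromℕ< _))) λ ()

  ℓ₀≢ℓ₂ : ℓ₀ ≢ ℓ₂
  ℓ₀≢ℓ₂ eq = contradiction (trans (sym (Finₚ.toℕ-fromℕ< _)) (trans (cong toℕ eq) (Finₚ.toℕ-fromℕ< _))) λ ()

  ℓ₁≢ℓ₂ : ℓ₁ ≢ ℓ₂
  ℓ₁≢ℓ₂ eq = contradiction (trans (sym (Finₚ.toℕ-fromℕ< _)) (trans (cong toℕ eq) (Finₚ.toℕ-fromℕ< _))) λ ()

  RHS≢0 : β ≢ 0ℚ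
  RHS≢0 eq = fromℕ≢0 (d + d ∸ 3) (trans (cong (λ z → ⁺ z ÷ 1) (sym k∸3≡)) eq)
    where
    k∸3≡ : k ∸ 3 ≡ suc (d + d ∸ 3)
    k∸3≡ = trans (cong (_∸ 3) k≡) (+-∸-assoc 1 {d + d} {3} (≤-trans (n≤1+n 3) (2≤d ⊹ 2≤d)))

  private
    module Fwd = Intervals (forward (u 0)) ℓ₀≢ℓ₁ ℓ₀≢ℓ₂ ℓ₁≢ℓ₂

  single-block : Decomposition n
  single-block = Fwd.intervals 0 0 0

  single-block≡0 : ∀ a b → lmcVec single-block a b ≡ 0ℚ
  single-block≡0 a b = lmcVec-≡ single-block (trans (constant a) (sym (constant b)))
    where
    constant : ∀ a → proj₁ single-block a ≡ ℓ₀
    constant a = Fwd.label-≡ {s = fdist (u 0) a} (Fwd.above z≤n z≤n z≤n)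

  at-injective : ∀ {s t} → s < k → t < k → u s ≡ u t → s ≡ t
  at-injective {s} {t} s<k t<k eq = begin
    s               ≡⟨ m<n⇒m%n≡m s<k ⟨
    s % k           ≡⟨ Finₚ.toℕ-fromℕ< (m%n<n s k) ⟨
    toℕ (s mod k)   ≡⟨ cong toℕ (v-injective eq) ⟩
    toℕ (t mod k)   ≡⟨ Finₚ.toℕ-fromℕ< (m%n<n t k) ⟩
    t % k           ≡⟨ m<n⇒m%n≡m t<k ⟩
    t ∎
    where open ≡-Reasoning

  -- A facet forces a polygon without crossing edges

  module _ (facet : FacetDefining (LMC n) α β) where

    -- On the face, x_{v_m v_{m+1}} + x_{v_t v_{t+1}} = x_{v_m v_t} + x_{v_{m+1} v_{t+1}}
    -- whenever no decomposition has v_m v_{m+1} and v_t v_{t+1} in two different blocks.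
    ¬crossing : ∀ {m t} → suc m ≤ t → t < k →
      (∀ D → NonCrossing (proj₁ D) (u m) (u (suc m)) (u t) (u (suc t))) →
      (Q : Decomposition n) → proj₁ Q (u m) ≡ proj₁ Q (u t) → proj₁ Q (u (suc m)) ≡ proj₁ Q (u (suc t)) →
      proj₁ Q (u m) ≢ proj₁ Q (u (suc m)) → ⊥
    ¬crossing {m} {t} m<t t<k nonCrossing Q mt m′t′ mm′ =
      second-equation⇒¬facet (α-linear) (λ D → value-≤-k-3 D)
        RHS≢0 single-block single-block≡0 α′-linear tight⇒0 Q α′Q≢0 facet
      where
      α′ : Vect n → ℚ
      α′ x = (x (u m) (u (suc m)) ⊖ x (u m) (u t)) ⊖ (x (u (suc m)) (u (suc t)) ⊖ x (u t) (u (suc t)))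
      α′-linear : Linear α′
      α′-linear = ⊖-linear (⊖-linear (coordinate-linear _ _) (coordinate-linear _ _)) (⊖-linear (coordinate-linear _ _) (coordinate-linear _ _))
      α′-value : ∀ D {A P R B} → lmcVec D (u m) (u (suc m)) ≡ A → lmcVec D (u m) (u t) ≡ P →
        lmcVec D (u (suc m)) (u (suc t)) ≡ R → lmcVec D (u t) (u (suc t)) ≡ B → α′ (lmcVec D) ≡ (A ⊖ P) ⊖ (R ⊖ B)
      α′-value D refl refl refl refl = refl
      -- `Q` cuts both edges and neither of the other two pairs, so the value is 2.
      α′Q≢0 : α′ (lmcVec Q) ≢ 0ℚ
      α′Q≢0 eq = contradiction (trans (sym (α′-value Q (lmcVec-≢ Q mm′) (lmcVec-≡ Q mt) (lmcVec-≡ Q m′t′)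
        (lmcVec-≢ Q λ tt′ → mm′ (trans mt (trans tt′ (sym m′t′)))))) eq) λ ()
      tight⇒0 : ∀ D → α (lmcVec D) ≡ β → α′ (lmcVec D) ≡ 0ℚ
      tight⇒0 D tight = cases (f (u m) Finₚ.≟ f (u (suc m))) (f (u t) Finₚ.≟ f (u (suc t)))
        where
        f = proj₁ D
        nc₁ = proj₁ (nonCrossing D)
        nc₂ = proj₂ (nonCrossing D)
        -- When both edges are cut and v_m, v_t share a block, the labels also differ at the ends of
        -- the two arcs between the edges: four cut edges.
        ≢mt : f (u m) ≢ f (u (suc m)) → f (u t) ≢ f (u (suc t)) → f (u m) ≢ f (u t)
        ≢mt A B eq = four-cuts⇒¬tight D m<t t<k A B (λ eq′ → A (trans eq (sym eq′))) (λ eq′ → B (trans (sym eq) (sym eq′))) tight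
        ≢m′t′ : f (u m) ≢ f (u (suc m)) → f (u t) ≢ f (u (suc t)) → f (u (suc m)) ≢ f (u (suc t))
        ≢m′t′ A B eq = four-cuts⇒¬tight D m<t t<k A B (λ eq′ → B (trans (sym eq′) eq)) (λ eq′ → A (trans (sym eq′) (sym eq))) tight
        cases : Dec (f (u m) ≡ f (u (suc m))) → Dec (f (u t) ≡ f (u (suc t))) → α′ (lmcVec D) ≡ 0ℚ
        cases (no A) (no B) = α′-value D (lmcVec-≢ D A) (lmcVec-≢ D (≢mt A B)) (lmcVec-≢ D (≢m′t′ A B)) (lmcVec-≢ D B)
        cases (yes A) (yes B) with nc₁ A
        ... | inj₁ tm  = α′-value D (lmcVec-≡ D A) (lmcVec-≡ D (sym tm)) (lmcVec-≡ D (trans (sym A) (trans (sym tm) B))) (lmcVec-≡ D B)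
        ... | inj₂ t′m = α′-value D (lmcVec-≡ D A) (lmcVec-≡ D (sym (trans B t′m))) (lmcVec-≡ D (trans (sym A) (sym t′m))) (lmcVec-≡ D B)
        cases (yes A) (no B) with nc₁ A
        ... | inj₁ tm  = α′-value D (lmcVec-≡ D A) (lmcVec-≡ D (sym tm)) (lmcVec-≢ D λ eq → B (trans tm (trans A eq))) (lmcVec-≢ D B)
        ... | inj₂ t′m = α′-value D (lmcVec-≡ D A) (lmcVec-≢ D λ eq → B (trans (sym eq) (sym t′m))) (lmcVec-≡ D (trans (sym A) (sym t′m))) (lmcVec-≢ D B)
        cases (no A) (yes B) with nc₂ B
        ... | inj₁ mt  = α′-value D (lmcVec-≢ D A) (lmcVec-≡ D mt) (lmcVec-≢ D λ eq → A (trans mt (trans B (sym eq)))) (lmcVec-≡ D B)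
        ... | inj₂ m′t = α′-value D (lmcVec-≢ D A) (lmcVec-≢ D λ eq → A (trans eq (sym m′t))) (lmcVec-≡ D (trans m′t B)) (lmcVec-≡ D B)

    r : ℕ → ℕ
    r t = fdist (u 0) (u t)

    private
      inside : ∀ {lo hi} a → lo ≤ fdist (u 0) a → fdist (u 0) a < hi → proj₁ (Fwd.intervals lo hi hi) a ≡ ℓ₁
      inside a lo≤a a<hi = Fwd.label-≡ (Fwd.first lo≤a a<hi)

      before : ∀ {lo hi} a → fdist (u 0) a < lo → proj₁ (Fwd.intervals lo hi hi) a ≡ ℓ₀
      before a a<lo = Fwd.label-≡ (Fwd.below a<lo)

      after : ∀ {lo hi} a → lo ≤ hi → hi ≤ fdist (u 0) a → proj₁ (Fwd.intervals lo hi hi) a ≡ ℓ₀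
      after a lo≤hi hi≤a = Fwd.label-≡ (Fwd.above (≤-trans lo≤hi hi≤a) hi≤a hi≤a)

    module _ {m t : ℕ} (m<t : suc m ≤ t) (t<k : t < k) where

      -- The names list the four endpoints by position. In each order the block of `Q` is the
      -- interval between two of the endpoints that separates v_m, v_t from v_{m+1}, v_{t+1}; t + 1
      -- = k is allowed and returns to position 0.
      ¬-m-t-m′-t′ : r m < r t → r t < r (suc m) → r (suc m) < r (suc t) → ⊥
      ¬-m-t-m′-t′ p q s = ¬crossing m<t t<k (λ D → interleaved⇒nonCrossing D (u 0) p q s)
        (Fwd.intervals (r m) (r (suc m)) (r (suc m)))
        (trans m∈ (sym (inside (u t) (<⇒≤ p) q)))
        (trans m′∉ (sym (after (u (suc t)) (<⇒≤ (<-trans p q)) (<⇒≤ s))))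
        λ eq → ℓ₀≢ℓ₁ (trans (sym m′∉) (trans (sym eq) m∈))
        where
        m∈ = inside {r m} {r (suc m)} (u m) ≤-refl (<-trans p q)
        m′∉ = after {r m} {r (suc m)} (u (suc m)) (<⇒≤ (<-trans p q)) ≤-refl

      ¬-m-t′-m′-t : r m < r (suc t) → r (suc t) < r (suc m) → r (suc m) < r t → ⊥
      ¬-m-t′-m′-t p q s = ¬crossing m<t t<k (λ D → nonCrossing-flip {f = proj₁ D} (interleaved⇒nonCrossing D (u 0) p q s))
        (Fwd.intervals (r (suc t)) (r t) (r t))
        (trans m∉ (sym (after (u t) (<⇒≤ (<-trans q s)) ≤-refl)))
        (trans m′∈ (sym (inside (u (suc t)) ≤-refl (<-trans q s))))
        λ eq → ℓ₀≢ℓ₁ (trans (sym m∉) (trans eq m′∈))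
        where
        m∉ = before {r (suc t)} {r t} (u m) p
        m′∈ = inside {r (suc t)} {r t} (u (suc m)) (<⇒≤ q) s

      ¬-t′-m-t-m′ : r (suc t) < r m → r m < r t → r t < r (suc m) → ⊥
      ¬-t′-m-t-m′ p q s = ¬crossing m<t t<k
        (λ D → nonCrossing-flip {f = proj₁ D} (nonCrossing-sym {f = proj₁ D} (interleaved⇒nonCrossing D (u 0) p q s)))
        (Fwd.intervals (r m) (r (suc m)) (r (suc m)))
        (trans m∈ (sym (inside (u t) (<⇒≤ q) s)))
        (trans m′∉ (sym (before (u (suc t)) p)))
        λ eq → ℓ₀≢ℓ₁ (trans (sym m′∉) (trans (sym eq) m∈))
        where
        m∈ = inside {r m} {r (suc m)} (u m) ≤-refl (<-trans q s)
        m′∉ = after {r m} {r (suc m)} (u (suc m)) (<⇒≤ (<-trans q s)) ≤-refl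

      ¬-t′-m′-t-m : r (suc t) < r (suc m) → r (suc m) < r t → r t < r m → ⊥
      ¬-t′-m′-t-m p q s = ¬crossing m<t t<k
        (λ D → nonCrossing-flip {f = proj₁ D} (nonCrossing-sym {f = proj₁ D} (nonCrossing-flip {f = proj₁ D} (interleaved⇒nonCrossing D (u 0) p q s))))
        (Fwd.intervals (r (suc t)) (r t) (r t))
        (trans m∉ (sym (after (u t) (<⇒≤ (<-trans p q)) ≤-refl)))
        (trans m′∈ (sym (inside (u (suc t)) ≤-refl (<-trans p q))))
        λ eq → ℓ₀≢ℓ₁ (trans (sym m∉) (trans eq m′∈))
        where
        m∉ = after {r (suc t)} {r t} (u m) (<⇒≤ (<-trans p q)) (<⇒≤ s)
        m′∈ = inside {r (suc t)} {r t} (u (suc m)) (<⇒≤ p) q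

    r-injective : ∀ {s t} → s < k → t < k → r s ≡ r t → s ≡ t
    r-injective s<k t<k eq = at-injective s<k t<k (fdist-injective {o = u 0} eq)

    r-0 : r 0 ≡ 0
    r-0 = fdist-unique (≤-trans (s≤s z≤n) 3≤n) (+ₘ-0 (u 0))

    r-k : r k ≡ 0
    r-k = trans (cong (fdist (u 0)) (at-periodic 0)) r-0

    r-pos : ∀ {t} → 0 < t → t < k → 0 < r t
    r-pos {t} 0<t t<k = ≤∧≢⇒< z≤n λ eq → <⇒≢ 0<t (r-injective (<-trans 0<t t<k) t<k (trans r-0 eq))

    r-connex : ∀ {s t} → s < k → t < k → s ≢ t → r s < r t ⊎ r t < r s
    r-connex {s} {t} s<k t<k s≢t with <-cmp (r s) (r t)
    ... | tri< p _ _ = inj₁ p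
    ... | tri≈ _ p _ = contradiction (r-injective s<k t<k p) s≢t
    ... | tri> _ _ p = inj₂ p

    last<k : ∀ {p} → suc p ≡ k → p < k
    last<k eq = ≤-reflexive eq

    -- Descending from v_k = v₀, no later vertex lies between v_i and v_{i+1}.
    increasing-step : ∀ {i} → 0 < i → (∀ j → i < j → j < k → r i < r j) → ∀ j → suc i < j → j < k → r (suc i) < r j
    increasing-step {i} 0<i later j i<j j<k = descend (k ∸ suc j) j (m∸n+n≡m j<k) i<j
      where
      descend : ∀ s j → s + suc j ≡ k → suc i < j → r (suc i) < r j
      descend s j s+≡k i<j with r-connex (<-trans i<j j<k′) j<k′ (<⇒≢ i<j)
        where
        j<k′ : j < k
        j<k′ = subst (j <_) s+≡k (m≤n+m (suc j) s)
      ... | inj₁ i<j′ = i<j′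
      descend zero j 1+j≡k i<j | inj₂ between = ⊥-elim (¬-t′-m-t-m′ (<⇒≤ i<j) (last<k 1+j≡k)
        (subst (_< r i) (sym (trans (cong r 1+j≡k) r-k)) (r-pos 0<i i<k)) (later j (<-trans (n<1+n i) i<j) (last<k 1+j≡k)) between)
        where i<k = <-trans (<-trans (n<1+n i) i<j) (last<k 1+j≡k)
      -- The next vertex already lies beyond v_{i+1}, so the edge from v_j to it crosses v_i
      -- v_{i+1}.
      descend (suc s) j s+≡k i<j | inj₂ between = ⊥-elim (¬-m-t-m′-t′ (<⇒≤ i<j) j<k′
        (later j (<-trans (n<1+n i) i<j) j<k′) between (descend s (suc j) (trans (+-suc s (suc j)) s+≡k) (m<n⇒m<1+n i<j)))
        where
        j<k′ : j < k
        j<k′ = subst (j <_) s+≡k (m≤n+m (suc j) (suc s))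

    -- Mirror image: if v_j lay between v_{i+1} and v_i, the edge to v_{j+1}, which lies below
    -- v_{i+1} by descent or is v₀, would cross v_i v_{i+1}.
    decreasing-step : ∀ {i} → (∀ j → i < j → j < k → r j < r i) → ∀ j → suc i < j → j < k → r j < r (suc i)
    decreasing-step {i} later j i<j j<k = descend (k ∸ suc j) j (m∸n+n≡m j<k) i<j
      where
      descend : ∀ s j → s + suc j ≡ k → suc i < j → r j < r (suc i)
      descend s j s+≡k i<j with r-connex (<-trans i<j j<k′) j<k′ (<⇒≢ i<j)
        where
        j<k′ : j < k
        j<k′ = subst (j <_) s+≡k (m≤n+m (suc j) s)
      ... | inj₂ j<i′ = j<i′
      descend zero j 1+j≡k i<j | inj₁ between = ⊥-elim (¬-t′-m′-t-m (<⇒≤ i<j) (last<k 1+j≡k)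
        (subst (_< r (suc i)) (sym (trans (cong r 1+j≡k) r-k)) (r-pos (s≤s z≤n) (<-trans i<j (last<k 1+j≡k)))) between
        (later j (<-trans (n<1+n i) i<j) (last<k 1+j≡k)))
      descend (suc s) j s+≡k i<j | inj₁ between = ⊥-elim (¬-t′-m′-t-m (<⇒≤ i<j) j<k′
        (descend s (suc j) (trans (+-suc s (suc j)) s+≡k) (m<n⇒m<1+n i<j)) between (later j (<-trans (n<1+n i) i<j) j<k′))
        where
        j<k′ : j < k
        j<k′ = subst (j <_) s+≡k (m≤n+m (suc j) (suc s))

    increasing : (∀ j → 1 < j → j < k → r 1 < r j) → ∀ i j → suc i < j → j < k → r (suc i) < r j
    increasing start zero    = start
    increasing start (suc i) = increasing-step (s≤s z≤n) (increasing start i)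

    decreasing : (∀ j → 1 < j → j < k → r j < r 1) → ∀ i j → suc i < j → j < k → r j < r (suc i)
    decreasing start zero    = start
    decreasing start (suc i) = decreasing-step (decreasing start i)

    -- The edge v₀v₁ divides the circle and v₂ selects a side; a later edge that changes sides would
    -- cross v₀v₁. This fixes the orientation of the whole walk.
    ascent-from-2 : r 1 < r 2 → ∀ j → 2 + j < k → r 1 < r (2 + j)
    ascent-from-2 start zero    _   = start
    ascent-from-2 start (suc j) j<k with r-connex (<⇒≤ 3≤k) j<k (λ ())
    ... | inj₁ p = p
    ... | inj₂ p = ⊥-elim (¬-m-t′-m′-t (s≤s z≤n) (<⇒≤ j<k)
      (subst (_< r (3 + j)) (sym r-0) (r-pos (s≤s z≤n) j<k)) p (ascent-from-2 start j (<⇒≤ j<k)))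

    descent-from-2 : r 2 < r 1 → ∀ j → 2 + j < k → r (2 + j) < r 1
    descent-from-2 start zero    _   = start
    descent-from-2 start (suc j) j<k with r-connex (<⇒≤ 3≤k) j<k (λ ())
    ... | inj₂ p = p
    ... | inj₁ p = ⊥-elim (¬-m-t-m′-t′ (s≤s z≤n) (<⇒≤ j<k)
      (subst (_< r (2 + j)) (sym r-0) (r-pos (s≤s z≤n) (<⇒≤ j<k))) (descent-from-2 start j (<⇒≤ j<k)) p)

    ascent-start : r 1 < r 2 → ∀ j → 1 < j → j < k → r 1 < r j
    ascent-start start (suc (suc j)) _         j<k = ascent-from-2 start j j<k
    ascent-start start (suc zero)    (s≤s ()) _

    descent-start : r 2 < r 1 → ∀ j → 1 < j → j < k → r j < r 1
    descent-start start (suc (suc j)) _         j<k = descent-from-2 start j j<k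
    descent-start start (suc zero)    (s≤s ()) _

    private
      1+i<k : ∀ {i} → i ≤ k ∸ 2 → suc i < k
      1+i<k {i} i≤ = subst (suc (suc i) ≤_) (m+[n∸m]≡n (<⇒≤ 3≤k)) (s≤s (s≤s i≤))

      consecutive≢ : ∀ {i} → suc i < k → u i ≢ u (suc i)
      consecutive≢ i<k eq = <⇒≢ (n<1+n _) (at-injective (<⇒≤ i<k) i<k eq)

    facet⇒trueTo : TrueTo v
    facet⇒trueTo with r-connex (<⇒≤ 3≤k) 3≤k (λ ())
    ... | inj₁ up = inj₁ λ i i≤ → <⇒≤ (r-suc i (1+i<k i≤)) , consecutive≢ (1+i<k i≤)
      where
      r-suc : ∀ i → suc i < k → r i < r (suc i)
      r-suc zero    1<k = subst (_< r 1) (sym r-0) (r-pos (s≤s z≤n) 1<k)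
      r-suc (suc i) i<k = increasing (ascent-start up) i (suc (suc i)) ≤-refl i<k
    ... | inj₂ down = inj₂ λ i i≤ → back i (1+i<k i≤) , consecutive≢ (1+i<k i≤)
      where
      back : ∀ i → suc i < k → fdist (u (suc i)) (u i) ≤ fdist (u (suc i)) (u 0)
      back zero    _   = ≤-refl
      back (suc i) i<k = subst₂ _≤_ (sym to-prev) (sym to-0) (∸-monoˡ-≤ rb (<⇒≤ (fdist<n (u 0) (u (suc i)))))
        where
        open ≡-Reasoning
        a = u (suc i)
        b = u (suc (suc i))
        ra = r (suc i)
        rb = r (suc (suc i))
        rb<ra : rb < ra
        rb<ra = decreasing (descent-start down) i (suc (suc i)) ≤-refl i<k
        from-b : ∀ s → rb ≤ s → b +ₘ (s ∸ rb) ≡ u 0 +ₘ s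
        from-b s rb≤s = begin
          b +ₘ (s ∸ rb)                  ≡⟨ cong (_+ₘ (s ∸ rb)) (+ₘ-fdist (u 0) b) ⟨
          (u 0 +ₘ rb) +ₘ (s ∸ rb)        ≡⟨ +ₘ-+ (u 0) rb (s ∸ rb) ⟩
          u 0 +ₘ (rb + (s ∸ rb))         ≡⟨ cong (u 0 +ₘ_) (m+[n∸m]≡n rb≤s) ⟩
          u 0 +ₘ s ∎
        to-prev : fdist b a ≡ ra ∸ rb
        to-prev = fdist-unique (≤-<-trans (m∸n≤m ra rb) (fdist<n (u 0) a)) (trans (from-b ra (<⇒≤ rb<ra)) (+ₘ-fdist (u 0) a))
        to-0 : fdist b (u 0) ≡ n ∸ rb
        to-0 = fdist-unique (∸-monoʳ-< (r-pos (s≤s z≤n) i<k) (<⇒≤ (fdist<n (u 0) b))) (trans (from-b n (<⇒≤ (fdist<n (u 0) b))) (+ₘ-n (u 0)))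

  -- Tight decompositions with two or three blocks

  module _ (D : Decomposition n) where
    private
      γ : ℕ → Fin n
      γ = g D

      -- Half-chord t ≤ d joins t and t + d; half-chord t > d wraps around and joins a = t - (d + 1)
      -- with a + d + 1. So the half-chords are the pairs in 0, ..., 2d at distance d or d + 1.
      -- Half-chord `c` is exempt.
      chords-cut : (c : ℕ) → (∀ a → a + d ≤ d + d → a ≢ c → γ a ≢ γ (a + d)) →
        (∀ a → a + suc d ≤ d + d → a + suc d ≢ c → γ a ≢ γ (a + suc d)) →
        ∀ t → t < k → t ≢ c → γ t ≢ γ (t + d)
      chords-cut c short long t t<k t≢c eq with t ≤? d
      ... | yes t≤d = short t (+-monoˡ-≤ d t≤d) t≢c eq
      ... | no  t≰d = long (t ∸ suc d) (subst (_≤ d + d) (sym t≡) (<k⁻¹ t<k)) (λ eq → t≢c (trans (sym t≡) eq))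
          (trans (sym wrapped) (trans (sym eq) (cong γ (sym t≡))))
        where
        t≡ : t ∸ suc d + suc d ≡ t
        t≡ = m∸n+n≡m (≰⇒> t≰d)
        wrapped : γ (t + d) ≡ γ (t ∸ suc d)
        wrapped = trans (cong γ (trans (cong (_+ d) (sym t≡)) (trans (+-assoc (t ∸ suc d) (suc d) d) (cong (λ z → t ∸ suc d + z) (sym k≡)))))
          (g-periodic D (t ∸ suc d))

    module _ {ℓ₀ ℓ₁ ℓ₂ : Fin n} (ℓ₀≢ℓ₁ : ℓ₀ ≢ ℓ₁) (ℓ₀≢ℓ₂ : ℓ₀ ≢ ℓ₂) (ℓ₁≢ℓ₂ : ℓ₁ ≢ ℓ₂)
      {i j l : ℕ} (i<j : i < j) (j<l : j < l) (l≤2d : l ≤ d + d) (j≤i+d : j ≤ i + d) (l≤j+d : l ≤ j + d) (i+d<l : i + d < l)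
      (γ₀ : ∀ t → t ≤ i → γ t ≡ ℓ₀) (γ₁ : ∀ t → i < t → t ≤ j → γ t ≡ ℓ₁)
      (γ₂ : ∀ t → j < t → t ≤ l → γ t ≡ ℓ₂) (γ₃ : ∀ t → l < t → t ≤ k → γ t ≡ ℓ₀) where

      private
        data Arc (t : ℕ) : Fin n → Set where
          arc₀ : t ≤ i → Arc t ℓ₀
          arc₁ : i < t → t ≤ j → Arc t ℓ₁
          arc₂ : j < t → t ≤ l → Arc t ℓ₂
          arc₃ : l < t → Arc t ℓ₀

        arc : ∀ t → t ≤ k → Arc t (γ t)
        arc t t≤k with t ≤? i | t ≤? j | t ≤? l
        ... | yes p | _     | _     = subst (Arc t) (sym (γ₀ t p)) (arc₀ p)
        ... | no p  | yes q | _     = subst (Arc t) (sym (γ₁ t (≰⇒> p) q)) (arc₁ (≰⇒> p) q)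
        ... | no _  | no q  | yes s = subst (Arc t) (sym (γ₂ t (≰⇒> q) s)) (arc₂ (≰⇒> q) s)
        ... | no _  | no _  | no s  = subst (Arc t) (sym (γ₃ t (≰⇒> s) t≤k)) (arc₃ (≰⇒> s))

        -- No arc with at most d points holds two indices at distance d or d + 1. The arc through v₀
        -- appears as `arc₀` and `arc₃`; a coincidence of labels within an arc is refuted by adding
        -- up the inequalities.
        apart : ∀ {a b x y} → a + d ≤ b → b ≤ a + suc d → b ≤ d + d → Arc a x → Arc b y → x ≢ y
        apart {a} {b} p q s (arc₀ a≤i)     (arc₀ b≤i)     _  =
          ¬linear 0 (p ⊹ b≤i ⊹ i+d<l ⊹ l≤2d ⊹ z≤n {a}) (solve (a ∷ b ∷ i ∷ l ∷ d ∷ []))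
        apart         p q s (arc₀ _)       (arc₁ _ _)     eq = ℓ₀≢ℓ₁ eq
        apart         p q s (arc₀ _)       (arc₂ _ _)     eq = ℓ₀≢ℓ₂ eq
        apart {a} {b} p q s (arc₀ a≤i)     (arc₃ l<b)     _  =
          ¬linear 0 (q ⊹ a≤i ⊹ i+d<l ⊹ l<b) (solve (a ∷ b ∷ i ∷ l ∷ d ∷ []))
        apart         p q s (arc₁ _ _)     (arc₀ _)       eq = ℓ₀≢ℓ₁ (sym eq)
        apart {a} {b} p q s (arc₁ i<a _)   (arc₁ _ b≤j)   _  =
          ¬linear 0 (p ⊹ b≤j ⊹ j≤i+d ⊹ i<a) (solve (a ∷ b ∷ i ∷ j ∷ d ∷ []))
        apart         p q s (arc₁ _ _)     (arc₂ _ _)     eq = ℓ₁≢ℓ₂ eq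
        apart         p q s (arc₁ _ _)     (arc₃ _)       eq = ℓ₀≢ℓ₁ (sym eq)
        apart         p q s (arc₂ _ _)     (arc₀ _)       eq = ℓ₀≢ℓ₂ (sym eq)
        apart         p q s (arc₂ _ _)     (arc₁ _ _)     eq = ℓ₁≢ℓ₂ (sym eq)
        apart {a} {b} p q s (arc₂ j<a _)   (arc₂ _ b≤l)   _  =
          ¬linear 0 (p ⊹ b≤l ⊹ l≤j+d ⊹ j<a) (solve (a ∷ b ∷ j ∷ l ∷ d ∷ []))
        apart         p q s (arc₂ _ _)     (arc₃ _)       eq = ℓ₀≢ℓ₂ (sym eq)
        apart {a} {b} p q s (arc₃ l<a)     (arc₀ b≤i)     _  =
          ¬linear (1 + d + d) (p ⊹ b≤i ⊹ l<a ⊹ i+d<l) (solve (a ∷ b ∷ i ∷ l ∷ d ∷ []))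
        apart         p q s (arc₃ _)       (arc₁ _ _)     eq = ℓ₀≢ℓ₁ eq
        apart         p q s (arc₃ _)       (arc₂ _ _)     eq = ℓ₀≢ℓ₂ eq
        apart {a} {b} p q s (arc₃ l<a)     (arc₃ _)       _  =
          ¬linear (1 + i) (p ⊹ l<a ⊹ i+d<l ⊹ s) (solve (a ∷ b ∷ i ∷ l ∷ d ∷ []))

        i<k = <k (≤-trans (<⇒≤ (<-trans i<j j<l)) l≤2d)
        j<k = <k (≤-trans (<⇒≤ j<l) l≤2d)
        l<k = <k l≤2d

      tight-triple : α (lmcVec D) ≡ β
      tight-triple = trans (value-≡ D {[]} {i ∷ j ∷ l ∷ []} []ᵘ
        ((<⇒≢ i<j ◂ <⇒≢ (<-trans i<j j<l) ◂ ∅) ∷ᵘ (<⇒≢ j<l ◂ ∅) ∷ᵘ ∅ ∷ᵘ []ᵘ) ∅ (i<k ◂ j<k ◂ l<k ◂ ∅) ∅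
        (cut-i ◂ cut-j ◂ cut-l ◂ ∅)
        -- Index k is out of range: no half-chord is exempt.
        (λ t t<k _ → chords-cut k
          (λ a le _ → apart ≤-refl (+-monoʳ-≤ a (n≤1+n d)) le (arc a (<⇒≤ (<k (≤-trans (m≤m+n a d) le)))) (arc (a + d) (<⇒≤ (<k le))))
          (λ a le _ → apart (+-monoʳ-≤ a (n≤1+n d)) ≤-refl le (arc a (<⇒≤ (<k (≤-trans (m≤m+n a (suc d)) le)))) (arc (a + suc d) (<⇒≤ (<k le))))
          t t<k (<⇒≢ t<k))
        uncut)
        (trans (cong (_⊖ ones 3) (ℚₚ.+-identityʳ (ones k))) (sym (RHS-ones k 3≤k)))
        where
        cut-i : γ i ≢ γ (suc i)
        cut-i eq = ℓ₀≢ℓ₁ (trans (sym (γ₀ i ≤-refl)) (trans eq (γ₁ (suc i) ≤-refl i<j)))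
        cut-j : γ j ≢ γ (suc j)
        cut-j eq = ℓ₁≢ℓ₂ (trans (sym (γ₁ j i<j ≤-refl)) (trans eq (γ₂ (suc j) ≤-refl j<l)))
        cut-l : γ l ≢ γ (suc l)
        cut-l eq = ℓ₀≢ℓ₂ (sym (trans (sym (γ₂ l j<l ≤-refl)) (trans eq (γ₃ (suc l) ≤-refl l<k))))
        uncut : ∀ t → t < k → t ∉ i ∷ j ∷ l ∷ [] → γ t ≡ γ (suc t)
        uncut t t<k t∉ with t ≤? i | t ≤? j | t ≤? l
        ... | yes p | _     | _     = trans (γ₀ t p) (sym (γ₀ (suc t) (≤∧≢⇒< p λ eq → t∉ (here eq))))
        ... | no p  | yes q | _     = trans (γ₁ t (≰⇒> p) q)
          (sym (γ₁ (suc t) (m<n⇒m<1+n (≰⇒> p)) (≤∧≢⇒< q λ eq → t∉ (there (here eq)))))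
        ... | no _  | no q  | yes s = trans (γ₂ t (≰⇒> q) s)
          (sym (γ₂ (suc t) (m<n⇒m<1+n (≰⇒> q)) (≤∧≢⇒< s λ eq → t∉ (there (there (here eq))))))
        ... | no _  | no _  | no s  = trans (γ₃ t (≰⇒> s) (<⇒≤ t<k)) (sym (γ₃ (suc t) (m<n⇒m<1+n (≰⇒> s)) t<k))

    module _ {ℓ₀ ℓ : Fin n} (ℓ₀≢ℓ : ℓ₀ ≢ ℓ) {i l : ℕ} (i<l : i < l) (l≤2d : l ≤ d + d)
      (γ₀ : ∀ t → t ≤ i → γ t ≡ ℓ₀) (γ₁ : ∀ t → i < t → t ≤ l → γ t ≡ ℓ)
      (γ₂ : ∀ t → l < t → t ≤ k → γ t ≡ ℓ₀) where

      private
        data Arc₂ (t : ℕ) : Fin n → Set where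
          arc₀ : t ≤ i → Arc₂ t ℓ₀
          arc₁ : i < t → t ≤ l → Arc₂ t ℓ
          arc₂ : l < t → Arc₂ t ℓ₀

        arc′ : ∀ t → t ≤ k → Arc₂ t (γ t)
        arc′ t t≤k with t ≤? i | t ≤? l
        ... | yes p | _     = subst (Arc₂ t) (sym (γ₀ t p)) (arc₀ p)
        ... | no p  | yes q = subst (Arc₂ t) (sym (γ₁ t (≰⇒> p) q)) (arc₁ (≰⇒> p) q)
        ... | no _  | no q  = subst (Arc₂ t) (sym (γ₂ t (≰⇒> q) t≤k)) (arc₂ (≰⇒> q))

        i<k = <k (≤-trans (<⇒≤ i<l) l≤2d)
        l<k = <k l≤2d

        tight-one-chord : ∀ c → c < k → γ c ≡ γ (c + d) →
          (∀ a → a + d ≤ d + d → a ≢ c → ∀ {x y} → Arc₂ a x → Arc₂ (a + d) y → x ≢ y) →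
          (∀ a → a + suc d ≤ d + d → a + suc d ≢ c → ∀ {x y} → Arc₂ a x → Arc₂ (a + suc d) y → x ≢ y) →
          α (lmcVec D) ≡ β
        tight-one-chord c c<k uncut-c short long = trans (value-≡ D {c ∷ []} {i ∷ l ∷ []} (∅ ∷ᵘ []ᵘ)
          ((<⇒≢ i<l ◂ ∅) ∷ᵘ ∅ ∷ᵘ []ᵘ) (c<k ◂ ∅) (i<k ◂ l<k ◂ ∅) (uncut-c ◂ ∅) (cut-i ◂ cut-l ◂ ∅)
          (λ t t<k t∉ → chords-cut c
            (λ a le a≢c → short a le a≢c (arc′ a (<⇒≤ (<k (≤-trans (m≤m+n a d) le)))) (arc′ (a + d) (<⇒≤ (<k le))))
            (λ a le a≢c → long a le a≢c (arc′ a (<⇒≤ (<k (≤-trans (m≤m+n a (suc d)) le)))) (arc′ (a + suc d) (<⇒≤ (<k le))))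
            t t<k (λ eq → t∉ (here eq)))
          uncut)
          (trans (collect (ones k)) (sym (RHS-ones k 3≤k)))
          where
          collect : ∀ x → (x ⊖ (1ℚ ⊕ 0ℚ)) ⊖ (1ℚ ⊕ (1ℚ ⊕ 0ℚ)) ≡ x ⊖ (1ℚ ⊕ (1ℚ ⊕ (1ℚ ⊕ 0ℚ)))
          collect = Ring.solve-∀ ringℚ
          cut-i : γ i ≢ γ (suc i)
          cut-i eq = ℓ₀≢ℓ (trans (sym (γ₀ i ≤-refl)) (trans eq (γ₁ (suc i) ≤-refl i<l)))
          cut-l : γ l ≢ γ (suc l)
          cut-l eq = ℓ₀≢ℓ (sym (trans (sym (γ₁ l i<l ≤-refl)) (trans eq (γ₂ (suc l) ≤-refl l<k))))
          uncut : ∀ t → t < k → t ∉ i ∷ l ∷ [] → γ t ≡ γ (suc t)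
          uncut t t<k t∉ with t ≤? i | t ≤? l
          ... | yes p | _     = trans (γ₀ t p) (sym (γ₀ (suc t) (≤∧≢⇒< p λ eq → t∉ (here eq))))
          ... | no p  | yes q = trans (γ₁ t (≰⇒> p) q)
            (sym (γ₁ (suc t) (m<n⇒m<1+n (≰⇒> p)) (≤∧≢⇒< q λ eq → t∉ (there (here eq)))))
          ... | no _  | no q  = trans (γ₂ t (≰⇒> q) (<⇒≤ t<k)) (sym (γ₂ (suc t) (m<n⇒m<1+n (≰⇒> q)) t<k))

      -- The arc ]i , i + d + 1] has d + 1 points, and its only half-chord joins the first to the
      -- last; the other arc has d points and none.
      tight-1+d : l ≡ i + suc d → α (lmcVec D) ≡ β
      tight-1+d refl = tight-one-chord (suc i) (<k (≤-trans i<l l≤2d))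
        (trans (γ₁ (suc i) ≤-refl i<l) (sym (γ₁ (suc i + d) (s≤s (m≤m+n i d)) (≤-reflexive (sym (+-suc i d))))))
        short long
        where
        short : ∀ a → a + d ≤ d + d → a ≢ suc i → ∀ {x y} → Arc₂ a x → Arc₂ (a + d) y → x ≢ y
        short a le a≢ (arc₀ _)     (arc₁ _ _)   eq = ℓ₀≢ℓ eq
        short a le a≢ (arc₁ _ _)   (arc₀ _)     eq = ℓ₀≢ℓ (sym eq)
        short a le a≢ (arc₁ _ _)   (arc₂ _)     eq = ℓ₀≢ℓ (sym eq)
        short a le a≢ (arc₂ _)     (arc₁ _ _)   eq = ℓ₀≢ℓ eq
        short a le a≢ (arc₀ a≤i)   (arc₀ b≤i)   eq = ¬linear 0 (b≤i ⊹ l≤2d ⊹ z≤n {a}) (solve (a ∷ i ∷ d ∷ []))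
        short a le a≢ (arc₀ a≤i)   (arc₂ l<b)   eq = ¬linear 1 (a≤i ⊹ l<b) (solve (a ∷ i ∷ d ∷ []))
        short a le a≢ (arc₁ i<a _) (arc₁ _ b≤l) eq = a≢ (≤-antisym (linear 0 b≤l (solve (a ∷ i ∷ d ∷ []))) i<a)
        short a le a≢ (arc₂ l<a)   _            eq = ¬linear (1 + i) (l<a ⊹ le) (solve (a ∷ i ∷ d ∷ []))
        long : ∀ a → a + suc d ≤ d + d → a + suc d ≢ suc i → ∀ {x y} → Arc₂ a x → Arc₂ (a + suc d) y → x ≢ y
        long a le a≢ (arc₀ _)     (arc₁ _ _)   eq = ℓ₀≢ℓ eq
        long a le a≢ (arc₁ _ _)   (arc₀ _)     eq = ℓ₀≢ℓ (sym eq)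
        long a le a≢ (arc₁ _ _)   (arc₂ _)     eq = ℓ₀≢ℓ (sym eq)
        long a le a≢ (arc₀ a≤i)   (arc₀ b≤i)   eq = ¬linear 1 (b≤i ⊹ l≤2d ⊹ z≤n {a}) (solve (a ∷ i ∷ d ∷ []))
        long a le a≢ (arc₀ a≤i)   (arc₂ l<b)   eq = ¬linear 0 (a≤i ⊹ l<b) (solve (a ∷ i ∷ d ∷ []))
        long a le a≢ (arc₁ i<a _) (arc₁ _ b≤l) eq = ¬linear 0 (i<a ⊹ b≤l) (solve (a ∷ i ∷ d ∷ []))
        long a le a≢ (arc₂ l<a)   _            eq = ¬linear (2 + i) (l<a ⊹ le) (solve (a ∷ i ∷ d ∷ []))

      -- Here the complement of ]i , i + d] has d + 1 points, and its half-chord runs from i + d + 1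
      -- to i + k. The index of this half-chord is i + d + 1 if i < d and wraps to 0 if i = d.
      tight-d : l ≡ i + d → α (lmcVec D) ≡ β
      tight-d refl with i <? d
      ... | yes i<d = tight-one-chord (suc (i + d)) c<k uncut-c short long
        where
        c<k : suc (i + d) < k
        c<k = <k (+-monoˡ-≤ d i<d)
        uncut-c : γ (suc (i + d)) ≡ γ (suc (i + d) + d)
        uncut-c = trans (γ₂ (suc (i + d)) ≤-refl (<⇒≤ c<k)) (sym (trans (cong γ wrapped) (trans (g-periodic D i) (γ₀ i ≤-refl))))
          where
          wrapped : suc (i + d) + d ≡ i + k
          wrapped = trans (trans (cong suc (+-assoc i d d)) (sym (+-suc i (d + d)))) (cong (i +_) (sym k≡))
        short : ∀ a → a + d ≤ d + d → a ≢ suc (i + d) → ∀ {x y} → Arc₂ a x → Arc₂ (a + d) y → x ≢ y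
        short a le a≢ (arc₀ _)     (arc₁ _ _)   eq = ℓ₀≢ℓ eq
        short a le a≢ (arc₁ _ _)   (arc₀ _)     eq = ℓ₀≢ℓ (sym eq)
        short a le a≢ (arc₁ _ _)   (arc₂ _)     eq = ℓ₀≢ℓ (sym eq)
        short a le a≢ (arc₂ _)     (arc₁ _ _)   eq = ℓ₀≢ℓ eq
        short a le a≢ (arc₀ a≤i)   (arc₀ b≤i)   eq = ¬linear 0 (b≤i ⊹ i<d ⊹ z≤n {a}) (solve (a ∷ i ∷ d ∷ []))
        short a le a≢ (arc₀ a≤i)   (arc₂ l<b)   eq = ¬linear 0 (a≤i ⊹ l<b) (solve (a ∷ i ∷ d ∷ []))
        short a le a≢ (arc₁ i<a _) (arc₁ _ b≤l) eq = ¬linear 0 (i<a ⊹ b≤l) (solve (a ∷ i ∷ d ∷ []))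
        short a le a≢ (arc₂ l<a)   _            eq = ¬linear i (l<a ⊹ le) (solve (a ∷ i ∷ d ∷ []))
        long : ∀ a → a + suc d ≤ d + d → a + suc d ≢ suc (i + d) → ∀ {x y} → Arc₂ a x → Arc₂ (a + suc d) y → x ≢ y
        long a le a≢ (arc₀ _)     (arc₁ _ _)   eq = ℓ₀≢ℓ eq
        long a le a≢ (arc₁ _ _)   (arc₀ _)     eq = ℓ₀≢ℓ (sym eq)
        long a le a≢ (arc₁ _ _)   (arc₂ _)     eq = ℓ₀≢ℓ (sym eq)
        long a le a≢ (arc₀ a≤i)   (arc₀ b≤i)   eq = ¬linear 1 (b≤i ⊹ i<d ⊹ z≤n {a}) (solve (a ∷ i ∷ d ∷ []))
        long a le a≢ (arc₀ a≤i)   (arc₂ l<b)   eq =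
          a≢ (trans (+-suc a d) (cong (λ z → suc (z + d)) (≤-antisym a≤i (linear 0 l<b (solve (a ∷ i ∷ d ∷ []))))))
        long a le a≢ (arc₁ i<a _) (arc₁ _ b≤l) eq = ¬linear 1 (i<a ⊹ b≤l) (solve (a ∷ i ∷ d ∷ []))
        long a le a≢ (arc₂ l<a)   _            eq = ¬linear (1 + i) (l<a ⊹ le) (solve (a ∷ i ∷ d ∷ []))
      ... | no i≮d = tight-one-chord 0 (<k z≤n) (trans (γ₀ 0 z≤n) (sym (γ₀ d d≤i))) short long
        where
        d≤i : d ≤ i
        d≤i = ≮⇒≥ i≮d
        i≤d : i ≤ d
        i≤d = +-cancelʳ-≤ d i d l≤2d
        short : ∀ a → a + d ≤ d + d → a ≢ 0 → ∀ {x y} → Arc₂ a x → Arc₂ (a + d) y → x ≢ y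
        short a le a≢ (arc₀ _)     (arc₁ _ _)   eq = ℓ₀≢ℓ eq
        short a le a≢ (arc₁ _ _)   (arc₀ _)     eq = ℓ₀≢ℓ (sym eq)
        short a le a≢ (arc₁ _ _)   (arc₂ _)     eq = ℓ₀≢ℓ (sym eq)
        short a le a≢ (arc₂ _)     (arc₁ _ _)   eq = ℓ₀≢ℓ eq
        short a le a≢ (arc₀ a≤i)   (arc₀ b≤i)   eq = a≢ (n≤0⇒n≡0 (linear 0 (b≤i ⊹ i≤d) (solve (a ∷ i ∷ d ∷ []))))
        short a le a≢ (arc₀ a≤i)   (arc₂ l<b)   eq = ¬linear 0 (a≤i ⊹ l<b) (solve (a ∷ i ∷ d ∷ []))
        short a le a≢ (arc₁ i<a _) (arc₁ _ b≤l) eq = ¬linear 0 (i<a ⊹ b≤l) (solve (a ∷ i ∷ d ∷ []))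
        short a le a≢ (arc₂ l<a)   _            eq = ¬linear i (l<a ⊹ le) (solve (a ∷ i ∷ d ∷ []))
        long : ∀ a → a + suc d ≤ d + d → a + suc d ≢ 0 → ∀ {x y} → Arc₂ a x → Arc₂ (a + suc d) y → x ≢ y
        long a le a≢ (arc₀ _)     (arc₁ _ _)   eq = ℓ₀≢ℓ eq
        long a le a≢ (arc₁ _ _)   (arc₀ _)     eq = ℓ₀≢ℓ (sym eq)
        long a le a≢ (arc₁ _ _)   (arc₂ _)     eq = ℓ₀≢ℓ (sym eq)
        long a le a≢ (arc₀ a≤i)   (arc₀ b≤i)   eq = ¬linear a (b≤i ⊹ i≤d) (solve (a ∷ i ∷ d ∷ []))
        long a le a≢ (arc₀ a≤i)   (arc₂ l<b)   eq = ¬linear 0 (le ⊹ l<b ⊹ d≤i) (solve (a ∷ i ∷ d ∷ []))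
        long a le a≢ (arc₁ i<a _) (arc₁ _ b≤l) eq = ¬linear 1 (i<a ⊹ b≤l) (solve (a ∷ i ∷ d ∷ []))
        long a le a≢ (arc₂ l<a)   _            eq = ¬linear (1 + i) (l<a ⊹ le) (solve (a ∷ i ∷ d ∷ []))

  -- A monotone polygon gives a facet

  module _ (F : Frame {n}) (pos-0 : Frame.pos F (u 0) ≡ 0)
           (pos-mono : ∀ {s t} → s < t → t < k → Frame.pos F (u s) < Frame.pos F (u t)) where

    open Frame F

    private
      R : ℕ → ℕ
      R t = pos (u t)

      module Cut = Intervals F (ℓ₀≢ℓ₁) (ℓ₀≢ℓ₂) (ℓ₁≢ℓ₂)

      R-k : R k ≡ 0
      R-k = trans (cong pos (at-periodic 0)) pos-0

    -- The boundary e lies between v_i and v_{i+1}.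
    record Segment (i e : ℕ) : Set where
      field
        left  : ∀ {t} → t ≤ i → R t < e
        right : ∀ {t} → i < t → t < k → e ≤ R t

    open Segment

    segment-suc : ∀ i → i < k → Segment i (suc (R i))
    segment-suc i i<k = record
      { left  = λ {t} t≤i → s≤s ([ (λ t<i → <⇒≤ (pos-mono t<i i<k)) , (λ eq → ≤-reflexive (cong R eq)) ]′ (m≤n⇒m<n∨m≡n t≤i))
      ; right = pos-mono
      }

    segment-of : ∀ {e} → 0 < e → ∃ λ i → i ≤ d + d × Segment i e
    segment-of {e} 0<e = search (d + d) ≤-refl λ t<t′ t′<k → contradiction (<-≤-trans t<t′ (≤-pred (subst (_ <_) k≡ t′<k))) (<-irrefl refl)
      where
      search : ∀ m → m ≤ d + d → (∀ {t} → m < t → t < k → e ≤ R t) → ∃ λ i → i ≤ d + d × Segment i e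
      search m m≤ beyond with R m <? e
      ... | yes Rm<e = m , m≤ , record
        { left  = λ {t} t≤m → [ (λ t<m → <-trans (pos-mono t<m (<k m≤)) Rm<e) , (λ eq → subst (λ z → R z < e) (sym eq) Rm<e) ]′ (m≤n⇒m<n∨m≡n t≤m)
        ; right = beyond
        }
      search zero    m≤ beyond | no R0≮e = contradiction (subst (_< e) (sym pos-0) 0<e) R0≮e
      search (suc m) m≤ beyond | no Rm≮e = search m (<⇒≤ m≤) λ {t} m<t t<k →
        [ (λ m<t′ → beyond m<t′ t<k) , (λ eq → subst (λ z → e ≤ R z) eq (≮⇒≥ Rm≮e)) ]′ (m≤n⇒m<n∨m≡n m<t)

    segment-mono : ∀ {i j e f} → i < k → e < f → Segment i e → Segment j f → i ≤ j
    segment-mono i<k e<f si sj = ≮⇒≥ λ j<i → <⇒≱ (<-trans (left si ≤-refl) e<f) (right sj j<i i<k)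

    boundary-mono : ∀ {i j e f} → i < j → j < k → Segment i e → Segment j f → e ≤ f
    boundary-mono i<j j<k si sj = <⇒≤ (≤-<-trans (right si i<j j<k) (left sj ≤-refl))

    module _ {i j l e f h} (i≤j : i ≤ j) (j≤l : j ≤ l) (l≤2d : l ≤ d + d)
             (si : Segment i e) (sj : Segment j f) (sl : Segment l h) where

      private
        γ = g (Cut.intervals e f h)

        ≤k : ∀ {t m} → t ≤ m → m ≤ l → t < k
        ≤k t≤m m≤l = <k (≤-trans t≤m (≤-trans m≤l l≤2d))

      label-low : ∀ t → t ≤ i → γ t ≡ ℓ₀
      label-low t t≤i = Cut.label-≡ (Cut.below (left si t≤i))

      label-first : ∀ t → i < t → t ≤ j → γ t ≡ ℓ₁
      label-first t i<t t≤j = Cut.label-≡ (Cut.first (right si i<t (≤k t≤j j≤l)) (left sj t≤j))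

      label-second : ∀ t → j < t → t ≤ l → γ t ≡ ℓ₂
      label-second t j<t t≤l = Cut.label-≡ (Cut.second (right si (≤-<-trans i≤j j<t) t<k) (right sj j<t t<k) (left sl t≤l))
        where t<k = ≤k t≤l ≤-refl

      label-high : ∀ t → l < t → t ≤ k → γ t ≡ ℓ₀
      label-high t l<t t≤k with m≤n⇒m<n∨m≡n t≤k
      ... | inj₁ t<k  = Cut.label-≡ (Cut.above (right si (≤-<-trans (≤-trans i≤j j≤l) l<t) t<k) (right sj (≤-<-trans j≤l l<t) t<k) (right sl l<t t<k))
      -- v_k is v₀ at position 0, in the lower part of the same block.
      ... | inj₂ refl = Cut.label-≡ (Cut.below (subst (_< e) (sym R-k) (≤-<-trans z≤n (left si z≤n))))

    module _ {L : Vect n → ℚ} (L-linear : Linear L)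
             (L-tight : ∀ e f h → e ≤ n → f ≤ n → h ≤ n →
               α (lmcVec (Cut.intervals e f h)) ≡ β → L (lmcVec (Cut.intervals e f h)) ≡ 0ℚ) where

      private
        D : ℕ → ℕ → ℚ
        D e f = L (X pos e f)

        L-sum : ∀ {e f h} → e ≤ f → f ≤ h → h ≤ n → α (lmcVec (Cut.intervals e f h)) ≡ β → (D e f ⊕ D f h) ⊕ D e h ≡ 0ℚ
        L-sum {e} {f} {h} e≤f f≤h h≤n tight = L-intervals F ℓ₀≢ℓ₁ ℓ₀≢ℓ₂ ℓ₁≢ℓ₂ L-linear e≤f f≤h
          (L-tight e f h (≤-trans e≤f f≤n) f≤n h≤n tight)
          where f≤n = ≤-trans f≤h h≤n

        -- Taking the boundary `e` twice empties one block, and the relation for three blocks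
        -- becomes 2 `D e h` = 0.
        L-pair : ∀ {i l e h} → i < l → l ≤ d + d → l ≡ i + d ⊎ l ≡ i + suc d → Segment i e → Segment l h → h ≤ n → D e h ≡ 0ℚ
        L-pair {i} {l} {e} {h} i<l l≤2d gap si sl h≤n = ⊕-self-0 (begin
          D e h ⊕ D e h              ≡⟨ cong (_⊕ D e h) (trans (cong (_⊕ D e h) (null L-linear (X-empty pos e))) (ℚₚ.+-identityˡ (D e h))) ⟨
          (D e e ⊕ D e h) ⊕ D e h    ≡⟨ L-sum ≤-refl (boundary-mono i<l (<k l≤2d) si sl) h≤n
                                          ([ tight-d Δ ℓ₀≢ℓ₂ i<l l≤2d low mid high , tight-1+d Δ ℓ₀≢ℓ₂ i<l l≤2d low mid high ]′ gap) ⟩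
          0ℚ ∎)
          where
          open ≡-Reasoning
          Δ = Cut.intervals e e h
          low = label-low ≤-refl (<⇒≤ i<l) l≤2d si si sl
          mid = label-second ≤-refl (<⇒≤ i<l) l≤2d si si sl
          high = label-high ≤-refl (<⇒≤ i<l) l≤2d si si sl

        -- One boundary per segment turns the values on boundaries into an array indexed by
        -- segments, which satisfies the hypotheses of `D≡0`.
        L-distinct : (rep : ℕ → ℕ) → (∀ i → i < k → Segment i (rep i)) → (∀ i → i < k → rep i ≤ n) →
          ∀ {i j} → i < j → j ≤ d + d → D (rep i) (rep j) ≡ 0ℚ
        L-distinct rep seg rep≤n = D≡0 2≤d (λ i j → D (rep i) (rep j))
          (λ i i≤d → pair-d i (i + d) (m<m+n i 0<d) (+-monoˡ-≤ d i≤d) (inj₁ refl))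
          (λ i i<d → pair-d i (suc (i + d)) (s≤s (m≤m+n i d)) (+-monoˡ-≤ d i<d) (inj₂ (sym (+-suc i d))))
          λ i j l i<j j<l l≤2d j≤i+d l≤j+d i+d<l →
            let l<k = <k l≤2d ; j<k = <-trans j<l l<k ; i<k = <-trans i<j j<k in
            L-sum (boundary-mono i<j j<k (seg i i<k) (seg j j<k)) (boundary-mono j<l l<k (seg j j<k) (seg l l<k)) (rep≤n l l<k)
              (tight-triple (Cut.intervals (rep i) (rep j) (rep l)) ℓ₀≢ℓ₁ ℓ₀≢ℓ₂ ℓ₁≢ℓ₂ i<j j<l l≤2d j≤i+d l≤j+d i+d<l
                (label-low (<⇒≤ i<j) (<⇒≤ j<l) l≤2d (seg i i<k) (seg j j<k) (seg l l<k))
                (label-first (<⇒≤ i<j) (<⇒≤ j<l) l≤2d (seg i i<k) (seg j j<k) (seg l l<k))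
                (label-second (<⇒≤ i<j) (<⇒≤ j<l) l≤2d (seg i i<k) (seg j j<k) (seg l l<k))
                (label-high (<⇒≤ i<j) (<⇒≤ j<l) l≤2d (seg i i<k) (seg j j<k) (seg l l<k)))
          where
          0<d : 0 < d
          0<d = ≤-trans (s≤s z≤n) 2≤d
          pair-d : ∀ i l → i < l → l ≤ d + d → l ≡ i + d ⊎ l ≡ i + suc d → D (rep i) (rep l) ≡ 0ℚ
          pair-d i l i<l l≤2d gap = L-pair i<l l≤2d gap (seg i (<-trans i<l (<k l≤2d))) (seg l (<k l≤2d)) (rep≤n l (<k l≤2d))

      -- Any two boundaries in different segments extend to a choice of representatives; every other
      -- segment takes the position right after its v_t.
      L-different-segments : ∀ {i j e f} → i < j → j ≤ d + d → Segment i e → Segment j f → e ≤ n → f ≤ n → D e f ≡ 0ℚ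
      L-different-segments {i} {j} {e} {f} i<j j≤2d si sj e≤n f≤n =
        subst₂ (λ x y → D x y ≡ 0ℚ) rep-i rep-j (L-distinct rep seg rep≤n i<j j≤2d)
        where
        rep : ℕ → ℕ
        rep t with t ≟ i | t ≟ j
        ... | yes _ | _     = e
        ... | no _  | yes _ = f
        ... | no _  | no _  = suc (R t)
        rep-i : rep i ≡ e
        rep-i with i ≟ i | i ≟ j
        ... | yes _ | _ = refl
        ... | no i≢i | _ = contradiction refl i≢i
        rep-j : rep j ≡ f
        rep-j with j ≟ i | j ≟ j
        ... | yes j≡i | _      = contradiction (sym j≡i) (<⇒≢ i<j)
        ... | no _    | yes _  = refl
        ... | no _    | no j≢j = contradiction refl j≢j
        seg : ∀ t → t < k → Segment t (rep t)
        seg t t<k with t ≟ i | t ≟ j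
        ... | yes refl | _        = si
        ... | no _     | yes refl = sj
        ... | no _     | no _     = segment-suc t t<k
        rep≤n : ∀ t → t < k → rep t ≤ n
        rep≤n t t<k with t ≟ i | t ≟ j
        ... | yes _ | _     = e≤n
        ... | no _  | yes _ = f≤n
        ... | no _  | no _  = pos<n (u t)

      private
        drop : ∀ {x y z} → y ≡ 0ℚ → z ≡ 0ℚ → (x ⊕ y) ⊕ z ≡ 0ℚ → x ≡ 0ℚ
        drop {x} refl refl eq = trans (sym (trans (ℚₚ.+-identityʳ _) (ℚₚ.+-identityʳ x))) eq

        drop′ : ∀ {x y z} → x ≡ 0ℚ → z ≡ 0ℚ → (x ⊕ y) ⊕ z ≡ 0ℚ → y ≡ 0ℚ
        drop′ {x} {y} refl refl eq = trans (sym (trans (ℚₚ.+-identityʳ _) (ℚₚ.+-identityˡ y))) eq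

      -- The block [e , f[ contains no v_t, so a third boundary in a segment at distance d gives a
      -- tight decomposition. Two of the three values in its relation belong to different segments
      -- and vanish. The third segment is i + d or i - d, whichever is in range.
      L-same-segment : ∀ {i e f} → i ≤ d + d → e < f → Segment i e → Segment i f → f ≤ n → D e f ≡ 0ℚ
      L-same-segment {i} {e} {f} i≤2d e<f se sf f≤n with i ≤? d
      ... | yes i≤d = drop
        (L-different-segments i<l l≤2d sf sl f≤n h≤n) (L-different-segments i<l l≤2d se sl (≤-trans (<⇒≤ e<f) f≤n) h≤n)
        (L-sum (<⇒≤ e<f) (boundary-mono i<l (<k l≤2d) sf sl) h≤n
          (tight-d (Cut.intervals e f h) ℓ₀≢ℓ₂ i<l l≤2d
            (label-low ≤-refl (<⇒≤ i<l) l≤2d se sf sl) (label-second ≤-refl (<⇒≤ i<l) l≤2d se sf sl)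
            (label-high ≤-refl (<⇒≤ i<l) l≤2d se sf sl) refl))
        where
        l = i + d
        h = suc (R l)
        i<l : i < l
        i<l = m<m+n i (≤-trans (s≤s z≤n) 2≤d)
        l≤2d : l ≤ d + d
        l≤2d = +-monoˡ-≤ d i≤d
        sl : Segment l h
        sl = segment-suc l (<k l≤2d)
        h≤n : h ≤ n
        h≤n = pos<n (u l)
      ... | no i≰d = drop′
        (L-different-segments l<i i≤2d sl se h≤n (≤-trans (<⇒≤ e<f) f≤n)) (L-different-segments l<i i≤2d sl sf h≤n f≤n)
        (L-sum (boundary-mono l<i (<k i≤2d) sl se) (<⇒≤ e<f) f≤n
          (tight-d (Cut.intervals h e f) ℓ₀≢ℓ₁ l<i i≤2d
            (label-low (<⇒≤ l<i) ≤-refl i≤2d sl se sf) (label-first (<⇒≤ l<i) ≤-refl i≤2d sl se sf)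
            (label-high (<⇒≤ l<i) ≤-refl i≤2d sl se sf)
            (sym (m∸n+n≡m (<⇒≤ (≰⇒> i≰d))))))
        where
        l = i ∸ d
        h = suc (R l)
        l<i : l < i
        l<i = ∸-monoʳ-< (≤-trans (s≤s z≤n) 2≤d) (<⇒≤ (≰⇒> i≰d))
        sl : Segment l h
        sl = segment-suc l (<-trans l<i (<k i≤2d))
        h≤n : h ≤ n
        h≤n = pos<n (u l)

      L-X≡0 : ∀ {e f} → 0 < e → e < f → f ≤ n → L (X pos e f) ≡ 0ℚ
      L-X≡0 {e} {f} 0<e e<f f≤n with segment-of 0<e | segment-of (<-trans 0<e e<f)
      ... | i , i≤2d , si | j , j≤2d , sj with m≤n⇒m<n∨m≡n (segment-mono (<k i≤2d) e<f si sj)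
      ... | inj₁ i<j  = L-different-segments i<j j≤2d si sj (≤-trans (<⇒≤ e<f) f≤n) f≤n
      ... | inj₂ refl = L-same-segment i≤2d e<f si sj f≤n

    module _ (c : Fin (#pairs n) → ℚ) where

      private
        L : Vect n → ℚ
        L x = sumFin (#pairs n) λ i → c i ⊗ entry x i

        L-linear : Linear L
        L-linear = sum-linear (#pairs n) λ i → ⊗-linear (c i) (coordinate-linear _ _)

        Witness : ℕ → ℕ → ℕ → Set
        Witness e f h = α (lmcVec (Cut.intervals e f h)) ≡ β × L (lmcVec (Cut.intervals e f h)) ≢ 0ℚ

        witness? : ∀ e f h → Dec (Witness e f h)
        witness? e f h = (α (lmcVec (Cut.intervals e f h)) ℚₚ.≟ β) ×-dec ¬? (L (lmcVec (Cut.intervals e f h)) ℚₚ.≟ 0ℚ)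

        -- `L-X≡0` asks only for boundaries up to `n`, so a tight decomposition with nonzero value
        -- can be found by a finite, decidable search.
        Witnessed : Set
        Witnessed = ∃ λ (e : Fin (suc n)) → ∃ λ (f : Fin (suc n)) → ∃ λ (h : Fin (suc n)) → Witness (toℕ e) (toℕ f) (toℕ h)

        witnessed? : Dec Witnessed
        witnessed? = Finₚ.any? λ e → Finₚ.any? λ f → Finₚ.any? λ h → witness? (toℕ e) (toℕ f) (toℕ h)

        toWitnessed : ∀ {e f h} → e ≤ n → f ≤ n → h ≤ n → Witness e f h → Witnessed
        toWitnessed {e} {f} {h} e≤n f≤n h≤n w = Fin.fromℕ< (s≤s e≤n) , Fin.fromℕ< (s≤s f≤n) , Fin.fromℕ< (s≤s h≤n) ,
          subst (λ x → Witness x _ _) (sym (Finₚ.toℕ-fromℕ< (s≤s e≤n)))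
            (subst₂ (Witness e) (sym (Finₚ.toℕ-fromℕ< (s≤s f≤n))) (sym (Finₚ.toℕ-fromℕ< (s≤s h≤n))) w)

        ¬witnessed⇒0 : ¬ Witnessed → ∀ i → c i ≡ 0ℚ
        ¬witnessed⇒0 none i = begin
          c i
            ≡⟨ sum-δ-⊗ (#pairs n) i c ⟨
          sumFin (#pairs n) (λ j → c j ⊗ δ (toℕ i) (toℕ j))
            ≡⟨ sum-cong (#pairs n) (λ j → cong (c j ⊗_) (E-entry pos pos-injective i j)) ⟨
          L (E pos a b)
            ≡⟨ L-E pos pos<n L-linear (L-X≡0 L-linear L-tight) a b (λ eq → <⇒≢ (pair-< n i) (cong toℕ (pos-injective eq))) ⟩
          0ℚ ∎
          where
          open ≡-Reasoning
          a = proj₁ (pair n i)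
          b = proj₂ (pair n i)
          L-tight : ∀ e f h → e ≤ n → f ≤ n → h ≤ n →
            α (lmcVec (Cut.intervals e f h)) ≡ β → L (lmcVec (Cut.intervals e f h)) ≡ 0ℚ
          L-tight e f h e≤n f≤n h≤n tight =
            decidable-stable (L (lmcVec (Cut.intervals e f h)) ℚₚ.≟ 0ℚ) λ neq → none (toWitnessed e≤n f≤n h≤n (tight , neq))

      face-spanning : (∃ λ i → c i ≢ 0ℚ) → ∃ λ Δ → α (lmcVec Δ) ≡ β × L (lmcVec Δ) ≢ 0ℚ
      face-spanning (i , cᵢ≢0) = case witnessed? of λ where
        (yes (e , f , h , w)) → Cut.intervals (toℕ e) (toℕ f) (toℕ h) , w
        (no none)             → contradiction (¬witnessed⇒0 none i) cᵢ≢0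

    increasing⇒facet : FacetDefining (LMC n) α β
    increasing⇒facet = spanning⇒facet (α-linear) (λ Δ → value-≤-k-3 Δ)
      (RHS≢0) (single-block) (single-block≡0)
      face-spanning (#pairs n ∸ 1) (sym (m+[n∸m]≡n (#pairs>0 (≤-trans (subst (2 ≤_) (sym k≡) (s≤s (≤-trans (s≤s z≤n) (≤-trans 2≤d (m≤m+n d d))))) k≤n))))
      where
      #pairs>0 : ∀ {n} → 2 ≤ n → 1 ≤ #pairs n
      #pairs>0 {suc (suc n)} _ = s≤s z≤n
      #pairs>0 {suc zero} (s≤s ())

  private
    k-2 : ∀ {i} → suc i < k → i ≤ k ∸ 2
    k-2 {suc i} i<k = ∸-monoˡ-≤ 2 i<k
    k-2 {zero}  i<k = z≤n

    chain : ∀ {R : ℕ → ℕ} → (∀ i → suc i < k → R i < R (suc i)) → ∀ {s t} → s < t → t < k → R s < R t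
    chain step {s} {suc t} (s≤s s≤t) t<k with m≤n⇒m<n∨m≡n s≤t
    ... | inj₁ s<t  = <-trans (chain step s<t (<⇒≤ t<k)) (step t t<k)
    ... | inj₂ refl = step s t<k

    fdist-self : fdist (u 0) (u 0) ≡ 0
    fdist-self = fdist-unique (≤-trans (s≤s z≤n) 3≤n) (+ₘ-0 (u 0))

  -- In the second case positions are counted against the orientation, by the distance to v₀, which
  -- makes the sequence increasing again.
  trueTo⇒facet : TrueTo v → FacetDefining (LMC n) α β
  trueTo⇒facet (inj₁ forwards) = increasing⇒facet (forward (u 0)) fdist-self (chain step)
    where
    step : ∀ i → suc i < k → fdist (u 0) (u i) < fdist (u 0) (u (suc i))
    step i i<k with forwards i (k-2 i<k)
    ... | le , neq = ≤∧≢⇒< le λ eq → neq (fdist-injective {o = u 0} eq)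
  trueTo⇒facet (inj₂ backwards) = increasing⇒facet (backward (u 0)) fdist-self (chain step)
    where
    open ≡-Reasoning
    step : ∀ i → suc i < k → fdist (u i) (u 0) < fdist (u (suc i)) (u 0)
    step i i<k with backwards i (k-2 i<k)
    ... | le , neq = subst (_< t) (sym remaining) (∸-monoʳ-< s>0 le)
      where
      a = u i
      b = u (suc i)
      s = fdist b a
      t = fdist b (u 0)
      s>0 : 0 < s
      s>0 = ≤∧≢⇒< z≤n λ 0≡s → neq (begin
        a            ≡⟨ +ₘ-fdist b a ⟨
        b +ₘ s       ≡⟨ cong (b +ₘ_) 0≡s ⟨
        b +ₘ 0       ≡⟨ +ₘ-0 b ⟩
        b ∎)
      -- v_i lies on the way forward from v_{i+1} to v₀, so the distances subtract.
      remaining : fdist a (u 0) ≡ t ∸ s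
      remaining = fdist-unique (≤-<-trans (m∸n≤m t s) (fdist<n b (u 0))) (begin
        a +ₘ (t ∸ s)              ≡⟨ cong (_+ₘ (t ∸ s)) (+ₘ-fdist b a) ⟨
        (b +ₘ s) +ₘ (t ∸ s)       ≡⟨ +ₘ-+ b s (t ∸ s) ⟩
        b +ₘ (s + (t ∸ s))        ≡⟨ cong (b +ₘ_) (m+[n∸m]≡n le) ⟩
        b +ₘ t                    ≡⟨ +ₘ-fdist b (u 0) ⟩
        u 0 ∎)

theorem7p22 : ∀ (k n : ℕ) .{{_ : NonZero k}} .{{_ : NonZero n}} →
    5 ≤ k → k ≤ n → k % 2 ≡ 1 →
    (v : Fin k → Fin n) → Injective _≡_ _≡_ v →
    FacetDefining (LMC n) (halfChordedLHS v) (halfChordedRHS k) ⇔ TrueTo v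
theorem7p22 k n 5≤k k≤n k-odd v v-injective = mk⇔
  (facet⇒trueTo v v-injective k≡ refl 2≤d k≤n) (trueTo⇒facet v v-injective k≡ refl 2≤d k≤n)
  where
  d = k / 2
  k≡ : k ≡ suc (d + d)
  k≡ = trans (m≡m%n+[m/n]*n k 2) (cong₂ _+_ k-odd (trans (*-comm d 2) (cong (d +_) (+-identityʳ d))))
  2≤d : 2 ≤ d
  2≤d = /-monoˡ-≤ 2 5≤k
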